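{- Let $r$ and $k$ be natural numbers such that $r\ge k+2$ and $k\ge 12$. Then (a) $F_v(2_r;r-k+1)\ge r+k+11$; (b) if $k=12$ and $r\ge 22$, then $F_v(2_r;r-11)=r+23$.
   Context: All graphs are finite, simple and undirected; $\omega(G)$ denotes the clique number. For positive integers $a_1,\dots,a_r$, $G\overset{v}{\to}(a_1,\dots,a_r)$ means that for every partition $V(G)=V_1\cup\dots\cup V_r$ into pairwise disjoint (possibly empty) sets some $V_i$ contains an $a_i$-clique. $(2_r)$ denotes the sequence of $r$ twos. $H_v(a_1,\dots,a_r;q)$ is the set of graphs $G$ with $G\overset{v}{\to}(a_1,\dots,a_r)$ and $\omega(G)<q$, and $F_v(a_1,\dots,a_r;q)=\min\{|V(G)|:G\in H_v(a_1,\dots,a_r;q)\}$ (it exists iff $q>\max\{a_1,\dots,a_r\}$). Equivalently, $F_v(2_r;q)$ is the minimum number of vertices of a graph with chromatic number at least $r+1$ and clique number less than $q$. -}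

module Defs where

open import Data.Nat using (ℕ; _≤_)
open import Data.Fin using (Fin)
open import Data.Bool using (Bool; true; false)
open import Data.Product using (Σ; ∃; _×_)
open import Relation.Binary.PropositionalEquality using (_≡_; _≢_)
open import Relation.Nullary using (¬_)

record Graph (n : ℕ) : Set where
  field
    adj    : Fin n → Fin n → Bool
    sym    : ∀ x y → adj x y ≡ adj y x
    irrefl : ∀ x → adj x x ≡ false
open Graph public

-- An a-clique in G: a map from Fin a to the vertices whose images of
-- distinct indices are adjacent (hence distinct, by irreflexivity).
IsClique : ∀ {n} → Graph n → (a : ℕ) → (Fin a → Fin n) → Set
IsClique G a f = ∀ i j → i ≢ j → adj G (f i) (f j) ≡ true

CliqueLt : ∀ {n} → Graph n → ℕ → Set
CliqueLt G q = ¬ (Σ (Fin q → Fin _) λ f → IsClique G q f)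

-- A partition V(G) = V_1 ∪ … ∪ V_r (parts possibly empty) is a map c : Fin n → Fin r.
-- G →v (a_1,…,a_r): for every such partition some V_i contains an a_i-clique.
VArrows : ∀ {n} → Graph n → (r : ℕ) → (Fin r → ℕ) → Set
VArrows {n} G r a = ∀ (c : Fin n → Fin r) →
  ∃ λ (i : Fin r) → Σ (Fin (a i) → Fin n) λ f →
    IsClique G (a i) f × (∀ j → c (f j) ≡ i)

InHv : ∀ {n} → Graph n → (r : ℕ) → (Fin r → ℕ) → ℕ → Set
InHv G r a q = VArrows G r a × CliqueLt G q

twos : (r : ℕ) → Fin r → ℕ
twos r _ = 2

FvAtLeast : (r : ℕ) → (Fin r → ℕ) → ℕ → ℕ → Set
FvAtLeast r a q b = ∀ (n : ℕ) (G : Graph n) → InHv G r a q → b ≤ n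

FvIs : (r : ℕ) → (Fin r → ℕ) → ℕ → ℕ → Set
FvIs r a q m = (Σ (Graph m) λ G → InHv G r a q) × FvAtLeast r a q m

-- The numbers n - χ(G) and χ(G) - ω(G) decrease by at least 2 and at most 1 when an independent triple
-- is deleted (by at least 1 and at most 1 for a pair), so it suffices to treat graphs G with
-- independence number at most 2 and χ(G) - ω(G) ≤ 13. There the complement H is triangle-free,
-- χ(G) = n - ν(H) and ω(G) = α(H), and the claim is a lower bound for the matching number ν(H) in
-- terms of n - ν(H) - α(H). Deleting a vertex covered by all maximum matchings, or separating the
-- components, preserves a counterexample; by Gallai's lemma only n = 2 ν(H) + 1 remains, where the
-- claim says that R(3, a + 1) does not exceed certain numbers for a ≤ 9, the last being R(3, 10) ≤ 43.
--
-- Let E(k, n) be the least number of edges of a triangle-free graph on n vertices without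
-- independent k-sets. The non-neighbours of v span e - Σ_{u ~ v} deg u edges, and averaging this over
-- v bounds E(k + 1, ·) in terms of E(k, ·). The few values where averaging is not sharp enough are
-- improved by classification: averaging produces a vertex whose non-neighbours span one of finitely
-- many known graphs X, and the given graph is X together with the cones N(u) ∩ X, u ~ v, of which
-- each large independent set of X is missed by very few. Weights on these sets give every cone
-- a price, and the total price is bounded, which keeps the search for systems of cones small.
-- On 43 vertices, two adjacent vertices of degree less than 9 contradict the resulting edge bounds.
--
-- In (b), the join of a clique with the complement of a triangle-free circulant graph of order 45
-- and independence number 10 attains the bound.

module Submission where

open import Defs renaming (sym to adj-symmetric; irrefl to adj-irreflexive)
open import Agda.Builtin.Nat using (div-helper; mod-helper)
open import Data.Bool using (Bool; true; false; if_then_else_; not; _∧_; _∨_; T)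
import Data.Bool.Properties as Boolₚ
open import Data.Bool.ListAction using (all; any)
open import Data.Empty using (⊥; ⊥-elim)
open import Data.Fin.Base using (Fin; toℕ; fromℕ<; inject≤)
import Data.Fin.Properties as Finₚ
open import Data.List.Base
  using (List; []; _∷_; _++_; map; length; filterᵇ; filter; replicate; upTo; zip; zipWith; reverse; take; tabulate; allFin; lookup)
import Data.List.Properties as Lₚ
open import Data.List.Membership.Propositional using (_∈_; _∉_)
open import Data.List.Membership.Propositional.Properties
  using (∈-∃++; ∈-++⁺ˡ; ∈-++⁺ʳ; ∈-++⁻; ∈-map⁺; ∈-map⁻; ∈-filter⁺; ∈-filter⁻; ∈-upTo⁺; ∈-allFin; ∈-lookup)
import Data.List.Membership.DecPropositional as DecMembership
open import Data.List.Relation.Unary.Any using (here; there)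
open import Data.List.Relation.Unary.All as All using (All; []; _∷_)
import Data.List.Relation.Unary.All.Properties as Allₚ
open import Data.List.Relation.Unary.AllPairs as AllPairs using (AllPairs; []; _∷_)
import Data.List.Relation.Unary.AllPairs.Properties as APₚ
import Data.List.Relation.Unary.Linked.Properties as Linkedₚ
open import Data.List.Relation.Unary.Unique.Propositional using (Unique)
import Data.List.Relation.Unary.Unique.Propositional.Properties as Uniqueₚ
open import Data.List.Relation.Binary.Permutation.Propositional as ↭ using (_↭_; prep; ↭-sym; ↭-trans; ↭-refl)
open import Data.List.Relation.Binary.Permutation.Propositional.Properties using (∈-resp-↭; All-resp-↭; ↭-length; ++⁺; shift)
open import Data.List.Sort.Base using (module SortingAlgorithm)
import Data.List.Sort.InsertionSort as IS
open import Data.Maybe.Base using (Maybe; just; nothing)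
open import Data.Nat renaming (_≟_ to _≟ℕ_)
open import Data.Nat.Properties hiding (_≟_)
open import Data.Nat.Divisibility using (divides)
open import Data.Nat.DivMod using (+-distrib-/-∣ʳ; m<n⇒m/n≡0; m*n/n≡m; [m+kn]%n≡m%n; m<n⇒m%n≡m; /-monoˡ-≤)
open import Data.Nat.ListAction using (sum)
open import Data.Nat.Solver using (module +-*-Solver)
open import Data.Product using (∃; ∃₂; _×_; _,_; proj₁; proj₂)
open import Data.Sum using (_⊎_; inj₁; inj₂)
open import Function.Base using (_∘_; id)
open import Function.Bundles using (mk⇔)
import Relation.Binary.Construct.On as On
open import Relation.Binary.Definitions using (DecidableEquality)
open import Relation.Binary.PropositionalEquality
open import Relation.Nullary using (¬_; Dec; yes; no; does)
open import Relation.Nullary.Decidable using (T?; _×-dec_; ¬?; does-⇔; dec-true; dec-false; decidable-stable)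

open DecMembership _≟ℕ_ using () renaming (_∈?_ to _∈?ℕ_)

-- The turning point d = 13 and the values of `bound` come from R(3, 10) ≤ 43. If n = 2 k + 1 and n
-- - ν(H) exceeds α(H) by at least d, then α(H) ≤ k + 1 - d; for d = 13 and k = 21 this would be a
-- triangle-free graph on 43 vertices without independent 10-sets. So 22 is reached at d = 13. The
-- smaller values are chosen to grow by at most 2 per step, which pays for deleting a triple, and to
-- survive splitting d over separated parts; they need only weak Ramsey bounds.
--
-- The classifications are carried out by evaluation. Therefore sets are coded as numbers, and an
-- intersection costs one multiplication and one division. Neither the weights nor the isomorphism
-- search have to be trusted: any weights give a valid price bound, and every isomorphism that is
-- found is checked.
--
-- Matchings are functions, and whether a maximum matching misses a given vertex is not decided.
-- Extremal objects exist only up to double negation, which is harmless, because the goals are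
-- absurdity or a decidable inequality.

-- Bit matrices and the search for systems of cones

Row : Set
Row = List Bool

-- The strict upper triangle of an adjacency matrix: each row lists only the later vertices, so
-- deleting the first vertex means taking the tail.
Tri : Set
Tri = List Row

bit : Bool → ℕ
bit true = 1
bit false = 0

count : Row → ℕ
count [] = 0
count (b ∷ r) = bit b + count r

disjoint : Row → Row → Bool
disjoint [] _ = true
disjoint (_ ∷ _) [] = true
disjoint (true ∷ r) (true ∷ z) = false
disjoint (true ∷ r) (false ∷ z) = disjoint r z
disjoint (false ∷ r) (_ ∷ z) = disjoint r z

extend : Row → List Row → List Row
extend r I = map (false ∷_) I ++ map (true ∷_) (filterᵇ (disjoint r) I)

indSets : Tri → List Row
indSets [] = [] ∷ []
indSets (r ∷ X) = extend r (indSets X)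

fromBits : ℕ → ℕ → Row
fromBits zero n = []
fromBits (suc m) n = (n % 2 ≡ᵇ 1) ∷ fromBits m (n / 2)

-- Rows are stored as numbers, least significant bit first; the length of a row is the number of
-- rows after it.
decode : List ℕ → Tri
decode [] = []
decode (x ∷ xs) = fromBits (length xs) x ∷ decode xs

enc renc : Row → ℕ
enc [] = 0
enc (b ∷ r) = bit b + 32 * enc r
renc [] = 0
renc (b ∷ r) = bit b * 32 ^ length r + renc r

-- This is `(c * z) / (w + 1) % 32`, written with the primitives behind `/` and `%`. Base 32 leaves
-- room for intersections of up to 31 elements without carries.
meet : ℕ → ℕ → ℕ → ℕ
meet w c z = mod-helper 0 31 (div-helper 0 w (c * z) w) 31

-- A candidate for the cone of a neighbour v of the root vertex: its intersection with the graph X on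
-- the non-neighbours, as a bit list and as a number in base 32, its size, its price, and the (k - 2)-
-- and (k - 3)-sets of X that are independent and miss it.
data Cand : Set where
  cand : (row : Row) (code size h : ℕ) (m₁ m₂ : List ℕ) → Cand

row : Cand → Row
row (cand r _ _ _ _ _) = r
code size h : Cand → ℕ
code (cand _ c _ _ _ _) = c
size (cand _ _ s _ _ _) = s
h (cand _ _ _ x _ _) = x
m₁ m₂ : Cand → List ℕ
m₁ (cand _ _ _ _ m _) = m
m₂ (cand _ _ _ _ _ m) = m

positive : ℕ → Bool
positive zero = false
positive (suc _) = true

-- w + 1 = 32 ^ (m - 1): the digit of enc r * renc z at that place is |r ∩ z|
module Search (w : ℕ) where

  hitsAll : ℕ → List ℕ → Bool
  hitsAll′ : ℕ → ℕ → List ℕ → Bool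
  hitsAll c [] = true
  hitsAll c (z ∷ K) = hitsAll′ (meet w c z) c K
  hitsAll′ zero c K = false
  hitsAll′ (suc _) c K = hitsAll c K

  missedByAny : ℕ → List Cand → Bool
  missedByAny′ : ℕ → ℕ → List Cand → Bool
  missedByAny z [] = false
  missedByAny z (x ∷ ch) = missedByAny′ (meet w (code x) z) z ch
  missedByAny′ zero z ch = true
  missedByAny′ (suc _) z ch = missedByAny z ch

  critical : List Cand → List ℕ → List ℕ
  critical ch [] = []
  critical ch (z ∷ zs) = if missedByAny z ch then z ∷ critical ch zs else critical ch zs

  fits : ℕ → ℕ → ℕ → Bool
  fits 1 s R = s ≡ᵇ R
  fits _ s R = true

  -- `b` is the least price of the other cones still to come after `y`. `K₁` holds the (k - 2)-sets
  -- missed by the cone just chosen, where one miss is allowed, and `K₂` the (k - 3)-sets already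
  -- missed twice, where two are allowed; a later cone must meet all of them.
  compatible : ℕ → ℕ → ℕ → ℕ → List ℕ → List ℕ → Cand → Bool
  compatible l b B R K₁ K₂ y =
    if h y + b ≤ᵇ B
    then (if fits l (size y) R then (if hitsAll (code y) K₁ then hitsAll (code y) K₂ else false) else false)
    else false

  -- The first argument counts the cones still to be chosen from `cs`, which is sorted by price;
  -- `ch` holds the chosen ones, `B` and `R` the remaining price and total size. By the sorting,
  -- `suc l * h c` bounds the price of every completion from below. The cone `c` stays among the
  -- candidates, since several neighbours may have the same cone.
  search : ℕ → List Cand → List Cand → ℕ → ℕ → List (List Cand)
  branch : ℕ → Cand → List Cand → List Cand → ℕ → ℕ → List (List Cand)
  search zero cs ch B R = if R ≡ᵇ 0 then [] ∷ [] else []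
  search (suc l) [] ch B R = []
  search (suc l) (c ∷ cs) ch B R =
    if suc l * h c ≤ᵇ B then branch l c cs ch B R ++ search (suc l) cs ch B R else []
  branch l c cs ch B R =
    if size c ≤ᵇ R
    then map (c ∷_)
      (search l
        (filterᵇ (compatible l (pred l * h c) (B ∸ h c) (R ∸ size c) (m₁ c) (critical ch (m₂ c))) (c ∷ cs))
        (c ∷ ch) (B ∸ h c) (R ∸ size c))
    else []

byH : _
byH = On.decTotalOrder ≤-decTotalOrder h

sortH : List Cand → List Cand
sortH = IS.sort byH

ofSize : ℕ → List Row → List Row
ofSize s = filterᵇ (λ z → count z ≡ᵇ s)

weigh : ℕ → List ℕ → List (ℕ × ℕ)
weigh n [] = []
weigh n (z ∷ zs) = (z , n % 10) ∷ weigh (n / 10) zs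

lost : ℕ → List (ℕ × ℕ) → ℕ → ℕ
lost w [] c = 0
lost w ((z , y) ∷ W) c = (if positive (meet w c z) then 0 else y) + lost w W c

minH : ℕ → List Cand → ℕ
minH B [] = B
minH B (c ∷ cs) = h c ⊓ minH B cs

-- Every set in `Z₁` is missed by at most one cone, so all cones together lose at most the total
-- weight, and their sizes add up to R. Hence the prices add up to at most the total weight plus
-- `q * R`, for any choice of the weights and of `q`.
toCand : ℕ → List (ℕ × ℕ) → List ℕ → List ℕ → ℕ → Row → Cand
toCand w W Z₁ Z₂ q r = mk (enc r) (count r)
  where
  miss : ℕ → ℕ → Bool
  miss c z = not (positive (meet w c z))
  mk : ℕ → ℕ → Cand
  mk c s = cand r c s (lost w W c + q * s) (filterᵇ (miss c) Z₁) (filterᵇ (miss c) Z₂)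

module Glue (w d B R : ℕ) where
  solve : ℕ → List Cand → List (List Cand)
  -- Each of the other d - 1 cones costs at least the minimal price `p`.
  solve p I = Search.search w d (sortH (filterᵇ (λ c → h c + pred d * p ≤ᵇ B) I)) [] B R

  solutions : List Cand → List (List Cand)
  solutions I = solve (minH B I) I

numMissing : ℕ → ℕ → List Cand → ℕ
numMissing w z [] = 0
numMissing w z (c ∷ cs) = (if positive (meet w (code c) z) then 0 else 1) + numMissing w z cs

capped : ℕ → List (ℕ × List ℕ) → List Cand → Bool
capped w L cs = all (λ { (j , Z) → all (λ z → numMissing w z cs ≤ᵇ j) Z }) L

-- No independent k-set is allowed in the glued graph; wt lists the digits of the weights.
module Gluings (k : ℕ) (wt q d R : ℕ) where
  -- An independent s-set of X and the neighbours whose cones miss it form an independent set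
  -- together, so at most k - 1 - s cones miss it. The sizes k - 2 and k - 3 are already enforced by
  -- the search.
  cap : ℕ → List Row → ℕ × List ℕ
  cap s I = (k ∸ suc s , map renc (ofSize s I))

  caps : ℕ → List Row → List (ℕ × List ℕ)
  caps zero I = []
  caps (suc s) I = cap (suc s) I ∷ caps s I

  candidates : ℕ → List ℕ → List ℕ → List (ℕ × ℕ) → List Row → List Cand
  -- A neighbour has degree at most k - 1, and one of its edges goes to the root.
  candidates w Z₁ Z₂ W I = map (toCand w W Z₁ Z₂ q) (filterᵇ (λ c → count c ≤ᵇ (k ∸ 2)) I)

  step₂ : ℕ → List Row → List ℕ → List ℕ → List (ℕ × ℕ) → List (List Cand)
  step₂ w I Z₁ Z₂ W = Glue.solutions w d (sum (map proj₂ W) + q * R) R (candidates w Z₁ Z₂ W I)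

  step₁ : ℕ → List Row → List ℕ → List ℕ → List (List Cand)
  step₁ w I Z₁ Z₂ = filterᵇ (capped w (caps (k ∸ 4) I)) (step₂ w I Z₁ Z₂ (weigh wt Z₁))

  step₀ : ℕ → List Row → List (List Cand)
  step₀ w I = step₁ w I (map renc (ofSize (k ∸ 2) I)) (map renc (ofSize (k ∸ 3) I))

  gluings : Tri → List (List Cand)
  gluings X = step₀ (32 ^ pred (length X) ∸ 1) (indSets X)

-- Isomorphism tests and the gluing check

nthB : Row → ℕ → Bool
nthB [] _ = false
nthB (b ∷ r) zero = b
nthB (b ∷ r) (suc i) = nthB r i

at : Tri → ℕ → ℕ → Bool
at [] _ _ = false
at (r ∷ X) zero zero = false
at (r ∷ X) zero (suc j) = nthB r j
at (r ∷ X) (suc i) zero = nthB r i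
at (r ∷ X) (suc i) (suc j) = at X i j

relabel : Tri → List ℕ → Tri
relabel Y [] = []
relabel Y (i ∷ π) = map (at Y i) π ∷ relabel Y π

eqB : Bool → Bool → Bool
eqB true b = b
eqB false b = not b

eqRow : Row → Row → Bool
eqRow [] [] = true
eqRow (a ∷ r) (b ∷ s) = if eqB a b then eqRow r s else false
eqRow _ _ = false

eqTri : Tri → Tri → Bool
eqTri [] [] = true
eqTri (r ∷ X) (s ∷ Y) = if eqRow r s then eqTri X Y else false
eqTri _ _ = false

distinct : List ℕ → Bool
distinct [] = true
distinct (i ∷ π) = if all (λ j → not (i ≡ᵇ j)) π then distinct π else false

rowCode : Row → ℕ
rowCode [] = 0
rowCode (b ∷ r) = bit b + 2 * rowCode r

-- The full neighbourhood of each vertex as a bit mask: the row of an earlier vertex contributes the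
-- bits that the triangle omits.
codes degrees : Tri → List ℕ
codes [] = []
codes (r ∷ X) = 2 * rowCode r ∷ zipWith (λ b c → bit b + 2 * c) r (codes X)
degrees [] = []
degrees (r ∷ X) = count r ∷ zipWith (λ b c → bit b + c) r (degrees X)

data Vert : Set where
  vert : (idx pow-1 code deg : ℕ) → Vert

idx : Vert → ℕ
idx (vert i _ _ _) = i

verts : ℕ → List ℕ → List ℕ → List Vert
verts i (c ∷ cs) (d ∷ ds) = vert i (2 ^ i ∸ 1) c d ∷ verts (suc i) cs ds
verts i _ _ = []

edge : Vert → Vert → Bool
edge (vert _ _ c _) (vert _ p _ _) = positive ((c / suc p) % 2)

matches : Row → List Vert → Vert → Bool
matches [] _ v = true
matches (b ∷ r) [] v = true
matches (b ∷ r) (x ∷ xs) v = if eqB b (edge x v) then matches r xs v else false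

template : List Vert → List Vert → List (ℕ × Row)
template ch [] = []
template ch (v@(vert _ _ _ d) ∷ vs) = (d , map (edge v) ch) ∷ template (v ∷ ch) vs

-- Backtracking: the image of the next vertex has the right degree and the right adjacencies to the
-- images chosen so far. The result is only a proposal, which `validIso` checks independently.
embed : List (ℕ × Row) → List Vert → List Vert → Maybe (List ℕ)
embed [] ch av = just (reverse (map idx ch))
embed ((d , r) ∷ t) ch av = try [] av
  where
  try : List Vert → List Vert → Maybe (List ℕ)
  orElse : Maybe (List ℕ) → List Vert → List Vert → Maybe (List ℕ)
  try seen [] = nothing
  try seen (v@(vert _ _ _ e) ∷ vs) =
    if d ≡ᵇ e
    then (if matches r ch v then orElse (embed t (v ∷ ch) (seen ++ vs)) (v ∷ seen) vs else try (v ∷ seen) vs)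
    else try (v ∷ seen) vs
  orElse (just π) seen vs = just π
  orElse nothing seen vs = try seen vs

vertsOf : Tri → List Vert
vertsOf X = verts 0 (codes X) (degrees X)

validIso : Tri → Tri → Maybe (List ℕ) → Bool
validIso Y X nothing = false
validIso Y X (just π) = (length π ≡ᵇ length Y) ∧ all (λ i → i <ᵇ length Y) π ∧ distinct π ∧ eqTri (relabel Y π) X

isoTo : Tri → Tri → Bool
isoTo Y X = validIso Y X (embed (template [] (vertsOf X)) [] (vertsOf Y))

-- Neighbours of the root are pairwise non-adjacent in a triangle-free graph, whence the `false`
-- entries.
nbrRows : List Row → Tri
nbrRows [] = []
nbrRows (c ∷ cs) = (replicate (length cs) false ++ c) ∷ nbrRows cs

glue : Tri → List Row → Tri
glue X cs = (replicate (length cs) true ++ replicate (length X) false) ∷ nbrRows cs ++ X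

checkGlue : ℕ → ℕ → ℕ → ℕ → ℕ → List Tri → Tri → Bool
checkGlue k wt q d R L X = all (λ cs → any (isoTo (glue X (map row cs))) L) (Gluings.gluings k wt q d R X)

private variable
  A : Set

-- Sums over lists

∑ : (A → ℕ) → List A → ℕ
∑ f [] = 0
∑ f (x ∷ xs) = f x + ∑ f xs

∑-++ : (f : A → ℕ) (xs ys : List A) → ∑ f (xs ++ ys) ≡ ∑ f xs + ∑ f ys
∑-++ f [] ys = refl
∑-++ f (x ∷ xs) ys rewrite ∑-++ f xs ys = sym (+-assoc (f x) _ _)

x+[y+z]≡y+[x+z] : ∀ a b c → a + (b + c) ≡ b + (a + c)
x+[y+z]≡y+[x+z] a b c = trans (sym (+-assoc a b c)) (trans (cong (_+ c) (+-comm a b)) (+-assoc b a c))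

∑-↭ : (f : A → ℕ) {xs ys : List A} → xs ↭ ys → ∑ f xs ≡ ∑ f ys
∑-↭ f ↭.refl = refl
∑-↭ f (prep x p) = cong (f x +_) (∑-↭ f p)
∑-↭ f (↭.swap x y p) rewrite ∑-↭ f p = x+[y+z]≡y+[x+z] (f x) (f y) _
∑-↭ f (↭.trans p q) = trans (∑-↭ f p) (∑-↭ f q)

∑-cong : {f g : A → ℕ} {xs : List A} → All (λ x → f x ≡ g x) xs → ∑ f xs ≡ ∑ g xs
∑-cong [] = refl
∑-cong (p ∷ ps) = cong₂ _+_ p (∑-cong ps)

∑-mono : {f g : A → ℕ} {xs : List A} → All (λ x → f x ≤ g x) xs → ∑ f xs ≤ ∑ g xs
∑-mono [] = z≤n
∑-mono (p ∷ ps) = +-mono-≤ p (∑-mono ps)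

interchange : ∀ a b c d → (a + b) + (c + d) ≡ (a + c) + (b + d)
interchange = solve 4 (λ a b c d → (a :+ b) :+ (c :+ d) := (a :+ c) :+ (b :+ d)) refl
  where open +-*-Solver

∑-+ : (f g : A → ℕ) (xs : List A) → ∑ (λ x → f x + g x) xs ≡ ∑ f xs + ∑ g xs
∑-+ f g [] = refl
∑-+ f g (x ∷ xs) rewrite ∑-+ f g xs = interchange (f x) (g x) _ _

∑-*ˡ : (c : ℕ) (f : A → ℕ) (xs : List A) → ∑ (λ x → c * f x) xs ≡ c * ∑ f xs
∑-*ˡ c f [] = sym (*-zeroʳ c)
∑-*ˡ c f (x ∷ xs) rewrite ∑-*ˡ c f xs = sym (*-distribˡ-+ c (f x) _)

∑-*ʳ : (c : ℕ) (f : A → ℕ) (xs : List A) → ∑ (λ x → f x * c) xs ≡ ∑ f xs * c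
∑-*ʳ c f [] = refl
∑-*ʳ c f (x ∷ xs) rewrite ∑-*ʳ c f xs = sym (*-distribʳ-+ c (f x) _)

∑-const : (c : ℕ) (xs : List A) → ∑ (λ _ → c) xs ≡ length xs * c
∑-const c [] = refl
∑-const c (x ∷ xs) = cong (c +_) (∑-const c xs)

∑-zero : {f : A → ℕ} {xs : List A} → All (λ x → f x ≡ 0) xs → ∑ f xs ≡ 0
∑-zero [] = refl
∑-zero (p ∷ ps) = cong₂ _+_ p (∑-zero ps)

∑-swap : {B : Set} (f : A → B → ℕ) (xs : List A) (ys : List B) →
         ∑ (λ x → ∑ (f x) ys) xs ≡ ∑ (λ y → ∑ (λ x → f x y) xs) ys
∑-swap f [] ys = sym (∑-zero {xs = ys} (All.universal (λ _ → refl) ys))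
∑-swap f (x ∷ xs) ys rewrite ∑-swap f xs ys = sym (∑-+ (f x) _ ys)

∑-ones : {f : A → ℕ} {xs : List A} → All (λ x → f x ≡ 1) xs → ∑ f xs ≡ length xs
∑-ones [] = refl
∑-ones (p ∷ ps) = cong₂ _+_ p (∑-ones ps)

∑-filter : (f : A → ℕ) {P : A → Set} (P? : ∀ x → Dec (P x)) (xs : List A) →
           ∑ f xs ≡ ∑ f (filter P? xs) + ∑ f (filter (¬? ∘ P?) xs)
∑-filter f P? [] = refl
∑-filter f P? (x ∷ xs) with P? x
... | yes _ = trans (cong (f x +_) (∑-filter f P? xs)) (sym (+-assoc (f x) _ _))
... | no _ = trans (cong (f x +_) (∑-filter f P? xs)) (x+[y+z]≡y+[x+z] (f x) (∑ f (filter P? xs)) _)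

-- Permutations, membership and uniqueness

∈⇒↭∷ : {x : A} {xs : List A} → x ∈ xs → ∃ λ ys → xs ↭ x ∷ ys
∈⇒↭∷ {x = x} x∈ with as , bs , refl ← ∈-∃++ x∈ = as ++ bs , shift x as bs

AllPairs-↭ : {R : A → A → Set} → (∀ {x y} → R x y → R y x) → {xs ys : List A} →
             xs ↭ ys → AllPairs R xs → AllPairs R ys
AllPairs-↭ s ↭.refl ps = ps
AllPairs-↭ s (prep x p) (q ∷ ps) = All-resp-↭ p q ∷ AllPairs-↭ s p ps
AllPairs-↭ s (↭.swap x y p) ((q ∷ qs) ∷ rs ∷ ps) =
  (s q ∷ All-resp-↭ p rs) ∷ All-resp-↭ p qs ∷ AllPairs-↭ s p ps
AllPairs-↭ s (↭.trans p q) ps = AllPairs-↭ s q (AllPairs-↭ s p ps)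

Unique-↭ : {xs ys : List A} → xs ↭ ys → Unique xs → Unique ys
Unique-↭ = AllPairs-↭ (λ x≢y y≡x → x≢y (sym y≡x))

AllPairs-++ˡ : {R : A → A → Set} (xs : List A) {ys : List A} → AllPairs R (xs ++ ys) → AllPairs R xs
AllPairs-++ˡ [] ps = []
AllPairs-++ˡ (x ∷ xs) (p ∷ ps) = Allₚ.++⁻ˡ xs p ∷ AllPairs-++ˡ xs ps

AllPairs-++ʳ : {R : A → A → Set} (xs : List A) {ys : List A} → AllPairs R (xs ++ ys) → AllPairs R ys
AllPairs-++ʳ [] ps = ps
AllPairs-++ʳ (x ∷ xs) (p ∷ ps) = AllPairs-++ʳ xs ps

unique-length : {I S : List A} → Unique I → All (_∈ S) I → length I ≤ length S
unique-length [] [] = z≤n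
unique-length {I = x ∷ I} (x∉ ∷ u) (x∈ ∷ I⊆) with S′ , p ← ∈⇒↭∷ x∈ =
  subst (suc (length I) ≤_) (sym (↭-length p)) (s≤s (unique-length u (All.zipWith (λ (ne , y∈) → other ne (∈-resp-↭ p y∈)) (x∉ , I⊆))))
  where
  other : ∀ {y} → x ≢ y → y ∈ x ∷ S′ → y ∈ S′
  other ne (here e) = ⊥-elim (ne (sym e))
  other ne (there q) = q

∈-take : ∀ n (xs : List A) {x} → x ∈ take n xs → x ∈ xs
∈-take (suc n) (x ∷ xs) (here p) = here p
∈-take (suc n) (x ∷ xs) (there p) = there (∈-take n xs p)

unique⊆⇒↭ : {xs ys : List A} → Unique xs → All (_∈ ys) xs → length ys ≤ length xs → xs ↭ ys
unique⊆⇒↭ {xs = []} {[]} _ _ _ = ↭.refl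
unique⊆⇒↭ {xs = x ∷ xs} {ys} (x∉ ∷ u) (x∈ ∷ sub) len with zs , p ← ∈⇒↭∷ x∈ =
  ↭-trans (prep x (unique⊆⇒↭ u (All.tabulate sub′) (≤-pred (subst (_≤ _) (↭-length p) len)))) (↭-sym p)
  where
  sub′ : ∀ {y} → y ∈ xs → y ∈ zs
  sub′ y∈ with ∈-resp-↭ p (All.lookup sub y∈)
  ... | here refl = ⊥-elim (All.lookup x∉ y∈ refl)
  ... | there y∈zs = y∈zs

-- Vertex sets in a triangle-free graph

module TriangleFree {A : Set} (adj : A → A → Bool)
  (adj-sym : ∀ x y → adj x y ≡ adj y x) (adj-irr : ∀ x → adj x x ≡ false)
  (tf : ∀ {x y z} → adj x y ≡ true → adj x z ≡ true → adj y z ≡ true → ⊥) where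

  Anti : A → A → Set
  Anti x y = x ≢ y × adj x y ≡ false

  Anti-sym : ∀ {x y} → Anti x y → Anti y x
  Anti-sym {x} {y} (p , q) = (λ e → p (sym e)) , trans (adj-sym y x) q

  NoInd : ℕ → List A → Set
  NoInd k S = ∀ I → AllPairs Anti I → All (_∈ S) I → length I < k

  NoInd-⊆ : ∀ {k S S′} → All (_∈ S) S′ → NoInd k S → NoInd k S′
  NoInd-⊆ sub ni I ap I⊆ = ni I ap (All.map (All.lookup sub) I⊆)

  ↭-⊆ : {S S′ : List A} → S ↭ S′ → All (_∈ S) S′
  ↭-⊆ p = All.tabulate (∈-resp-↭ (↭-sym p))

  deg : A → List A → ℕ
  deg x = ∑ (bit ∘ adj x)

  edges : List A → ℕ
  edges [] = 0
  edges (x ∷ S) = deg x S + edges S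

  edges-↭ : ∀ {S S′} → S ↭ S′ → edges S ≡ edges S′
  edges-↭ ↭.refl = refl
  edges-↭ (prep x p) = cong₂ _+_ (∑-↭ _ p) (edges-↭ p)
  edges-↭ {x ∷ y ∷ S} {y ∷ x ∷ S′} (↭.swap x y p)
    rewrite ∑-↭ (bit ∘ adj x) p | ∑-↭ (bit ∘ adj y) p | edges-↭ p | adj-sym x y =
    solve 4 (λ b p q r → (b :+ p) :+ (q :+ r) := (b :+ q) :+ (p :+ r)) refl (bit (adj y x)) (deg x S′) (deg y S′) (edges S′)
    where open +-*-Solver
  edges-↭ (↭.trans p q) = trans (edges-↭ p) (edges-↭ q)

  handshake : ∀ S → ∑ (λ x → deg x S) S ≡ 2 * edges S
  handshake [] = refl
  handshake (x ∷ S)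
    rewrite adj-irr x
          | ∑-+ (λ y → bit (adj y x)) (λ y → deg y S) S
          | handshake S
          | ∑-cong {f = λ y → bit (adj y x)} {g = λ y → bit (adj x y)} (All.universal (λ y → cong bit (adj-sym y x)) S) =
    solve 2 (λ d e → d :+ (d :+ con 2 :* e) := con 2 :* (d :+ e)) refl (deg x S) (edges S)
    where open +-*-Solver

  nbrDegrees : A → List A → ℕ
  nbrDegrees v S = ∑ (λ u → bit (adj v u) * deg u S) S

  -- After exchanging the sums, the degree of `u` is counted once for each neighbour of `u`.
  ∑nbrDegrees : ∀ S → ∑ (λ v → nbrDegrees v S) S ≡ ∑ (λ u → deg u S * deg u S) S
  ∑nbrDegrees S = trans (∑-swap (λ v u → bit (adj v u) * deg u S) S S)
    (∑-cong (All.universal (λ u → trans (∑-*ʳ (deg u S) (λ v → bit (adj v u)) S)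
      (cong (_* deg u S) (∑-cong (All.universal (λ v → cong bit (adj-sym v u)) S)))) S))

  partition↭ : ∀ v S → ∃ λ N → ∃ λ H → S ↭ N ++ H
             × All (λ u → adj v u ≡ true) N × All (λ u → adj v u ≡ false) H
  partition↭ v [] = [] , [] , ↭.refl , [] , []
  partition↭ v (x ∷ S) with partition↭ v S | adj v x in eq
  ... | N , H , p , n , h | true = x ∷ N , H , prep x p , eq ∷ n , h
  ... | N , H , p , n , h | false = N , x ∷ H , ↭-trans (prep x p) (↭-sym (shift x N H)) , n , eq ∷ h

  record Split (v : A) (S : List A) : Set where
    constructor split
    field
      N H : List A
      perm : S ↭ v ∷ N ++ H
      nbr : All (λ u → adj v u ≡ true) N
      non : All (λ u → Anti v u) H

  splitAt : ∀ {v S} → Unique S → v ∈ S → Split v S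
  splitAt {v} {S} u v∈ with S′ , p ← ∈⇒↭∷ v∈ with v∉ ∷ _ ← Unique-↭ p u
    with N , H , q , n , h ← partition↭ v S′ =
    split N H (↭-trans p (prep v q)) n (All.zip (Allₚ.++⁻ʳ N (All-resp-↭ q v∉) , h))

  nbrs-anti : ∀ {v N} → Unique N → All (λ u → adj v u ≡ true) N → AllPairs Anti N
  nbrs-anti [] [] = []
  nbrs-anti {v} {x ∷ N} (x∉ ∷ u) (e ∷ es) = All.zipWith anti (x∉ , es) ∷ nbrs-anti u es
    where
    anti : ∀ {y} → x ≢ y × adj v y ≡ true → Anti x y
    anti {y} (x≢y , e′) with adj x y in q
    ... | true = ⊥-elim (tf e e′ q)
    ... | false = x≢y , refl

  cross : List A → List A → ℕ
  cross N H = ∑ (λ u → deg u H) N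

  edges-++ : ∀ N H → edges (N ++ H) ≡ edges N + (cross N H + edges H)
  edges-++ [] H = refl
  edges-++ (x ∷ N) H rewrite ∑-++ (bit ∘ adj x) N H | edges-++ N H =
    solve 5 (λ a b c d e → (a :+ b) :+ (c :+ (d :+ e)) := (a :+ c) :+ ((b :+ d) :+ e)) refl
      (deg x N) (deg x H) (edges N) (cross N H) (edges H)
    where open +-*-Solver

  anti-deg : ∀ {x N} → All (Anti x) N → deg x N ≡ 0
  anti-deg = ∑-zero ∘ All.map (λ a → cong bit (proj₂ a))

  anti-edges : ∀ {N} → AllPairs Anti N → edges N ≡ 0
  anti-edges [] = refl
  anti-edges (a ∷ as) = cong₂ _+_ (anti-deg a) (anti-edges as)

  module _ {v S} (sp : Split v S) (uS : Unique S) where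
    open Split sp
    private
      u′ : Unique (v ∷ N ++ H)
      u′ = Unique-↭ perm uS
      uNH : Unique (N ++ H)
      uNH = AllPairs.tail u′
      antiN : AllPairs Anti N
      antiN = nbrs-anti (AllPairs-++ˡ N uNH) nbr

    split-uN : Unique N
    split-uN = AllPairs-++ˡ N uNH

    split-uH : Unique H
    split-uH = AllPairs-++ʳ N uNH

    split-antiN : AllPairs Anti N
    split-antiN = antiN

    deg-split : deg v S ≡ length N
    deg-split = begin
      deg v S                         ≡⟨ ∑-↭ _ perm ⟩
      bit (adj v v) + deg v (N ++ H)  ≡⟨ cong₂ _+_ (cong bit (adj-irr v)) (∑-++ _ N H) ⟩
      deg v N + deg v H               ≡⟨ cong₂ _+_ (∑-ones (All.map (cong bit) nbr)) (anti-deg non) ⟩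
      length N + 0                    ≡⟨ +-identityʳ _ ⟩
      length N                        ∎
      where open ≡-Reasoning

    edges-split : edges S ≡ length N + (cross N H + edges H)
    edges-split = begin
      edges S                                  ≡⟨ edges-↭ perm ⟩
      deg v (N ++ H) + edges (N ++ H)          ≡⟨ cong₂ _+_ eq₁ (edges-++ N H) ⟩
      length N + (edges N + (cross N H + edges H)) ≡⟨ cong (λ x → length N + (x + (cross N H + edges H))) (anti-edges antiN) ⟩
      length N + (cross N H + edges H)         ∎
      where
      open ≡-Reasoning
      eq₁ : deg v (N ++ H) ≡ length N
      eq₁ = trans (∑-++ _ N H) (trans (cong₂ _+_ (∑-ones (All.map (cong bit) nbr)) (anti-deg non)) (+-identityʳ _))

    length-split : length S ≡ suc (length N + length H)
    length-split = trans (↭-length perm) (cong suc (Lₚ.length-++ N))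

    deg-nbr : All (λ u → deg u S ≡ suc (deg u H)) N
    deg-nbr = All.tabulate λ {u} u∈ → begin
      deg u S                                ≡⟨ ∑-↭ _ perm ⟩
      bit (adj u v) + deg u (N ++ H)         ≡⟨ cong₂ _+_ (cong bit (trans (adj-sym u v) (All.lookup nbr u∈))) (∑-++ _ N H) ⟩
      suc (deg u N + deg u H)                ≡⟨ cong (λ x → suc (x + deg u H)) (∑-zero (All.tabulate (inN u∈))) ⟩
      suc (deg u H)                          ∎
      where
      open ≡-Reasoning
      inN : ∀ {u} → u ∈ N → ∀ {y} → y ∈ N → bit (adj u y) ≡ 0
      inN {u} u∈ {y} y∈ with adj u y in q
      ... | true = ⊥-elim (tf (All.lookup nbr u∈) (All.lookup nbr y∈) q)
      ... | false = refl

    nbrDegrees-split : nbrDegrees v S ≡ length N + cross N H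
    nbrDegrees-split = begin
      ∑ f S                        ≡⟨ ∑-↭ f perm ⟩
      f v + ∑ f (N ++ H)           ≡⟨ cong₂ _+_ (cong (λ b → bit b * deg v S) (adj-irr v)) (∑-++ f N H) ⟩
      ∑ f N + ∑ f H                ≡⟨ cong₂ _+_ fN (∑-zero (All.map (λ {u} a → cong (λ b → bit b * deg u S) (proj₂ a)) non)) ⟩
      (length N + cross N H) + 0   ≡⟨ +-identityʳ _ ⟩
      length N + cross N H         ∎
      where
      open ≡-Reasoning
      f : A → ℕ
      f u = bit (adj v u) * deg u S
      fN : ∑ f N ≡ length N + cross N H
      fN = trans (∑-cong (All.zipWith (λ {u} (a , d) → trans (cong (λ b → bit b * deg u S) a) (trans (+-identityʳ _) d)) (nbr , deg-nbr)))
             (trans (∑-+ (λ _ → 1) (λ u → deg u H) N) (cong (_+ cross N H) (∑-ones {xs = N} (All.universal (λ _ → refl) N))))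

    -- Every edge outside `H` has exactly one end in `N`, because `N` is independent and `v` has no
    -- neighbour in `H`; so the degrees of the neighbours count each of these edges once.
    edges-nbrDegrees : edges S ≡ nbrDegrees v S + edges H
    edges-nbrDegrees = trans edges-split (trans (sym (+-assoc (length N) _ _)) (cong (_+ edges H) (sym nbrDegrees-split)))

    split-⊆ : All (_∈ S) (v ∷ N ++ H)
    split-⊆ = ↭-⊆ perm

    deg< : ∀ {k} → NoInd k S → length N < k
    deg< ni = ni N antiN (Allₚ.++⁻ˡ N (All.tail split-⊆))

    H⊆S : All (_∈ S) H
    H⊆S = Allₚ.++⁻ʳ N (All.tail split-⊆)

    noInd-non : ∀ {k} → NoInd (suc k) S → NoInd k H
    noInd-non ni I ap I⊆ = ≤-pred (ni (v ∷ I) (All.map (All.lookup non) I⊆ ∷ ap)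
                                     (All.head split-⊆ ∷ All.map (All.lookup H⊆S) I⊆))

true≢false : true ≡ false → ⊥
true≢false ()

≡ᵇ-refl : ∀ n → (n ≡ᵇ n) ≡ true
≡ᵇ-refl zero = refl
≡ᵇ-refl (suc n) = ≡ᵇ-refl n

≤ᵇ-intro : ∀ {m n} → m ≤ n → (m ≤ᵇ n) ≡ true
≤ᵇ-intro {m} {n} p with m ≤ᵇ n | ≤⇒≤ᵇ p
... | true | _ = refl

∧-true : ∀ {a b} → a ∧ b ≡ true → a ≡ true × b ≡ true
∧-true {true} {true} _ = refl , refl

T⁺ : ∀ {b} → b ≡ true → T b
T⁺ refl = _

≤ᵇ-true : ∀ {m n} → (m ≤ᵇ n) ≡ true → m ≤ n
≤ᵇ-true {m} {n} e = ≤ᵇ⇒≤ m n (T⁺ e)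

<ᵇ-true : ∀ {m n} → (m <ᵇ n) ≡ true → m < n
<ᵇ-true {m} {n} e = <ᵇ⇒< m n (T⁺ e)

≡ᵇ-true : ∀ {m n} → (m ≡ᵇ n) ≡ true → m ≡ n
≡ᵇ-true {m} {n} e = ≡ᵇ⇒≡ m n (T⁺ e)

all-true : ∀ {A : Set} (p : A → Bool) {xs} → all p xs ≡ true → ∀ {x} → x ∈ xs → p x ≡ true
all-true p e (here refl) = proj₁ (∧-true e)
all-true p {y ∷ ys} e (there x∈) = all-true p (proj₂ (∧-true {p y} e)) x∈

any-true : ∀ {A : Set} (p : A → Bool) (xs : List A) → any p xs ≡ true → ∃ λ x → x ∈ xs × p x ≡ true
any-true p (x ∷ xs) e with p x in eq
... | true = x , here refl , eq
... | false with y , y∈ , q ← any-true p xs e = y , there y∈ , q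

-- A table lists, by number of vertices, lower bounds for the number of edges;
-- there is no graph beyond its end.

Table : Set
Table = List ℕ

_!_ : Table → ℕ → Maybe ℕ
[] ! n = nothing
(E ∷ T) ! zero = just E
(E ∷ T) ! suc n = T ! n

-- A degree whose non-neighbours would lie beyond the end of the table cannot occur and therefore
-- passes. `f` may raise the entry of the table.
fitsAt : (ℕ → ℕ → ℕ) → Table → ℕ → ℕ → ℕ → ℕ → Bool
fitsAt f T n a b d with T ! (n ∸ suc d)
... | nothing = true
... | just E = a * d + b ≤ᵇ 12 * (d * d + f (n ∸ suc d) E)

-- 12 (d² + E(n-1-d)) ≥ a d + b for all degrees d forces (12 n - 2 a) e ≥ b n.
certificate : (ℕ → ℕ → ℕ) → Table → ℕ → ℕ → ℕ → ℕ → ℕ → Bool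
certificate f T k n e a b =
  all (fitsAt f T n a b) (upTo (k ⊓ n)) ∧ ((2 * a ≤ᵇ 12 * n) ∧ (12 * n * e <ᵇ 2 * a * e + b * n))

fitsAt-just : ∀ f T n a b d {m E} → n ∸ suc d ≡ m → T ! m ≡ just E → fitsAt f T n a b d ≡ true →
              a * d + b ≤ 12 * (d * d + f m E)
fitsAt-just f T n a b d refl T!m eq with T ! (n ∸ suc d) | T!m
... | just E | refl = ≤ᵇ-true eq

-- The intercept of the supporting line of slope `a` below the values 12 (d² + E); the starting
-- value merely caps it. Where truncated subtraction makes the intercept too large, `certificate`
-- rejects it.
offset : (ℕ → ℕ → ℕ) → Table → ℕ → ℕ → List ℕ → ℕ
offset f T n a [] = 12 * (n * n)
offset f T n a (d ∷ ds) with T ! (n ∸ suc d)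
... | nothing = offset f T n a ds
... | just E = (12 * (d * d + f (n ∸ suc d) E) ∸ a * d) ⊓ offset f T n a ds

-- The slopes tried are multiples of 1/12; staying below 6 n guarantees the condition 2 a ≤ 12 n of
-- `certificate`.
exceeds : (ℕ → ℕ → ℕ) → Table → ℕ → ℕ → ℕ → Bool
exceeds f T k n e =
  any (λ a → certificate f T k n e a (offset f T n a (upTo (k ⊓ n)))) (upTo ((6 * n) ⊓ 150))

m≤n⇒∃ : ∀ {m n} → m ≤ n → ∃ λ o → m + o ≡ n
m≤n⇒∃ {m} {n} p = n ∸ m , m+[n∸m]≡n p

-- Averaging over the vertices of a triangle-free graph

module LinearProgram {A : Set} (adj : A → A → Bool)
  (adj-sym : ∀ x y → adj x y ≡ adj y x) (adj-irr : ∀ x → adj x x ≡ false)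
  (tf : ∀ {x y z} → adj x y ≡ true → adj x z ≡ true → adj y z ≡ true → ⊥) where

  open TriangleFree adj adj-sym adj-irr tf

  LB : Table → ℕ → Set
  LB T k = ∀ {S} → Unique S → NoInd k S → ∃ λ E → T ! length S ≡ just E × E ≤ edges S

  -- `nbrDegrees` sums to the sum of the squared degrees, so the quadratic terms of both sides
  -- cancel; the linear terms become edges by the handshake lemma.
  averaging : ∀ {S} (a b : ℕ) →
    (∀ {v} → v ∈ S → 12 * nbrDegrees v S + (a * deg v S + b) ≤ 12 * edges S + 12 * (deg v S * deg v S)) →
    2 * a * edges S + b * length S ≤ 12 * length S * edges S
  averaging {S} a b ineq = +-cancelˡ-≤ (12 * D²) _ _ (begin
    12 * D² + (2 * a * e + b * n)
      ≡⟨ cong₂ (λ x y → 12 * x + (y + b * n)) (sym (∑nbrDegrees S)) (trans (cong (_* e) (*-comm 2 a)) (trans (*-assoc a 2 e) (cong (a *_) (sym (handshake S))))) ⟩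
    12 * ∑ (λ v → nbrDegrees v S) S + (a * ∑ (λ v → deg v S) S + b * n)
      ≡⟨ sym sumˡ ⟩
    ∑ (λ v → 12 * nbrDegrees v S + (a * deg v S + b)) S
      ≤⟨ ∑-mono (All.tabulate ineq) ⟩
    ∑ (λ v → 12 * e + 12 * (deg v S * deg v S)) S
      ≡⟨ trans (∑-+ (λ _ → 12 * e) _ S) (cong₂ _+_ (∑-const (12 * e) S) (∑-*ˡ 12 _ S)) ⟩
    n * (12 * e) + 12 * D²
      ≡⟨ solve 3 (λ n e d → n :* (con 12 :* e) :+ con 12 :* d := con 12 :* d :+ con 12 :* n :* e) refl n e D² ⟩
    12 * D² + 12 * n * e ∎)
    where
    open ≤-Reasoning
    open +-*-Solver
    e n D² : ℕ
    e = edges S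
    n = length S
    D² = ∑ (λ v → deg v S * deg v S) S
    sumˡ : ∑ (λ v → 12 * nbrDegrees v S + (a * deg v S + b)) S
         ≡ 12 * ∑ (λ v → nbrDegrees v S) S + (a * ∑ (λ v → deg v S) S + b * n)
    sumˡ = trans (∑-+ _ _ S) (cong₂ _+_ (∑-*ˡ 12 _ S)
             (trans (∑-+ _ _ S) (cong₂ _+_ (∑-*ˡ a _ S) (trans (∑-const b S) (*-comm n b)))))

  -- The coefficient 12 n - 2 a of the number of edges is nonnegative, so refuting one value refutes
  -- all smaller ones.
  below : ∀ {a n b e e′} → 2 * a ≤ 12 * n → 12 * n * e < 2 * a * e + b * n → e′ ≤ e →
          12 * n * e′ < 2 * a * e′ + b * n
  below {a} {n} {b} {e} {e′} 2a≤ lt e′≤ with c , eq ← m≤n⇒∃ 2a≤ rewrite sym eq =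
    subst (_< 2 * a * e′ + b * n) (sym (*-distribʳ-+ e′ (2 * a) c))
      (+-monoʳ-< (2 * a * e′) (≤-<-trans (*-monoʳ-≤ c e′≤)
        (+-cancelˡ-< (2 * a * e) _ _ (subst (_< 2 * a * e + b * n) (*-distribʳ-+ e (2 * a) c) lt))))

  certificate-sound : ∀ f T k {S} (e a b : ℕ) → certificate f T (suc k) (length S) e a b ≡ true →
    LB T k → Unique S → NoInd (suc k) S →
    (∀ {v} (sp : Split v S) {E} → T ! length (Split.H sp) ≡ just E → E ≤ edges (Split.H sp) →
      f (length (Split.H sp)) E ≤ edges (Split.H sp)) →
    e < edges S
  certificate-sound f T k {S} e a b cert lb u noI raise with edges S ≤? e
  ... | no ¬p = ≰⇒> ¬p
  ... | yes p
    with fits , rest ← ∧-true {all (fitsAt f T (length S) a b) (upTo (suc k ⊓ length S))} cert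
    with 2a≤ , lt ← ∧-true {2 * a ≤ᵇ 12 * length S} rest =
    ⊥-elim (<⇒≱ (below {a} {length S} {b} (≤ᵇ-true 2a≤) (<ᵇ-true lt) p) (averaging a b ineq))
    where
    ineq : ∀ {v} → v ∈ S → 12 * nbrDegrees v S + (a * deg v S + b) ≤ 12 * edges S + 12 * (deg v S * deg v S)
    ineq {v} v∈ = at-split (splitAt u v∈)
     where
     at-split : Split v S → 12 * nbrDegrees v S + (a * deg v S + b) ≤ 12 * edges S + 12 * (deg v S * deg v S)
     at-split sp with E , T!E , E≤ ← lb (split-uH sp u) (noInd-non sp u noI) = final
      where
      open Split sp
      lN : deg v S ≡ length N
      lN = deg-split sp u
      lH : length S ∸ suc (length N) ≡ length H
      lH = trans (cong (_∸ suc (length N)) (length-split sp u)) (m+n∸m≡n (length N) (length H))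
      d∈ : length N ∈ upTo (suc k ⊓ length S)
      d∈ = ∈-upTo⁺ (⊓-glb (deg< sp u noI) (subst (length N <_) (sym (length-split sp u)) (s≤s (m≤m+n _ _))))
      fit : a * length N + b ≤ 12 * (length N * length N + edges H)
      fit = ≤-trans (fitsAt-just f T (length S) a b (length N) lH T!E (all-true (fitsAt f T (length S) a b) fits d∈))
        (*-monoʳ-≤ 12 (+-monoʳ-≤ (length N * length N) (raise sp T!E E≤)))
      final : 12 * nbrDegrees v S + (a * deg v S + b) ≤ 12 * edges S + 12 * (deg v S * deg v S)
      final rewrite lN = begin
        12 * Z + (a * length N + b)                   ≤⟨ +-monoʳ-≤ (12 * Z) fit ⟩
        12 * Z + 12 * (length N * length N + edges H) ≡⟨ solve 3 (λ z d e → con 12 :* z :+ con 12 :* (d :+ e) := con 12 :* (z :+ e) :+ con 12 :* d) refl Z (length N * length N) (edges H) ⟩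
        12 * (Z + edges H) + 12 * (length N * length N) ≡⟨ cong (λ x → 12 * x + 12 * (length N * length N)) (sym (edges-nbrDegrees sp u)) ⟩
        12 * edges S + 12 * (length N * length N)     ∎
        where
        open ≤-Reasoning
        open +-*-Solver
        Z : ℕ
        Z = nbrDegrees v S

  exceeds-sound : ∀ f T k {S} (e : ℕ) → exceeds f T (suc k) (length S) e ≡ true →
    LB T k → Unique S → NoInd (suc k) S →
    (∀ {v} (sp : Split v S) {E} → T ! length (Split.H sp) ≡ just E → E ≤ edges (Split.H sp) →
      f (length (Split.H sp)) E ≤ edges (Split.H sp)) →
    e < edges S
  exceeds-sound f T k {S} e ex lb u ni raise
    with a , _ , cert ← any-true _ (upTo ((6 * length S) ⊓ 150)) ex =
    certificate-sound f T k e a _ cert lb u ni raise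

  2edges≤ : ∀ {k S} → Unique S → NoInd (suc k) S → 2 * edges S ≤ length S * k
  2edges≤ {k} {S} u ni = subst₂ _≤_ (handshake S) (∑-const k S)
    (∑-mono (All.tabulate λ v∈ → let sp = splitAt u v∈ in
      subst (_≤ k) (sym (deg-split sp u)) (≤-pred (deg< sp u ni))))

lowerBoundOK : Table → ℕ → ℕ → ℕ → Bool
lowerBoundOK T k n zero = true
lowerBoundOK T k n (suc e) = exceeds (λ _ E → E) T k n e

-- At the end of the table the lower bound exceeds n (k - 1) / 2, the most edges that degrees below
-- k permit; so there is no graph on n vertices.
boundsOK : Table → ℕ → ℕ → Table → Bool
boundsOK T k n [] = exceeds (λ _ E → E) T k n (n * pred k / 2)
boundsOK T k n (E ∷ T′) = lowerBoundOK T k n E ∧ boundsOK T k (suc n) T′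

module Tables {A : Set} (adj : A → A → Bool)
  (adj-sym : ∀ x y → adj x y ≡ adj y x) (adj-irr : ∀ x → adj x x ≡ false)
  (tf : ∀ {x y z} → adj x y ≡ true → adj x z ≡ true → adj y z ≡ true → ⊥) where

  open TriangleFree adj adj-sym adj-irr tf
  open LinearProgram adj adj-sym adj-irr tf

  module _ {T k} (lb : LB T k) where
    lowerBoundOK-sound : ∀ {S} E → lowerBoundOK T (suc k) (length S) E ≡ true → Unique S → NoInd (suc k) S → E ≤ edges S
    lowerBoundOK-sound zero _ _ _ = z≤n
    lowerBoundOK-sound (suc e) ok u ni = exceeds-sound (λ _ E → E) T k e ok lb u ni (λ _ _ E≤ → E≤)

    -- A graph on more vertices contains one on exactly n.
    tooMany : ∀ n → exceeds (λ _ E → E) T (suc k) n (n * k / 2) ≡ true →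
              ∀ {S} → Unique S → NoInd (suc k) S → n ≤ length S → ⊥
    tooMany n ex {S} u ni n≤ = <⇒≱ (m*n≤o⇒m≤o/n′ {edges S′} {length S′ * k} (2edges≤ u′ ni′))
      (subst (λ n → n * k / 2 < edges S′) (sym lenS′) (exceeds-sound (λ _ E → E) T k (n * k / 2) ex′ lb u′ ni′ (λ _ _ E≤ → E≤)))
      where
      S′ : List A
      S′ = take n S
      lenS′ : length S′ ≡ n
      lenS′ = trans (Lₚ.length-take n S) (m≤n⇒m⊓n≡m n≤)
      u′ : Unique S′
      u′ = APₚ.take⁺ n u
      ni′ : NoInd (suc k) S′
      ni′ = NoInd-⊆ (All.tabulate (∈-take n S)) ni
      ex′ : exceeds (λ _ E → E) T (suc k) (length S′) (n * k / 2) ≡ true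
      ex′ = trans (cong (λ m → exceeds (λ _ E → E) T (suc k) m (n * k / 2)) lenS′) ex
      m*n≤o⇒m≤o/n′ : ∀ {m o} → 2 * m ≤ o → m < suc (o / 2)
      m*n≤o⇒m≤o/n′ {m} {o} p = s≤s (subst (_≤ o / 2) (trans (cong (_/ 2) (*-comm 2 m)) (m*n/n≡m m 2)) (/-monoˡ-≤ 2 p))

    boundsOK-sound : ∀ n T′ → boundsOK T (suc k) n T′ ≡ true → ∀ {S} → Unique S → NoInd (suc k) S →
                     ∀ i → length S ≡ n + i → ∃ λ E → T′ ! i ≡ just E × E ≤ edges S
    boundsOK-sound n [] ok u ni i len = ⊥-elim (tooMany n ok u ni (subst (n ≤_) (sym len) (m≤m+n n i)))
    boundsOK-sound n (E ∷ T′) ok {S} u ni i len with ∧-true {lowerBoundOK T (suc k) n E} ok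
    boundsOK-sound n (E ∷ T′) ok {S} u ni zero len | ok₁ , ok₂ =
      E , refl , lowerBoundOK-sound E (trans (cong (λ m → lowerBoundOK T (suc k) m E) (trans len (+-identityʳ n))) ok₁) u ni
    boundsOK-sound n (E ∷ T′) ok {S} u ni (suc i) len | ok₁ , ok₂ =
      boundsOK-sound (suc n) T′ ok₂ u ni i (trans len (+-suc n i))

    next : ∀ T′ → boundsOK T (suc k) 0 T′ ≡ true → LB T′ (suc k)
    next T′ ok {S} u ni = boundsOK-sound 0 T′ ok u ni (length S) refl

  LB₁ : LB (0 ∷ []) 1
  LB₁ {[]} u ni = 0 , refl , z≤n
  LB₁ {x ∷ S} u ni with s≤s () ← ni (x ∷ []) ([] ∷ []) (here refl ∷ [])

-- Intersections by multiplication

inter : Row → Row → ℕ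
inter [] _ = 0
inter (_ ∷ _) [] = 0
inter (a ∷ r) (b ∷ z) = bit a * bit b + inter r z

-- 1 + 32 + … + 32^(j-1)
rep : ℕ → ℕ
rep zero = 0
rep (suc j) = 1 + 32 * rep j

rep-pow : ∀ j → suc (31 * rep j) ≡ 32 ^ j
rep-pow zero = refl
rep-pow (suc j) = trans (solve 1 (λ r → con 1 :+ con 31 :* (con 1 :+ con 32 :* r) := con 32 :* (con 1 :+ con 31 :* r)) refl (rep j))
                    (cong (32 *_) (rep-pow j))
  where open +-*-Solver

bit≤1 : ∀ b → bit b ≤ 1
bit≤1 true = s≤s z≤n
bit≤1 false = z≤n

renc≤rep : ∀ z → renc z ≤ rep (length z)
renc≤rep [] = z≤n
renc≤rep (b ∷ z) = begin
  bit b * 32 ^ length z + renc z       ≤⟨ +-mono-≤ (*-monoˡ-≤ (32 ^ length z) (bit≤1 b)) (renc≤rep z) ⟩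
  1 * 32 ^ length z + rep (length z)   ≡⟨ cong (λ x → 1 * x + rep (length z)) (sym (rep-pow (length z))) ⟩
  1 * suc (31 * rep (length z)) + rep (length z)
    ≡⟨ solve 1 (λ r → con 1 :* (con 1 :+ con 31 :* r) :+ r := con 1 :+ con 32 :* r) refl (rep (length z)) ⟩
  rep (suc (length z))                 ∎
  where
  open ≤-Reasoning
  open +-*-Solver

-- The product convolves the digits, and the reversal in `renc` brings the pairs of equal positions
-- to place m. Each of the m lower places receives at most m ones, which bounds `low`.
product : ∀ m r z → length r ≡ suc m → length z ≡ suc m →
  ∃₂ λ low high → enc r * renc z ≡ low + 32 ^ m * (inter r z + 32 * high) × low ≤ m * rep m
product zero (a ∷ []) (b ∷ []) _ _ = 0 , 0 ,
  solve 2 (λ a b → (a :+ con 0) :* (b :* con 1 :+ con 0) := con 1 :* ((a :* b :+ con 0) :+ con 0)) refl (bit a) (bit b) , z≤n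
  where open +-*-Solver
product (suc m) (a ∷ r) (b ∷ z) lr lz
  with low , high , eq , bound ← product m r z (suc-injective lr) (suc-injective lz) =
  bit a * renc z + 32 * low , high + enc r * bit b , equation , low≤
  where
  equation : enc (a ∷ r) * renc (b ∷ z)
           ≡ (bit a * renc z + 32 * low) + 32 ^ suc m * (inter (a ∷ r) (b ∷ z) + 32 * (high + enc r * bit b))
  equation rewrite suc-injective lz = begin
    (x + 32 * e) * (y * (32 * p) + q)
      ≡⟨ solve 5 (λ x e y p q → (x :+ con 32 :* e) :* (y :* (con 32 :* p) :+ q)
           := (x :* q :+ con 32 :* (e :* q)) :+ con 32 :* p :* (x :* y :+ con 32 :* (e :* y))) refl x e y p q ⟩
    (x * q + 32 * (e * q)) + 32 * p * (x * y + 32 * (e * y))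
      ≡⟨ cong (λ t → (x * q + 32 * t) + 32 * p * (x * y + 32 * (e * y))) eq ⟩
    (x * q + 32 * (low + p * (i + 32 * high))) + 32 * p * (x * y + 32 * (e * y))
      ≡⟨ solve 8 (λ x e y p q l i h → (x :* q :+ con 32 :* (l :+ p :* (i :+ con 32 :* h))) :+ con 32 :* p :* (x :* y :+ con 32 :* (e :* y))
           := (x :* q :+ con 32 :* l) :+ con 32 :* p :* ((x :* y :+ i) :+ con 32 :* (h :+ e :* y))) refl x e y p q low i high ⟩
    (x * q + 32 * low) + 32 * p * ((x * y + i) + 32 * (high + e * y)) ∎
    where
    open ≡-Reasoning
    open +-*-Solver
    x y e p q i : ℕ
    x = bit a
    y = bit b
    e = enc r
    p = 32 ^ m
    q = renc z
    i = inter r z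
  low≤ : bit a * renc z + 32 * low ≤ suc m * rep (suc m)
  low≤ = +-mono-≤
    (≤-trans (*-monoˡ-≤ (renc z) (bit≤1 a)) (≤-trans (≤-reflexive (*-identityˡ _))
      (subst (λ j → renc z ≤ rep j) (suc-injective lz) (renc≤rep z))))
    (≤-trans (*-monoʳ-≤ 32 bound) (≤-trans (≤-reflexive (solve 2 (λ m r → con 32 :* (m :* r) := m :* (con 32 :* r)) refl m (rep m)))
      (*-monoʳ-≤ m (n≤1+n _))))
    where open +-*-Solver

inter≤ : ∀ r z → inter r z ≤ length r
inter≤ [] z = z≤n
inter≤ (a ∷ r) [] = z≤n
inter≤ (a ∷ r) (b ∷ z) = +-mono-≤ (*-mono-≤ (bit≤1 a) (bit≤1 b)) (inter≤ r z)

-- Since m ≤ 30, the lower part stays below 32 ^ m, and the digit at place m is at most m + 1 ≤ 31;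
-- so no carry disturbs it.
meet-inter : ∀ m w r z → suc w ≡ 32 ^ m → m < 31 → length r ≡ suc m → length z ≡ suc m →
             meet w (enc r) (renc z) ≡ inter r z
meet-inter m w r z w≡ m< lr lz with low , high , eq , bound ← product m r z lr lz = begin
  (enc r * renc z) / suc w % 32                ≡⟨ cong (λ t → t / suc w % 32) (trans eq (cong (low +_) (trans (cong (_* i+) (sym w≡)) (*-comm (suc w) i+)))) ⟩
  (low + i+ * suc w) / suc w % 32              ≡⟨ cong (_% 32) (+-distrib-/-∣ʳ low (divides i+ refl)) ⟩
  (low / suc w + i+ * suc w / suc w) % 32      ≡⟨ cong₂ (λ s t → (s + t) % 32) (m<n⇒m/n≡0 low<) (m*n/n≡m i+ (suc w)) ⟩
  i+ % 32                                      ≡⟨ cong (λ t → (inter r z + t) % 32) (*-comm 32 high) ⟩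
  (inter r z + high * 32) % 32                 ≡⟨ [m+kn]%n≡m%n (inter r z) high 32 ⟩
  inter r z % 32                               ≡⟨ m<n⇒m%n≡m (≤-<-trans (inter≤ r z) (subst (_< 32) (sym lr) (s≤s m<))) ⟩
  inter r z                                    ∎
  where
  open ≡-Reasoning
  i+ : ℕ
  i+ = inter r z + 32 * high
  low< : low < suc w
  low< = subst (low <_) (trans (rep-pow m) (sym w≡)) (s≤s (≤-trans bound (*-monoˡ-≤ (rep m) (<⇒≤ m<))))

-- Completeness of the search

module _ {V : Set} (C : V → Cand) (w : ℕ) where
  open Search w

  misses : ℕ → V → ℕ
  misses z u = if positive (meet w (code (C u)) z) then 0 else 1

  private
    isCand : ∀ {c cs} us → All (λ u → C u ∈ c ∷ cs) us →
             (∃₂ λ u us′ → us ↭ u ∷ us′ × C u ≡ c) ⊎ All (λ u → C u ∈ cs) us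
    isCand [] [] = inj₂ []
    isCand (u ∷ us) (here p ∷ ps) = inj₁ (u , us , ↭-refl , p)
    isCand (u ∷ us) (there p ∷ ps) with isCand us ps
    ... | inj₁ (u′ , us′ , q , e) = inj₁ (u′ , u ∷ us′ , ↭-trans (prep u q) (_↭_.swap u u′ ↭-refl) , e)
    ... | inj₂ qs = inj₂ (p ∷ qs)

    hitsAll-true : ∀ u K → All (λ z → misses z u ≡ 0) K → hitsAll (code (C u)) K ≡ true
    hitsAll-true u [] [] = refl
    hitsAll-true u (z ∷ K) (p ∷ ps) with meet w (code (C u)) z
    ... | suc _ = hitsAll-true u K ps

    missedByAny-true : ∀ z vs → missedByAny z (map C vs) ≡ true → 1 ≤ ∑ (misses z) vs
    missedByAny-true z (v ∷ vs) e with meet w (code (C v)) z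
    ... | zero = s≤s z≤n
    ... | suc _ = missedByAny-true z vs e

    critical-∈ : ∀ ch zs {z} → z ∈ critical ch zs → z ∈ zs × missedByAny z ch ≡ true
    critical-∈ ch (x ∷ zs) z∈ with missedByAny x ch in eq
    critical-∈ ch (x ∷ zs) (here refl) | true = here refl , eq
    critical-∈ ch (x ∷ zs) (there z∈) | true with p , q ← critical-∈ ch zs z∈ = there p , q
    ... | false with p , q ← critical-∈ ch zs z∈ = there p , q

    ∑-const≤ : ∀ {b} {f : V → ℕ} us → All (λ u → b ≤ f u) us → length us * b ≤ ∑ f us
    ∑-const≤ [] [] = z≤n
    ∑-const≤ (u ∷ us) (p ∷ ps) = +-mono-≤ p (∑-const≤ us ps)

    zero-∑ : ∀ {f : V → ℕ} {us} → ∑ f us ≡ 0 → ∀ {u} → u ∈ us → f u ≡ 0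
    zero-∑ {f} {x ∷ us} e (here refl) = m+n≡0⇒m≡0 (f x) e
    zero-∑ {f} {x ∷ us} e (there u∈) = zero-∑ (m+n≡0⇒n≡0 (f x) e) u∈

  Sorted : List Cand → Set
  Sorted = AllPairs (λ x y → h x ≤ h y)

  private
    search-skip : ∀ n {c cs ch B R sol} → n * h c ≤ B → sol ∈ search n cs ch B R → sol ∈ search n (c ∷ cs) ch B R
    search-skip zero _ s∈ = s∈
    search-skip (suc l) p s∈ rewrite ≤ᵇ-intro p = ∈-++⁺ʳ _ s∈

  -- vs are the neighbours whose cones have been chosen, us the others.
  search-complete : ∀ l cs us vs B R → length us ≡ l → Sorted cs → All (λ u → C u ∈ cs) us →
    (∀ {u z} → u ∈ us → z ∈ m₁ (C u) → misses z u ≡ 1 × ∑ (misses z) (vs ++ us) ≤ 1) →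
    (∀ {u z} → u ∈ us → z ∈ m₂ (C u) → misses z u ≡ 1 × ∑ (misses z) (vs ++ us) ≤ 2) →
    ∑ (h ∘ C) us ≤ B → ∑ (size ∘ C) us ≡ R →
    ∃ λ us′ → us′ ↭ us × map C us′ ∈ search l cs (map C vs) B R
  search-step : ∀ l c cs us vs B R → length us ≡ l → Sorted (c ∷ cs) → All (λ u → C u ∈ c ∷ cs) us →
    (∀ {u z} → u ∈ us → z ∈ m₁ (C u) → misses z u ≡ 1 × ∑ (misses z) (vs ++ us) ≤ 1) →
    (∀ {u z} → u ∈ us → z ∈ m₂ (C u) → misses z u ≡ 1 × ∑ (misses z) (vs ++ us) ≤ 2) →
    ∑ (h ∘ C) us ≤ B → ∑ (size ∘ C) us ≡ R →
    (∃₂ λ u us′ → us ↭ u ∷ us′ × C u ≡ c) ⊎ All (λ u → C u ∈ cs) us →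
    ∃ λ us′ → us′ ↭ us × map C us′ ∈ search l (c ∷ cs) (map C vs) B R
  search-complete zero cs [] vs B .0 refl so ∈cs p₁ p₂ b refl = [] , ↭-refl , here refl
  search-complete (suc l) [] (u ∷ us) vs B R len so (() ∷ _) p₁ p₂ b r
  search-complete n@(suc l) (c ∷ cs) us vs B R len so ∈cs p₁ p₂ b r =
    search-step n c cs us vs B R len so ∈cs p₁ p₂ b r (isCand us ∈cs)

  search-step zero c cs us vs B R len so ∈cs p₁ p₂ b r (inj₁ (u , us₁ , us↭ , _)) with () ← trans (sym len) (↭-length us↭)
  search-step n c cs us vs B R len so@(c≤ ∷ so′) ∈cs p₁ p₂ b r (inj₂ ∈cs′)
    with us′ , p , us′∈ ← search-complete n cs us vs B R len so′ ∈cs′ p₁ p₂ b r =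
    -- All remaining cones are at least as expensive as `c`, so the price test cannot have cut off
    -- this branch.
    us′ , p , search-skip n (≤-trans (≤-trans (≤-reflexive (cong (_* h c) (sym len))) (∑-const≤ us (All.map (λ C∈ → All.lookup c≤ C∈) ∈cs′))) b) us′∈
  search-step (suc l) c cs us vs B R len so@(c≤ ∷ so′) ∈cs p₁ p₂ b r (inj₁ (u , us₁ , us↭ , refl)) =
    u ∷ proj₁ rec , ↭-trans (prep u (proj₁ (proj₂ rec))) (↭-sym us↭) , found
    where
    len₁ : length us₁ ≡ l
    len₁ = suc-injective (trans (sym (↭-length us↭)) len)
    h-sum : h (C u) + ∑ (h ∘ C) us₁ ≤ B
    h-sum = subst (_≤ B) (∑-↭ (h ∘ C) us↭) b
    size-sum : size (C u) + ∑ (size ∘ C) us₁ ≡ R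
    size-sum = trans (sym (∑-↭ (size ∘ C) us↭)) r
    h≤ : ∀ {y} → y ∈ C u ∷ cs → h (C u) ≤ h y
    h≤ (here refl) = ≤-refl
    h≤ (there y∈) = All.lookup c≤ y∈
    ∈us : ∀ {u′} → u′ ∈ us₁ → u′ ∈ us
    ∈us u′∈ = ∈-resp-↭ (↭-sym us↭) (there u′∈)
    u∈us : u ∈ us
    u∈us = ∈-resp-↭ (↭-sym us↭) (here refl)
    h≤us : ∀ {u′} → u′ ∈ us₁ → h (C u) ≤ h (C u′)
    h≤us u′∈ = h≤ (All.lookup ∈cs (∈us u′∈))
    B′ R′ : ℕ
    B′ = B ∸ h (C u)
    R′ = R ∸ size (C u)
    K₁ K₂ : List ℕ
    K₁ = m₁ (C u)
    K₂ = critical (map C vs) (m₂ (C u))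
    h-sum₁ : ∑ (h ∘ C) us₁ ≤ B′
    h-sum₁ = ≤-trans (≤-reflexive (sym (m+n∸m≡n (h (C u)) _))) (∸-monoˡ-≤ (h (C u)) h-sum)
    size-sum₁ : ∑ (size ∘ C) us₁ ≡ R′
    size-sum₁ = trans (sym (m+n∸m≡n (size (C u)) _)) (cong (_∸ size (C u)) size-sum)
    total : ∀ z → ∑ (misses z) (vs ++ us) ≡ ∑ (misses z) vs + (misses z u + ∑ (misses z) us₁)
    total z = trans (∑-++ (misses z) vs us) (cong (∑ (misses z) vs +_) (∑-↭ (misses z) us↭))
    -- `u` alone exhausts the limit of one.
    none₁ : ∀ {z} → z ∈ K₁ → ∑ (misses z) us₁ ≡ 0
    none₁ {z} z∈ with m , le ← p₁ u∈us z∈ rewrite total z | m =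
      n≤0⇒n≡0 (≤-pred (≤-trans (m≤n+m _ (∑ (misses z) vs)) le))
    -- `u` and an earlier choice both miss `z`, which exhausts the limit of two.
    none₂ : ∀ {z} → z ∈ K₂ → ∑ (misses z) us₁ ≡ 0
    none₂ {z} z∈ with z∈m₂ , any ← critical-∈ (map C vs) (m₂ (C u)) z∈ with m , le ← p₂ u∈us z∈m₂ rewrite total z | m =
      n≤0⇒n≡0 (≤-pred (≤-pred (≤-trans (+-monoˡ-≤ (suc (∑ (misses z) us₁)) (missedByAny-true z vs any)) le)))
    fits-true : ∀ l us₁ {u′} → length us₁ ≡ l → u′ ∈ us₁ → ∑ (size ∘ C) us₁ ≡ R′ → fits l (size (C u′)) R′ ≡ true
    fits-true .1 (x ∷ []) refl (here refl) e = trans (cong (size (C x) ≡ᵇ_) (trans (sym e) (+-identityʳ _))) (≡ᵇ-refl (size (C x)))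
    fits-true .(suc (suc (length us₂))) (x ∷ y ∷ us₂) refl u′∈ e = refl
    budget : ∀ {u′} → u′ ∈ us₁ → h (C u′) + pred l * h (C u) ≤ B′
    budget {u′} u′∈ with us₂ , q ← ∈⇒↭∷ u′∈ = begin
      h (C u′) + pred l * h (C u)            ≡⟨ cong (λ n → h (C u′) + pred n * h (C u)) (trans (sym len₁) (↭-length q)) ⟩
      h (C u′) + length us₂ * h (C u)        ≤⟨ +-monoʳ-≤ (h (C u′)) (∑-const≤ us₂ (All.tabulate λ x∈ → h≤us (∈-resp-↭ (↭-sym q) (there x∈)))) ⟩
      h (C u′) + ∑ (h ∘ C) us₂               ≡⟨ sym (∑-↭ (h ∘ C) q) ⟩
      ∑ (h ∘ C) us₁                          ≤⟨ h-sum₁ ⟩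
      B′                                     ∎
      where open ≤-Reasoning
    comp : ∀ {u′} → u′ ∈ us₁ → compatible l (pred l * h (C u)) B′ R′ K₁ K₂ (C u′) ≡ true
    comp {u′} u′∈
      rewrite ≤ᵇ-intro (budget u′∈) | fits-true l us₁ len₁ u′∈ size-sum₁
            | hitsAll-true u′ K₁ (All.tabulate λ z∈ → zero-∑ (none₁ z∈) u′∈)
            | hitsAll-true u′ K₂ (All.tabulate λ z∈ → zero-∑ (none₂ z∈) u′∈) = refl
    cs₁ : List Cand
    cs₁ = filterᵇ (compatible l (pred l * h (C u)) B′ R′ K₁ K₂) (C u ∷ cs)
    ∈cs₁ : All (λ u′ → C u′ ∈ cs₁) us₁
    ∈cs₁ = All.tabulate λ u′∈ → ∈-filter⁺ (T? ∘ compatible l (pred l * h (C u)) B′ R′ K₁ K₂) (All.lookup ∈cs (∈us u′∈)) (T⁺ (comp u′∈))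
    shifted : ∀ z → ∑ (misses z) ((u ∷ vs) ++ us₁) ≡ ∑ (misses z) (vs ++ us)
    shifted z = trans (cong (misses z u +_) (∑-++ (misses z) vs us₁))
      (trans (solve 3 (λ a b c → a :+ (b :+ c) := b :+ (a :+ c)) refl (misses z u) (∑ (misses z) vs) (∑ (misses z) us₁)) (sym (total z)))
      where open +-*-Solver
    rec : ∃ λ us′ → us′ ↭ us₁ × map C us′ ∈ search l cs₁ (map C (u ∷ vs)) B′ R′
    rec = search-complete l cs₁ us₁ (u ∷ vs) B′ R′ len₁ (APₚ.filter⁺ (T? ∘ compatible l (pred l * h (C u)) B′ R′ K₁ K₂) so) ∈cs₁
      (λ {u′} {z} u′∈ z∈ → let m , le = p₁ (∈us u′∈) z∈ in m , subst (_≤ 1) (sym (shifted z)) le)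
      (λ {u′} {z} u′∈ z∈ → let m , le = p₂ (∈us u′∈) z∈ in m , subst (_≤ 2) (sym (shifted z)) le)
      h-sum₁ size-sum₁
    size≤ : size (C u) ≤ R
    size≤ = subst (size (C u) ≤_) size-sum (m≤m+n _ _)
    h≤B : suc l * h (C u) ≤ B
    h≤B = ≤-trans (≤-trans (≤-reflexive (cong (_* h (C u)) (sym len))) (∑-const≤ us (All.map h≤ ∈cs))) b
    found : map C (u ∷ proj₁ rec) ∈ search (suc l) (C u ∷ cs) (map C vs) B R
    found rewrite ≤ᵇ-intro h≤B | ≤ᵇ-intro size≤ = ∈-++⁺ˡ (∈-map⁺ (C u ∷_) (proj₂ (proj₂ rec)))

-- Correctness of the encodings

all-intro : ∀ {A : Set} (p : A → Bool) xs → (∀ {x} → x ∈ xs → p x ≡ true) → all p xs ≡ true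
all-intro p [] f = refl
all-intro p (x ∷ xs) f rewrite f (here refl) = all-intro p xs (f ∘ there)

nth : {A : Set} → A → List A → ℕ → A
nth d [] i = d
nth d (x ∷ xs) zero = x
nth d (x ∷ xs) (suc i) = nth d xs i

nth-∈ : {A : Set} (d : A) (xs : List A) {i : ℕ} → i < length xs → nth d xs i ∈ xs
nth-∈ d (x ∷ xs) {zero} p = here refl
nth-∈ d (x ∷ xs) {suc i} (s≤s p) = there (nth-∈ d xs p)

nth-injective : {A : Set} (d : A) {xs : List A} → Unique xs → ∀ {i j} → i < length xs → j < length xs →
                nth d xs i ≡ nth d xs j → i ≡ j
nth-injective d (x∉ ∷ u) {zero} {zero} p q e = refl
nth-injective d {x ∷ xs} (x∉ ∷ u) {zero} {suc j} p (s≤s q) e = ⊥-elim (All.lookup x∉ (nth-∈ d xs q) e)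
nth-injective d {x ∷ xs} (x∉ ∷ u) {suc i} {zero} (s≤s p) q e = ⊥-elim (All.lookup x∉ (nth-∈ d xs p) (sym e))
nth-injective d (x∉ ∷ u) {suc i} {suc j} (s≤s p) (s≤s q) e = cong suc (nth-injective d u p q e)

nthB-map : {A : Set} (d : A) (f : A → Bool) (xs : List A) {i : ℕ} → i < length xs → nthB (map f xs) i ≡ f (nth d xs i)
nthB-map d f (x ∷ xs) {zero} p = refl
nthB-map d f (x ∷ xs) {suc i} (s≤s p) = nthB-map d f xs p

eqRow-sound : ∀ r s → eqRow r s ≡ true → r ≡ s
eqRow-sound [] [] _ = refl
eqRow-sound (true ∷ r) (true ∷ s) e = cong (true ∷_) (eqRow-sound r s e)
eqRow-sound (false ∷ r) (false ∷ s) e = cong (false ∷_) (eqRow-sound r s e)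

eqTri-sound : ∀ X Y → eqTri X Y ≡ true → X ≡ Y
eqTri-sound [] [] _ = refl
eqTri-sound (r ∷ X) (s ∷ Y) e with eqRow r s in q
... | true = cong₂ _∷_ (eqRow-sound r s q) (eqTri-sound X Y e)

distinct-sound : ∀ π → distinct π ≡ true → Unique π
distinct-sound [] _ = []
distinct-sound (i ∷ π) e with all (λ j → not (i ≡ᵇ j)) π in q
... | true = All.tabulate (λ j∈ i≡j → differ (all-true (λ j → not (i ≡ᵇ j)) q j∈) i≡j) ∷ distinct-sound π e
  where
  differ : ∀ {i j} → not (i ≡ᵇ j) ≡ true → i ≡ j → ⊥
  differ {i} p refl with i ≡ᵇ i | ≡⇒≡ᵇ i i refl
  differ {i} () refl | true | _

select : {A : Set} → Row → List A → List A
select [] xs = []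
select (b ∷ z) [] = []
select (true ∷ z) (x ∷ xs) = x ∷ select z xs
select (false ∷ z) (x ∷ xs) = select z xs

select-⊆ : {A : Set} (z : Row) (xs : List A) {x : A} → x ∈ select z xs → x ∈ xs
select-⊆ (true ∷ z) (x ∷ xs) (here p) = here p
select-⊆ (true ∷ z) (x ∷ xs) (there p) = there (select-⊆ z xs p)
select-⊆ (false ∷ z) (x ∷ xs) p = there (select-⊆ z xs p)

length-select : {A : Set} (z : Row) (xs : List A) → length z ≡ length xs → length (select z xs) ≡ count z
length-select [] [] e = refl
length-select (true ∷ z) (x ∷ xs) e = cong suc (length-select z xs (suc-injective e))
length-select (false ∷ z) (x ∷ xs) e = length-select z xs (suc-injective e)

inter-select : {A : Set} (f : A → Bool) (z : Row) (xs : List A) → inter (map f xs) z ≡ 0 →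
               ∀ {x} → x ∈ select z xs → f x ≡ false
inter-select f (true ∷ z) (x ∷ xs) e (here refl) with f x | e
... | false | _ = refl
inter-select f (true ∷ z) (x ∷ xs) e (there p) = inter-select f z xs (m+n≡0⇒n≡0 (bit (f x) * 1) e) p
inter-select f (false ∷ z) (x ∷ xs) e p = inter-select f z xs (m+n≡0⇒n≡0 (bit (f x) * 0) e) p

disjoint-inter : ∀ r z → disjoint r z ≡ true → inter r z ≡ 0
disjoint-inter [] z e = refl
disjoint-inter (a ∷ r) [] e = refl
disjoint-inter (true ∷ r) (false ∷ z) e = disjoint-inter r z e
disjoint-inter (false ∷ r) (true ∷ z) e = disjoint-inter r z e
disjoint-inter (false ∷ r) (false ∷ z) e = disjoint-inter r z e

disjoint-map : {A : Set} (f g : A → Bool) (xs : List A) → All (λ x → g x ≡ true → f x ≡ false) xs →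
               disjoint (map f xs) (map g xs) ≡ true
disjoint-map f g [] [] = refl
disjoint-map f g (x ∷ xs) (p ∷ ps) with f x | g x
... | true | true with () ← p refl
... | true | false = disjoint-map f g xs ps
... | false | _ = disjoint-map f g xs ps

meet-ok : ∀ m r z → m < 32 → length r ≡ m → length z ≡ m → meet (32 ^ pred m ∸ 1) (enc r) (renc z) ≡ inter r z
meet-ok zero [] [] _ _ _ = refl
meet-ok (suc m) r z (s≤s m<) lr lz = meet-inter m _ r z (suc-pred-pow m) m< lr lz
  where
  suc-pred-pow : ∀ m → suc (32 ^ m ∸ 1) ≡ 32 ^ m
  suc-pred-pow m rewrite sym (rep-pow m) = refl

module Gluing {A : Set} (adj : A → A → Bool)
  (adj-sym : ∀ x y → adj x y ≡ adj y x) (adj-irr : ∀ x → adj x x ≡ false)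
  (tf : ∀ {x y z} → adj x y ≡ true → adj x z ≡ true → adj y z ≡ true → ⊥) where

  open TriangleFree adj adj-sym adj-irr tf

  tri : List A → Tri
  tri [] = []
  tri (y ∷ ys) = map (adj y) ys ∷ tri ys

  length-tri : ∀ ys → length (tri ys) ≡ length ys
  length-tri [] = refl
  length-tri (y ∷ ys) = cong suc (length-tri ys)

  count-map : (f : A → Bool) (xs : List A) → count (map f xs) ≡ ∑ (bit ∘ f) xs
  count-map f [] = refl
  count-map f (x ∷ xs) = cong (bit (f x) +_) (count-map f xs)

  at-tri : ∀ d ys {i j} → i < length ys → j < length ys → i ≢ j → at (tri ys) i j ≡ adj (nth d ys i) (nth d ys j)
  at-tri d (y ∷ ys) {zero} {zero} p q i≢j = ⊥-elim (i≢j refl)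
  at-tri d (y ∷ ys) {zero} {suc j} p (s≤s q) i≢j = nthB-map d (adj y) ys q
  at-tri d (y ∷ ys) {suc i} {zero} (s≤s p) q i≢j = trans (nthB-map d (adj y) ys p) (adj-sym y _)
  at-tri d (y ∷ ys) {suc i} {suc j} (s≤s p) (s≤s q) i≢j = at-tri d ys p q (i≢j ∘ cong suc)

  relabel-tri : ∀ d ys π → Unique π → All (_< length ys) π → relabel (tri ys) π ≡ tri (map (nth d ys) π)
  relabel-tri d ys [] u b = refl
  relabel-tri d ys (i ∷ π) (i∉ ∷ u) (i< ∷ b) = cong₂ _∷_
    (trans (map-cong-∈ (All.zipWith (λ (i≢j , j<) → at-tri d ys i< j< i≢j) (i∉ , b))) (Lₚ.map-∘ π))
    (relabel-tri d ys π u b)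
    where
    map-cong-∈ : ∀ {f g : ℕ → Bool} {xs} → All (λ x → f x ≡ g x) xs → map f xs ≡ map g xs
    map-cong-∈ [] = refl
    map-cong-∈ (p ∷ ps) = cong₂ _∷_ p (map-cong-∈ ps)

  -- Whatever the search returns, the checks of length, range and distinctness make it a permutation
  -- of the positions, and relabelling along it gives `X`.
  isoTo-sound : ∀ {ys X} → Unique ys → isoTo (tri ys) X ≡ true → ∃ λ zs → zs ↭ ys × tri zs ≡ X
  isoTo-sound {ys} {X} u e = go (embed (template [] (vertsOf X)) [] (vertsOf (tri ys))) e
    where
    go : ∀ mπ → validIso (tri ys) X mπ ≡ true → ∃ λ zs → zs ↭ ys × tri zs ≡ X
    go (just π) v with ∧-true {length π ≡ᵇ length (tri ys)} v
    ... | l , v₁ with ∧-true {all (λ i → i <ᵇ length (tri ys)) π} v₁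
    ... | b , v₂ with ∧-true {distinct π} v₂
    ... | dis , eq = conclude ys u refl
      where
      len : length π ≡ length ys
      len = trans (≡ᵇ-true l) (length-tri ys)
      bounded : All (_< length ys) π
      bounded = All.tabulate λ i∈ → subst (_ <_) (length-tri ys) (<ᵇ-true (all-true (λ i → i <ᵇ length (tri ys)) b i∈))
      uπ : Unique π
      uπ = distinct-sound π dis
      conclude : ∀ xs → Unique xs → xs ≡ ys → ∃ λ zs → zs ↭ ys × tri zs ≡ X
      conclude [] _ refl = [] , ↭-refl , trans (cong (relabel []) (sym (empty π len))) (eqTri-sound (relabel [] π) X eq)
        where
        empty : ∀ π → length π ≡ 0 → π ≡ []
        empty [] _ = refl
      -- The first vertex serves as the default value of `nth`.
      conclude (d ∷ xs) _ refl = map (nth d ys) π ,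
        unique⊆⇒↭ (unique-map uπ bounded) (Allₚ.map⁺ (All.map (nth-∈ d ys) bounded)) (≤-reflexive (trans (sym len) (sym (Lₚ.length-map _ π)))) ,
        trans (sym (relabel-tri d ys π uπ bounded)) (eqTri-sound _ X eq)
        where
        unique-map : ∀ {π} → Unique π → All (_< length ys) π → Unique (map (nth d ys) π)
        unique-map [] [] = []
        unique-map (i∉ ∷ u′) (i< ∷ b) =
          Allₚ.map⁺ (All.zipWith (λ (i≢j , j<) e → i≢j (nth-injective d u i< j< e)) (i∉ , b)) ∷ unique-map u′ b

  indSets-complete : (p : A → Bool) (ys : List A) →
    (∀ {y y′} → y ∈ ys → y′ ∈ ys → p y ≡ true → p y′ ≡ true → adj y y′ ≡ false) → map p ys ∈ indSets (tri ys)
  indSets-complete p [] ind = here refl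
  indSets-complete p (y ∷ ys) ind with p y in py
  ... | false = ∈-++⁺ˡ (∈-map⁺ (false ∷_) (indSets-complete p ys (λ a b → ind (there a) (there b))))
  ... | true = ∈-++⁺ʳ (map (false ∷_) (indSets (tri ys)))
    (∈-map⁺ (true ∷_) (∈-filter⁺ (T? ∘ disjoint (map (adj y) ys)) (indSets-complete p ys (λ a b → ind (there a) (there b)))
      (T⁺ (disjoint-map (adj y) p ys (All.tabulate λ y′∈ py′ → ind (here refl) (there y′∈) py py′)))))

  indSets-sound : ∀ ys {z} → Unique ys → z ∈ indSets (tri ys) → length z ≡ length ys × AllPairs Anti (select z ys)
  indSets-sound [] u (here refl) = refl , []
  indSets-sound (y ∷ ys) (y∉ ∷ u) z∈ with ∈-++⁻ (map (false ∷_) (indSets (tri ys))) z∈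
  ... | inj₁ z∈₁ with z′ , z′∈ , refl ← ∈-map⁻ (false ∷_) z∈₁ with l , a ← indSets-sound ys u z′∈ = cong suc l , a
  ... | inj₂ z∈₂ with z′ , z′∈f , refl ← ∈-map⁻ (true ∷_) z∈₂
      with z′∈ , dis ← ∈-filter⁻ (T? ∘ disjoint (map (adj y) ys)) z′∈f with l , a ← indSets-sound ys u z′∈ =
    cong suc l , All.tabulate (λ x∈ → All.lookup y∉ (select-⊆ z′ ys x∈) ,
      inter-select (adj y) z′ ys (disjoint-inter (map (adj y) ys) z′ (T⇒ dis)) x∈) ∷ a
    where
    T⇒ : ∀ {b} → T b → b ≡ true
    T⇒ {true} _ = refl

  tri-glue : ∀ {v us ys} → All (λ u → adj v u ≡ true) us → All (λ y → adj v y ≡ false) ys → AllPairs Anti us →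
    glue (tri ys) (map (λ u → map (adj u) ys) us) ≡ tri (v ∷ us ++ ys)
  tri-glue {v} {us} {ys} n nn a = cong₂ _∷_
    (sym (trans (Lₚ.map-++ (adj v) us ys) (cong₂ _++_ (constant n (Lₚ.length-map _ us)) (constant nn (length-tri ys)))))
    (sym (rows a))
    where
    constant : ∀ {b} {f : A → Bool} {xs : List A} {n} → All (λ x → f x ≡ b) xs → n ≡ length xs → map f xs ≡ replicate n b
    constant [] refl = refl
    constant (p ∷ ps) refl = cong₂ _∷_ p (constant ps refl)
    rows : ∀ {us} → AllPairs Anti us → tri (us ++ ys) ≡ nbrRows (map (λ u → map (adj u) ys) us) ++ tri ys
    rows [] = refl
    rows {u ∷ us} (p ∷ ps) = cong₂ _∷_
      (trans (Lₚ.map-++ (adj u) us ys) (cong (_++ map (adj u) ys) (constant (All.map proj₂ p) (Lₚ.length-map _ us))))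
      (rows ps)

miss : ℕ → ℕ
miss x = if positive x then 0 else 1

∑-miss : {A : Set} (f : A → ℕ) (xs : List A) → ∑ (miss ∘ f) xs ≡ length (filterᵇ (not ∘ positive ∘ f) xs)
∑-miss f [] = refl
∑-miss f (x ∷ xs) with f x
... | zero = cong suc (∑-miss f xs)
... | suc _ = ∑-miss f xs

minH-≤ : ∀ B cs {c} → c ∈ cs → minH B cs ≤ h c
minH-≤ B (x ∷ cs) (here refl) = m⊓n≤m _ _
minH-≤ B (x ∷ cs) (there c∈) = ≤-trans (m⊓n≤n (h x) _) (minH-≤ B cs c∈)

sortH-∈ : ∀ {c cs} → c ∈ cs → c ∈ sortH cs
sortH-∈ {cs = cs} c∈ = ∈-resp-↭ (↭-sym (SortingAlgorithm.sort-↭ (IS.insertionSort byH) cs)) c∈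

sortH-sorted : ∀ cs → AllPairs (λ x y → h x ≤ h y) (sortH cs)
sortH-sorted cs = Linkedₚ.Linked⇒AllPairs (λ {x} {y} {z} p q → ≤-trans {h x} {h y} {h z} p q) (SortingAlgorithm.sort-↗ (IS.insertionSort byH) cs)

T⇒ : ∀ {b} → T b → b ≡ true
T⇒ {true} _ = refl

weigh-∈ : ∀ n Z → All (λ p → proj₁ p ∈ Z) (weigh n Z)
weigh-∈ n [] = []
weigh-∈ n (z ∷ Z) = here refl ∷ All.map there (weigh-∈ (n / 10) Z)

-- Keeps the limits 1 and 2 valid for small k, where the size of the sets is truncated to 0.
m∸[m∸n]≤n : ∀ m n → m ∸ (m ∸ n) ≤ n
m∸[m∸n]≤n m n = m≤n+o⇒m∸n≤o m (m ∸ n) (m≤n+m∸n′ m n)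
  where
  m≤n+m∸n′ : ∀ m n → m ≤ m ∸ n + n
  m≤n+m∸n′ m n = subst (m ≤_) (+-comm n (m ∸ n)) (m≤n+m∸n m n)

-- The search finds every graph with a given root

module RootGluing {A : Set} (adj : A → A → Bool)
  (adj-sym : ∀ x y → adj x y ≡ adj y x) (adj-irr : ∀ x → adj x x ≡ false)
  (tf : ∀ {x y z} → adj x y ≡ true → adj x z ≡ true → adj y z ≡ true → ⊥) where

  open TriangleFree adj adj-sym adj-irr tf
  open Gluing adj adj-sym adj-irr tf
  open LinearProgram adj adj-sym adj-irr tf

  module _ {S v} (uS : Unique S) (sp : Split v S) (k : ℕ) (noI : NoInd (suc k) S)
           {ys} (ys↭ : ys ↭ Split.H sp) (small : length ys < 32) (wt q : ℕ) where
    open Split sp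

    private
      X : Tri
      X = tri ys
      w d R B : ℕ
      w = 32 ^ pred (length X) ∸ 1
      d = length N
      R = cross N H
      I : List Row
      I = indSets X
      Z₁ Z₂ : List ℕ
      Z₁ = map renc (ofSize (suc k ∸ 2) I)
      Z₂ = map renc (ofSize (suc k ∸ 3) I)
      W : List (ℕ × ℕ)
      W = weigh wt Z₁
      B = sum (map proj₂ W) + q * R
      cone : A → Row
      cone u = map (adj u) ys
      C : A → Cand
      C u = toCand w W Z₁ Z₂ q (cone u)
      uys : Unique ys
      uys = Unique-↭ (↭-sym ys↭) (split-uH sp uS)
      ys⊆H : All (_∈ H) ys
      ys⊆H = ↭-⊆ (↭-sym ys↭)
      N⊆S : All (_∈ S) N
      N⊆S = Allₚ.++⁻ˡ N (All.tail (split-⊆ sp uS))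
      v-non : ∀ {y} → y ∈ ys → adj v y ≡ false
      v-non y∈ = proj₂ (All.lookup non (All.lookup ys⊆H y∈))

      meets : ∀ u {z₀} → z₀ ∈ I → meet w (code (C u)) (renc z₀) ≡ inter (cone u) z₀
      meets u {z₀} z₀∈ = trans (cong (λ m → meet (32 ^ pred m ∸ 1) (enc (cone u)) (renc z₀)) (length-tri ys))
        (meet-ok (length ys) (cone u) z₀ small (Lₚ.length-map (adj u) ys) (proj₁ (indSets-sound ys uys z₀∈)))

      -- An independent set of X together with the neighbours whose cones miss it is independent.
      missing-bound : ∀ {z₀} → z₀ ∈ I → count z₀ + ∑ (misses C w (renc z₀)) N ≤ k
      missing-bound {z₀} z₀∈ = ≤-pred (subst (_< suc k) size-eq (noI (sel ++ M) anti sub))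
        where
        lz : length z₀ ≡ length ys
        lz = proj₁ (indSets-sound ys uys z₀∈)
        sel M : List A
        sel = select z₀ ys
        f : A → ℕ
        f u = meet w (code (C u)) (renc z₀)
        P? = T? ∘ (not ∘ positive ∘ f)
        M = filterᵇ (not ∘ positive ∘ f) N
        zero-f : ∀ {u} → T (not (positive (f u))) → f u ≡ 0
        zero-f {u} t with f u
        ... | zero = refl
        M-missing : ∀ {u} → u ∈ M → u ∈ N × ∀ {y} → y ∈ sel → adj u y ≡ false
        M-missing {u} u∈ with u∈N , t ← ∈-filter⁻ P? {xs = N} u∈ =
          u∈N , inter-select (adj u) z₀ ys (trans (sym (meets u z₀∈)) (zero-f {u} t))
        cross-anti : ∀ {y} → y ∈ sel → ∀ {u} → u ∈ M → Anti y u
        cross-anti {y} y∈ {u} u∈ with u∈N , miss ← M-missing u∈ =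
          (λ { refl → true≢false (trans (sym (All.lookup nbr u∈N)) (v-non (select-⊆ z₀ ys y∈))) }) ,
          trans (adj-sym y u) (miss y∈)
        anti : AllPairs Anti (sel ++ M)
        anti = APₚ.++⁺ (proj₂ (indSets-sound ys uys z₀∈)) (APₚ.filter⁺ P? (split-antiN sp uS))
          (All.tabulate λ y∈ → All.tabulate λ u∈ → cross-anti y∈ u∈)
        sub : All (_∈ S) (sel ++ M)
        sub = Allₚ.++⁺ (All.tabulate λ y∈ → All.lookup (H⊆S sp uS) (All.lookup ys⊆H (select-⊆ z₀ ys y∈)))
          (All.tabulate λ u∈ → All.lookup N⊆S (proj₁ (M-missing u∈)))
        size-eq : length (sel ++ M) ≡ count z₀ + ∑ (misses C w (renc z₀)) N
        size-eq = trans (Lₚ.length-++ sel) (cong₂ _+_ (length-select z₀ ys lz) (sym (∑-miss f N)))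

      ofSize-bound : ∀ s {z} → z ∈ map renc (ofSize s I) → ∑ (misses C w z) N ≤ k ∸ s
      ofSize-bound s {z} z∈ with z₀ , z₀∈f , refl ← ∈-map⁻ renc z∈
        with z₀∈ , t ← ∈-filter⁻ (T? ∘ (λ z → count z ≡ᵇ s)) {xs = I} z₀∈f =
        subst (λ s → ∑ (misses C w (renc z₀)) N ≤ k ∸ s) (≡ᵇ⇒≡ (count z₀) s t)
          (m+n≤o⇒n≤o∸m (count z₀) (missing-bound z₀∈))
        where
        m+n≤o⇒n≤o∸m : ∀ m {n o} → m + n ≤ o → n ≤ o ∸ m
        m+n≤o⇒n≤o∸m m {n} p = ≤-trans (≤-reflexive (sym (m+n∸m≡n m n))) (∸-monoˡ-≤ m p)

      Z₁-bound : ∀ {z} → z ∈ Z₁ → ∑ (misses C w z) N ≤ 1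
      Z₁-bound z∈ = ≤-trans (ofSize-bound (k ∸ 1) z∈) (m∸[m∸n]≤n k 1)

      Z₂-bound : ∀ {z} → z ∈ Z₂ → ∑ (misses C w z) N ≤ 2
      Z₂-bound z∈ = ≤-trans (ofSize-bound (k ∸ 2) z∈) (m∸[m∸n]≤n k 2)

      misses-1 : ∀ {u z} → T (not (positive (meet w (code (C u)) z))) → misses C w z u ≡ 1
      misses-1 {u} {z} t with meet w (code (C u)) z
      ... | zero = refl

      p₁ : ∀ {u z} → u ∈ N → z ∈ m₁ (C u) → misses C w z u ≡ 1 × ∑ (misses C w z) N ≤ 1
      p₁ {u} {z} u∈ z∈ with z∈Z , t ← ∈-filter⁻ (T? ∘ _) {xs = Z₁} z∈ = misses-1 {u} {z} t , Z₁-bound z∈Z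

      p₂ : ∀ {u z} → u ∈ N → z ∈ m₂ (C u) → misses C w z u ≡ 1 × ∑ (misses C w z) N ≤ 2
      p₂ {u} {z} u∈ z∈ with z∈Z , t ← ∈-filter⁻ (T? ∘ _) {xs = Z₂} z∈ = misses-1 {u} {z} t , Z₂-bound z∈Z

      size-sum : ∑ (size ∘ C) N ≡ R
      size-sum = ∑-cong (All.universal (λ u → trans (count-map (adj u) ys) (∑-↭ (bit ∘ adj u) ys↭)) N)

      lost-sum : ∀ W → All (λ p → proj₁ p ∈ Z₁) W → ∑ (λ u → lost w W (enc (cone u))) N ≤ sum (map proj₂ W)
      lost-sum [] [] = ≤-reflexive (∑-zero {xs = N} (All.universal (λ _ → refl) N))
      lost-sum ((z , y) ∷ W) (z∈ ∷ W∈) = begin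
        ∑ (λ u → (if positive (f u) then 0 else y) + lost w W (enc (cone u))) N
          ≡⟨ ∑-+ (λ u → if positive (f u) then 0 else y) _ N ⟩
        ∑ (λ u → if positive (f u) then 0 else y) N + ∑ (λ u → lost w W (enc (cone u))) N
          ≤⟨ +-mono-≤ (≤-reflexive (∑-cong (All.universal weight N))) (lost-sum W W∈) ⟩
        ∑ (λ u → y * misses C w z u) N + sum (map proj₂ W)
          ≤⟨ +-monoˡ-≤ _ (≤-trans (≤-reflexive (∑-*ˡ y (misses C w z) N)) (*-monoʳ-≤ y (Z₁-bound z∈))) ⟩
        y * 1 + sum (map proj₂ W)
          ≡⟨ cong (_+ sum (map proj₂ W)) (*-identityʳ y) ⟩
        y + sum (map proj₂ W) ∎
        where
        open ≤-Reasoning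
        f : A → ℕ
        f u = meet w (enc (cone u)) z
        weight : ∀ u → (if positive (f u) then 0 else y) ≡ y * misses C w z u
        weight u with f u
        ... | zero = sym (*-identityʳ y)
        ... | suc _ = sym (*-zeroʳ y)

      h-sum : ∑ (h ∘ C) N ≤ B
      h-sum = ≤-trans (≤-reflexive (∑-+ (λ u → lost w W (enc (cone u))) (λ u → q * count (cone u)) N))
        (+-mono-≤ (lost-sum W (weigh-∈ wt Z₁)) (≤-reflexive (trans (∑-*ˡ q (count ∘ cone) N) (cong (q *_) size-sum))))

      I₀ : List Cand
      I₀ = Gluings.candidates (suc k) wt q d R w Z₁ Z₂ W I

      C∈I₀ : ∀ {u} → u ∈ N → C u ∈ I₀
      C∈I₀ {u} u∈ = ∈-map⁺ (toCand w W Z₁ Z₂ q) (∈-filter⁺ (T? ∘ (λ c → count c ≤ᵇ (suc k ∸ 2)))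
        (indSets-complete (adj u) ys (λ {y} {y′} _ _ a b → no-edge a b)) (≤⇒≤ᵇ small-cone))
        where
        no-edge : ∀ {y y′} → adj u y ≡ true → adj u y′ ≡ true → adj y y′ ≡ false
        no-edge {y} {y′} a b with adj y y′ in c
        ... | true = ⊥-elim (tf a b c)
        ... | false = refl
        spu : Split u S
        spu = splitAt uS (All.lookup N⊆S u∈)
        small-cone : count (cone u) ≤ k ∸ 1
        small-cone = begin
          count (cone u)   ≡⟨ trans (count-map (adj u) ys) (∑-↭ (bit ∘ adj u) ys↭) ⟩
          deg u H          ≡⟨ cong pred (trans (sym (All.lookup (deg-nbr sp uS) u∈)) (deg-split spu uS)) ⟩
          pred (length (Split.N spu)) ≤⟨ pred-mono-≤ (≤-pred (deg< spu uS noI)) ⟩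
          pred k           ≡⟨ pred[n]≡n∸1 k ⟩
          k ∸ 1            ∎
          where
          open ≤-Reasoning
          pred[n]≡n∸1 : ∀ k → pred k ≡ k ∸ 1
          pred[n]≡n∸1 zero = refl
          pred[n]≡n∸1 (suc k) = refl

      p : ℕ
      p = minH B I₀
      keepᵇ : Cand → Bool
      keepᵇ c = h c + pred d * p ≤ᵇ B

      C∈sorted : All (λ u → C u ∈ sortH (filterᵇ keepᵇ I₀)) N
      C∈sorted = All.tabulate λ u∈ → sortH-∈ (∈-filter⁺ (T? ∘ keepᵇ) (C∈I₀ u∈) (≤⇒≤ᵇ (budget u∈)))
        where
        budget : ∀ {u} → u ∈ N → h (C u) + pred d * p ≤ B
        budget {u} u∈ with us₂ , r ← ∈⇒↭∷ u∈ = begin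
          h (C u) + pred d * p            ≡⟨ cong (λ n → h (C u) + pred n * p) (↭-length r) ⟩
          h (C u) + length us₂ * p        ≤⟨ +-monoʳ-≤ (h (C u)) (subst (_≤ ∑ (h ∘ C) us₂) (∑-const p us₂)
                                              (∑-mono (All.tabulate λ x∈ → minH-≤ B I₀ (C∈I₀ (∈-resp-↭ (↭-sym r) (there x∈)))))) ⟩
          h (C u) + ∑ (h ∘ C) us₂         ≡⟨ sym (∑-↭ (h ∘ C) r) ⟩
          ∑ (h ∘ C) N                     ≤⟨ h-sum ⟩
          B                               ∎
          where open ≤-Reasoning

      found : ∃ λ us → us ↭ N × map C us ∈ Search.search w d (sortH (filterᵇ keepᵇ I₀)) [] B R
      found = search-complete C w d (sortH (filterᵇ keepᵇ I₀)) N [] B R refl (sortH-sorted (filterᵇ keepᵇ I₀)) C∈sorted p₁ p₂ h-sum size-sum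

      numMissing-∑ : ∀ z us → numMissing w z (map C us) ≡ ∑ (misses C w z) us
      numMissing-∑ z [] = refl
      numMissing-∑ z (u ∷ us) = cong (misses C w z u +_) (numMissing-∑ z us)

      caps-bound : ∀ s {j Z z} → (j , Z) ∈ Gluings.caps (suc k) wt q d R s I → z ∈ Z → ∑ (misses C w z) N ≤ j
      caps-bound (suc s) (here refl) z∈ = ofSize-bound (suc s) z∈
      caps-bound (suc s) (there p) z∈ = caps-bound s p z∈

      capped-true : ∀ {us} → us ↭ N → capped w (Gluings.caps (suc k) wt q d R (suc k ∸ 4) I) (map C us) ≡ true
      capped-true {us} r = all-intro _ (Gluings.caps (suc k) wt q d R (suc k ∸ 4) I) λ { {j , Z} jZ∈ →
        all-intro (λ z → numMissing w z (map C us) ≤ᵇ j) Z λ {z} z∈ →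
          ≤ᵇ-intro (≤-trans (≤-reflexive (trans (numMissing-∑ z us) (∑-↭ (misses C w z) r))) (caps-bound (suc k ∸ 4) jZ∈ z∈)) }

    -- The search returns a reordering `us` of the neighbours, so the glued matrix is that of `v`,
    -- `us` and `ys` in this order. The weights and the price per vertex are arbitrary; they decide
    -- only how much of the search is cut off.
    gluing-sound : ∀ L → checkGlue (suc k) wt q (length N) (cross N H) L (tri ys) ≡ true →
                   ∃ λ zs → zs ↭ S × tri zs ∈ L
    gluing-sound L ok = conclude (proj₁ found) (proj₁ (proj₂ found)) (proj₂ (proj₂ found))
      where
      conclude : ∀ us → us ↭ N → map C us ∈ Search.search w d (sortH (filterᵇ keepᵇ I₀)) [] B R →
                 ∃ λ zs → zs ↭ S × tri zs ∈ L
      conclude us us↭N us∈ = fromIso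
        (any-true (isoTo (glue X (map row (map C us)))) L
          (all-true (λ cs → any (isoTo (glue X (map row cs))) L) ok
            (∈-filter⁺ (T? ∘ capped w (Gluings.caps (suc k) wt q d R (suc k ∸ 4) I)) us∈ (T⁺ (capped-true us↭N)))))
        where
        all↭ : v ∷ us ++ ys ↭ S
        all↭ = ↭-trans (prep v (++⁺ us↭N ys↭)) (↭-sym perm)
        glue≡ : glue X (map row (map C us)) ≡ tri (v ∷ us ++ ys)
        glue≡ = trans (cong (glue X) (sym (Lₚ.map-∘ us)))
          (tri-glue (All-resp-↭ (↭-sym us↭N) nbr) (All.tabulate v-non) (AllPairs-↭ Anti-sym (↭-sym us↭N) (split-antiN sp uS)))
        fromIso : (∃ λ X′ → X′ ∈ L × isoTo (glue X (map row (map C us))) X′ ≡ true) → ∃ λ zs → zs ↭ S × tri zs ∈ L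
        fromIso (X′ , X′∈ , iso)
          with zs , zs↭ , tri≡ ← isoTo-sound {v ∷ us ++ ys} {X′} (Unique-↭ (↭-sym all↭) uS)
                 (trans (cong (λ Y → isoTo Y X′) (sym glue≡)) iso) =
          zs , ↭-trans zs↭ all↭ , subst (_∈ L) (sym tri≡) X′∈

-- Each graph comes with the weights (decimal digits) and the price q per vertex of a cone
-- that bound its gluings.
record Root : Set where
  constructor root
  field
    order edgeCount : ℕ
    graphs : List (Tri × ℕ × ℕ)
open Root

-- If no vertex has non-neighbours with the parameters of a root, a lower bound equal to the edge
-- count of that root improves by one. Roots are processed in turn, so listing equal orders by
-- increasing edge count raises an entry repeatedly.
raise : List Root → ℕ → ℕ → ℕ
raise [] n E = E
raise (r ∷ rs) n E = if (order r ≡ᵇ n) ∧ (edgeCount r ≡ᵇ E) then raise rs n (suc E) else raise rs n E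

raise-≤ : ∀ rs {n e E} → (∀ {r} → r ∈ rs → (order r ≡ᵇ n) ∧ (edgeCount r ≡ᵇ e) ≡ false) → E ≤ e → raise rs n E ≤ e
raise-≤ [] nr E≤ = E≤
raise-≤ (r ∷ rs) {n} {e} {E} nr E≤ with order r ≡ᵇ n in q₁ | edgeCount r ≡ᵇ E in q₂
... | false | _ = raise-≤ rs (nr ∘ there) E≤
... | true | false = raise-≤ rs (nr ∘ there) E≤
... | true | true = raise-≤ rs (nr ∘ there) (≤∧≢⇒< E≤ λ { refl → contra (nr (here refl)) q₁ q₂ })
  where
  contra : ∀ {a b} → a ∧ b ≡ false → a ≡ true → b ≡ true → ⊥
  contra {true} {true} () _ _

any-false : ∀ {A : Set} (p : A → Bool) {xs} → any p xs ≡ false → ∀ {x} → x ∈ xs → p x ≡ false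
any-false p {x ∷ xs} e (here refl) with p x
... | false = refl
any-false p {x ∷ xs} e (there x∈) with p x
... | false = any-false p e x∈

-- The root vertex has degree n - 1 - order; the edges neither at this vertex nor among its
-- non-neighbours are the ones counted by the cones.
GluesInto : ℕ → ℕ → ℕ → List Tri → Root → Set
GluesInto k n e L r = All (λ (X , wt , q) → checkGlue k wt q (n ∸ suc (order r)) (e ∸ edgeCount r ∸ (n ∸ suc (order r))) L X ≡ true) (graphs r)

-- Classification of graphs with few edges

module Classification {A : Set} (adj : A → A → Bool)
  (adj-sym : ∀ x y → adj x y ≡ adj y x) (adj-irr : ∀ x → adj x x ≡ false)
  (tf : ∀ {x y z} → adj x y ≡ true → adj x z ≡ true → adj y z ≡ true → ⊥) where

  open TriangleFree adj adj-sym adj-irr tf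
  open Gluing adj adj-sym adj-irr tf
  open LinearProgram adj adj-sym adj-irr tf
  open RootGluing adj adj-sym adj-irr tf

  Class : ℕ → ℕ → ℕ → List Tri → Set
  Class k n e L = ∀ {S} → Unique S → NoInd k S → length S ≡ n → edges S ≡ e → ∃ λ zs → zs ↭ S × tri zs ∈ L

  isRoot : List A → Root → A → Bool
  isRoot S r v = (order r ≡ᵇ length S ∸ suc (deg v S)) ∧ (edgeCount r ≡ᵇ edges S ∸ nbrDegrees v S)

  -- Either the non-neighbours of some vertex span a classified graph, and the gluing check applies
  -- there, or the raised bounds hold at every vertex, and averaging gives more than e edges.
  glue-class : ∀ {T k n e L} (rs : List Root) → LB T k → exceeds (raise rs) T (suc k) n e ≡ true →
    All (λ r → order r < 32 × Class k (order r) (edgeCount r) (map proj₁ (graphs r)) × GluesInto (suc k) n e L r) rs →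
    Class (suc k) n e L
  glue-class {T} {k} {n} {e} {L} rs lb ex-ok ok {S} u ni refl refl with any (λ v → any (λ r → isRoot S r v) rs) S in found
  ... | false = ⊥-elim (<-irrefl refl (exceeds-sound (raise rs) T k (edges S) ex-ok lb u ni raised))
    where
    raised : ∀ {v} (sp : Split v S) {E} → T ! length (Split.H sp) ≡ just E → E ≤ edges (Split.H sp) →
             raise rs (length (Split.H sp)) E ≤ edges (Split.H sp)
    raised {v} sp _ E≤ = raise-≤ rs (λ {r} r∈ → trans (cong₂ (λ a b → (order r ≡ᵇ a) ∧ (edgeCount r ≡ᵇ b)) (sym lH) (sym eH))
      (any-false _ (any-false _ found v∈) r∈)) E≤
      where
      open Split sp
      v∈ : v ∈ S
      v∈ = All.head (split-⊆ sp u)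
      lH : length S ∸ suc (deg v S) ≡ length H
      lH = trans (cong₂ (λ a b → a ∸ suc b) (length-split sp u) (deg-split sp u)) (m+n∸m≡n (length N) (length H))
      eH : edges S ∸ nbrDegrees v S ≡ edges H
      eH = trans (cong (_∸ nbrDegrees v S) (edges-nbrDegrees sp u)) (m+n∸m≡n (nbrDegrees v S) (edges H))
  ... | true with v , v∈ , p ← any-true _ S found with r , r∈ , q ← any-true _ rs p
    with a , b ← ∧-true {order r ≡ᵇ length S ∸ suc (deg v S)} q = at-root (splitAt u v∈)
    where
    at-root : Split v S → ∃ λ zs → zs ↭ S × tri zs ∈ L
    at-root sp with small , class , glues ← All.lookup ok r∈
      with ys , ys↭ , tri∈ ← class (split-uH sp u) (noInd-non sp u ni)
        (sym (trans (≡ᵇ-true a) (trans (cong₂ (λ a b → a ∸ suc b) (length-split sp u) (deg-split sp u)) (m+n∸m≡n (length (Split.N sp)) _))))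
        (sym (trans (≡ᵇ-true b) (trans (cong (_∸ nbrDegrees v S) (edges-nbrDegrees sp u)) (m+n∸m≡n (nbrDegrees v S) _))))
      = use (graph∈ tri∈)
      where
      open Split sp
      lH : order r ≡ length H
      lH = trans (≡ᵇ-true a) (trans (cong₂ (λ a b → a ∸ suc b) (length-split sp u) (deg-split sp u)) (m+n∸m≡n (length N) _))
      eH : edgeCount r ≡ edges H
      eH = trans (≡ᵇ-true b) (trans (cong (_∸ nbrDegrees v S) (edges-nbrDegrees sp u)) (m+n∸m≡n (nbrDegrees v S) _))
      lN : length S ∸ suc (order r) ≡ length N
      lN = trans (cong₂ (λ a b → a ∸ suc b) (length-split sp u) lH) (m+n∸n≡m (length N) (length H))
      cr : edges S ∸ edgeCount r ∸ (length S ∸ suc (order r)) ≡ cross N H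
      cr = begin
        edges S ∸ edgeCount r ∸ (length S ∸ suc (order r))                   ≡⟨ cong₂ (λ a b → a ∸ b ∸ (length S ∸ suc (order r))) (edges-split sp u) eH ⟩
        length N + (cross N H + edges H) ∸ edges H ∸ (length S ∸ suc (order r))
          ≡⟨ cong₂ (λ a b → a ∸ edges H ∸ b) (sym (+-assoc (length N) _ _)) lN ⟩
        length N + cross N H + edges H ∸ edges H ∸ length N      ≡⟨ cong (_∸ length N) (m+n∸n≡m (length N + cross N H) (edges H)) ⟩
        length N + cross N H ∸ length N                          ≡⟨ m+n∸m≡n (length N) _ ⟩
        cross N H                                                ∎
        where open ≡-Reasoning
      graph∈ : ∀ {Y gs} → Y ∈ map proj₁ gs → ∃ λ (g : Tri × ℕ × ℕ) → g ∈ gs × Y ≡ proj₁ g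
      graph∈ {gs = g ∷ gs} (here refl) = g , here refl , refl
      graph∈ {gs = g ∷ gs} (there Y∈) with g′ , g′∈ , eq ← graph∈ Y∈ = g′ , there g′∈ , eq
      use : (∃ λ (g : Tri × ℕ × ℕ) → g ∈ graphs r × tri ys ≡ proj₁ g) → ∃ λ zs → zs ↭ S × tri zs ∈ L
      use ((X , wt , q) , g∈ , refl) = gluing-sound u sp k ni ys↭ (subst (_< 32) (trans lH (sym (↭-length ys↭))) small) wt q L
        (subst₂ (λ d R → checkGlue (suc k) wt q d R L X ≡ true) lN cr (All.lookup glues g∈))

bump : ℕ → Table → Table
bump n [] = []
bump zero (E ∷ T) = suc E ∷ T
bump (suc n) (E ∷ T) = E ∷ bump n T

bump-≢ : ∀ {n l} T → n ≢ l → bump n T ! l ≡ T ! l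
bump-≢ [] _ = refl
bump-≢ {zero} {zero} (E ∷ T) n≢ = ⊥-elim (n≢ refl)
bump-≢ {zero} {suc l} (E ∷ T) _ = refl
bump-≢ {suc n} {zero} (E ∷ T) _ = refl
bump-≢ {suc n} {suc l} (E ∷ T) n≢ = bump-≢ T (n≢ ∘ cong suc)

bump-≡ : ∀ {n E} T → T ! n ≡ just E → bump n T ! n ≡ just (suc E)
bump-≡ {zero} (E ∷ T) refl = refl
bump-≡ {suc n} (E ∷ T) p = bump-≡ {n} T p

module Improvement {A : Set} (adj : A → A → Bool)
  (adj-sym : ∀ x y → adj x y ≡ adj y x) (adj-irr : ∀ x → adj x x ≡ false)
  (tf : ∀ {x y z} → adj x y ≡ true → adj x z ≡ true → adj y z ≡ true → ⊥) where

  open TriangleFree adj adj-sym adj-irr tf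
  open LinearProgram adj adj-sym adj-irr tf
  open Classification adj adj-sym adj-irr tf

  not-attained : ∀ {T k} n {e} → LB T k → T ! n ≡ just e → Class k n e [] → LB (bump n T) k
  not-attained {T} n {e} lb T!n empty {S} u ni with E , T!S , E≤ ← lb u ni with n ≟ℕ length S
  ... | no n≢ = E , trans (bump-≢ T n≢) T!S , E≤
  ... | yes refl with refl ← trans (sym T!n) T!S = suc E , bump-≡ T T!n ,
    ≤∧≢⇒< E≤ λ eq → case-empty (empty u ni refl (sym eq))
    where
    case-empty : (∃ λ zs → zs ↭ S × _ ∈ []) → ⊥
    case-empty (_ , _ , ())

-- No graph on 43 vertices

positive-term : {A : Set} (f : A → ℕ) (xs : List A) → 0 < ∑ f xs → ∃ λ x → x ∈ xs × 0 < f x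
positive-term f (x ∷ xs) p with f x in eq
... | suc _ = x , here refl , subst (0 <_) (sym eq) (s≤s z≤n)
... | zero with y , y∈ , q ← positive-term f xs p = y , there y∈ , q

-- 9 d + E(42 - d) ≥ 194 for the possible degrees d < 9.
deficientOK : Table → ℕ → Bool
deficientOK T d with T ! (42 ∸ d)
... | nothing = true
... | just E = 194 ≤ᵇ 9 * d + E

deficientOK-sound : ∀ T d {m E} → deficientOK T d ≡ true → 42 ∸ d ≡ m → T ! m ≡ just E → 194 ≤ 9 * d + E
deficientOK-sound T d ok refl T! with T ! (42 ∸ d)
deficientOK-sound T d ok refl refl | just E = ≤ᵇ-true ok

module Ramsey43 {A : Set} (adj : A → A → Bool)
  (adj-sym : ∀ x y → adj x y ≡ adj y x) (adj-irr : ∀ x → adj x x ≡ false)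
  (tf : ∀ {x y z} → adj x y ≡ true → adj x z ≡ true → adj y z ≡ true → ⊥) where

  open TriangleFree adj adj-sym adj-irr tf
  open LinearProgram adj adj-sym adj-irr tf

  -- A vertex of degree < 9 has neighbours of total deficit at least 194 - e ≥ 1; two adjacent
  -- such vertices have disjoint neighbourhoods, so the total deficit 387 - 2 e is at least 388 - 2 e.
  no-43 : ∀ {T} → LB T 9 → all (deficientOK T) (upTo 9) ≡ true → ∀ {S} → Unique S → NoInd 10 S → length S ≡ 43 → ⊥
  no-43 {T} lb ok {S} u ni len = from-v (positive-term deficit S total>0)
    where
    open +-*-Solver
    e : ℕ
    e = edges S
    deficit : A → ℕ
    deficit x = 9 ∸ deg x S
    nbrDeficit : A → ℕ
    nbrDeficit v = ∑ (λ w → bit (adj v w) * deficit w) S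
    deg≤9 : ∀ {x} → x ∈ S → deg x S ≤ 9
    deg≤9 x∈ = let sp = splitAt u x∈ in ≤-pred (subst (_< 10) (sym (deg-split sp u)) (deg< sp u ni))
    total : ∑ deficit S + 2 * e ≡ 387
    total = begin
      ∑ deficit S + 2 * e                       ≡⟨ cong (∑ deficit S +_) (sym (handshake S)) ⟩
      ∑ deficit S + ∑ (λ x → deg x S) S         ≡⟨ sym (∑-+ deficit (λ x → deg x S) S) ⟩
      ∑ (λ x → deficit x + deg x S) S           ≡⟨ ∑-cong (All.tabulate λ x∈ → m∸n+n≡m (deg≤9 x∈)) ⟩
      ∑ (λ _ → 9) S                             ≡⟨ trans (∑-const 9 S) (cong (_* 9) len) ⟩
      387                                       ∎
      where open ≡-Reasoning
    -- 387 is odd, so the graph cannot be 9-regular.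
    total>0 : 0 < ∑ deficit S
    total>0 with ∑ deficit S | total
    ... | suc _ | _ = s≤s z≤n
    ... | zero | eq with () ← trans (sym ([m+kn]%n≡m%n 0 e 2)) (cong (_% 2) (trans (*-comm e 2) eq))
    e≤193 : e ≤ 193
    e≤193 with e ≤? 193
    ... | yes p = p
    ... | no p with s≤s q ← ≤-trans (*-monoʳ-≤ 2 (≰⇒> p)) (subst (2 * e ≤_) total (m≤n+m (2 * e) (∑ deficit S))) =
      ⊥-elim (<⇒≱ (≤ᵇ⇒≤ 387 387 _) q)
    nbr-sum : ∀ v → nbrDeficit v + nbrDegrees v S ≡ 9 * deg v S
    nbr-sum v = begin
      nbrDeficit v + nbrDegrees v S
        ≡⟨ sym (∑-+ (λ w → bit (adj v w) * deficit w) _ S) ⟩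
      ∑ (λ w → bit (adj v w) * deficit w + bit (adj v w) * deg w S) S
        ≡⟨ ∑-cong (All.tabulate λ {w} w∈ → trans (sym (*-distribˡ-+ (bit (adj v w)) (deficit w) _))
             (trans (cong (bit (adj v w) *_) (m∸n+n≡m (deg≤9 w∈))) (*-comm (bit (adj v w)) 9))) ⟩
      ∑ (λ w → 9 * bit (adj v w)) S
        ≡⟨ ∑-*ˡ 9 (bit ∘ adj v) S ⟩
      9 * deg v S ∎
      where open ≡-Reasoning
    large : ∀ {v} → v ∈ S → 0 < deficit v → 194 ≤ nbrDeficit v + e
    large {v} v∈ def = at-split (splitAt u v∈)
      where
      at-split : Split v S → 194 ≤ nbrDeficit v + e
      at-split sp with E , T!E , E≤ ← lb (split-uH sp u) (noInd-non sp u ni) = begin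
        194                                          ≤⟨ deficientOK-sound T (length N) (all-true (deficientOK T) ok (∈-upTo⁺ d<9)) lH T!E ⟩
        9 * length N + E                             ≤⟨ +-monoʳ-≤ (9 * length N) E≤ ⟩
        9 * length N + edges H                       ≡⟨ cong (λ d → 9 * d + edges H) (sym (deg-split sp u)) ⟩
        9 * deg v S + edges H                        ≡⟨ cong (_+ edges H) (sym (nbr-sum v)) ⟩
        nbrDeficit v + nbrDegrees v S + edges H      ≡⟨ +-assoc (nbrDeficit v) _ _ ⟩
        nbrDeficit v + (nbrDegrees v S + edges H)    ≡⟨ cong (nbrDeficit v +_) (sym (edges-nbrDegrees sp u)) ⟩
        nbrDeficit v + e                             ∎
        where
        open ≤-Reasoning
        open Split sp
        d<9 : length N < 9
        d<9 = subst (_< 9) (deg-split sp u) (m<n∸0⇒m<n′ (deg v S) def)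
          where
          m<n∸0⇒m<n′ : ∀ d → 0 < 9 ∸ d → d < 9
          m<n∸0⇒m<n′ d p with d <? 9
          ... | yes q = q
          ... | no q = ⊥-elim (<⇒≱ p (≤-reflexive (m≤n⇒m∸n≡0 (≮⇒≥ q))))
        lH : 42 ∸ length N ≡ length H
        lH = trans (cong (λ n → n ∸ suc (length N)) (trans (sym len) (length-split sp u))) (m+n∸m≡n (length N) (length H))
    from-v : (∃ λ v → v ∈ S × 0 < deficit v) → ⊥
    from-v (v , v∈ , def) = from-u (positive-term _ S nbr>0)
      where
      nbr>0 : 0 < nbrDeficit v
      nbr>0 = +-cancelʳ-< e 0 (nbrDeficit v) (≤-trans (s≤s e≤193) (large v∈ def))
      from-u : (∃ λ w → w ∈ S × 0 < bit (adj v w) * deficit w) → ⊥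
      from-u (w , w∈ , p) with adj v w in vw
      ... | true = <⇒≱ (≤ᵇ⇒≤ 388 388 _) (begin
        194 + 194                                        ≤⟨ +-mono-≤ (large v∈ def) (large w∈ (subst (0 <_) (+-identityʳ (deficit w)) p)) ⟩
        (nbrDeficit v + e) + (nbrDeficit w + e)          ≡⟨ solve 3 (λ a b e → (a :+ e) :+ (b :+ e) := (a :+ b) :+ con 2 :* e) refl (nbrDeficit v) (nbrDeficit w) e ⟩
        nbrDeficit v + nbrDeficit w + 2 * e              ≤⟨ +-monoˡ-≤ (2 * e) (≤-trans (≤-reflexive (sym (∑-+ (λ x → bit (adj v x) * deficit x) _ S))) (∑-mono (All.universal apart S))) ⟩
        ∑ deficit S + 2 * e                              ≡⟨ total ⟩
        387                                              ∎)
        where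
        open ≤-Reasoning
        -- A vertex adjacent to both `v` and `w` would form a triangle with them.
        apart : ∀ x → bit (adj v x) * deficit x + bit (adj w x) * deficit x ≤ deficit x
        apart x with adj v x in vx | adj w x in wx
        ... | true | true = ⊥-elim (tf vw vx wx)
        ... | true | false = ≤-reflexive (trans (+-identityʳ _) (+-identityʳ _))
        ... | false | true = ≤-reflexive (+-identityʳ _)
        ... | false | false = z≤n

-- Matchings and Gallai's lemma

module Matchings {A : Set} (_≟_ : DecidableEquality A) (adj : A → A → Bool)
  (adj-sym : ∀ x y → adj x y ≡ adj y x) (adj-irr : ∀ x → adj x x ≡ false) where

  -- A matching is given by its partner function; unmatched vertices are fixed.
  record IsMatching (S : List A) (m : A → A) : Set where
    field
      closed : ∀ {x} → x ∈ S → m x ∈ S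
      invol : ∀ {x} → x ∈ S → m (m x) ≡ x
      matched : ∀ {x} → x ∈ S → m x ≢ x → adj x (m x) ≡ true
  open IsMatching

  indicator : ∀ {P : Set} → Dec P → ℕ
  indicator (yes _) = 1
  indicator (no _) = 0

  unmatched : (A → A) → A → ℕ
  unmatched m x = indicator (m x ≟ x)

  defect : (A → A) → List A → ℕ
  defect m = ∑ (unmatched m)

  unmatched-yes : ∀ m {x} → m x ≡ x → unmatched m x ≡ 1
  unmatched-yes m {x} e with m x ≟ x
  ... | yes _ = refl
  ... | no ne = ⊥-elim (ne e)

  unmatched-no : ∀ m {x} → m x ≢ x → unmatched m x ≡ 0
  unmatched-no m {x} ne with m x ≟ x
  ... | yes e = ⊥-elim (ne e)
  ... | no _ = refl

  adj⇒≢ : ∀ {x y} → adj x y ≡ true → x ≢ y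
  adj⇒≢ {x} a refl with () ← trans (sym a) (adj-irr x)

  IsMatching-↭ : ∀ {S S′ m} → S ↭ S′ → IsMatching S m → IsMatching S′ m
  IsMatching-↭ p M .closed x∈ = ∈-resp-↭ p (closed M (∈-resp-↭ (↭-sym p) x∈))
  IsMatching-↭ p M .invol x∈ = invol M (∈-resp-↭ (↭-sym p) x∈)
  IsMatching-↭ p M .matched x∈ = matched M (∈-resp-↭ (↭-sym p) x∈)

  drop-fixed : ∀ {x S m} → Unique (x ∷ S) → IsMatching (x ∷ S) m → m x ≡ x → IsMatching S m
  drop-fixed {x} {S} {m} (x∉ ∷ u) M mx = record
    { closed = λ {y} y∈ → tail y∈ (closed M (there y∈))
    ; invol = invol M ∘ there
    ; matched = matched M ∘ there }
    where
    tail : ∀ {y} → y ∈ S → m y ∈ x ∷ S → m y ∈ S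
    tail {y} y∈ (here my≡x) = ⊥-elim (All.lookup x∉ y∈ (trans (sym mx) (trans (cong m (sym my≡x)) (invol M (there y∈)))))
    tail y∈ (there p) = p

  drop-edge : ∀ {x y S m} → Unique (x ∷ y ∷ S) → IsMatching (x ∷ y ∷ S) m → m x ≡ y → IsMatching S m
  drop-edge {x} {y} {S} {m} ((x≢y ∷ x∉) ∷ y∉ ∷ u) M mx = record
    { closed = λ {z} z∈ → tail z∈ (closed M (there (there z∈)))
    ; invol = invol M ∘ there ∘ there
    ; matched = matched M ∘ there ∘ there }
    where
    tail : ∀ {z} → z ∈ S → m z ∈ x ∷ y ∷ S → m z ∈ S
    tail {z} z∈ (here mz≡x) = ⊥-elim (All.lookup y∉ z∈ (trans (sym mx) (trans (cong m (sym mz≡x)) (invol M (there (there z∈))))))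
    tail {z} z∈ (there (here mz≡y)) = ⊥-elim (All.lookup x∉ z∈
      (trans (sym (invol M (here refl))) (trans (cong m (trans mx (sym mz≡y))) (invol M (there (there z∈))))))
    tail z∈ (there (there p)) = p

  flatten : List (A × A) → List A
  flatten [] = []
  flatten ((x , y) ∷ ps) = x ∷ y ∷ flatten ps

  -- A matching listed as edges and unmatched vertices; this form gives the parity of the defect
  -- and, for a complement, the colour classes.
  record Pairing (S : List A) (δ : ℕ) : Set where
    field
      pairs : List (A × A)
      singles : List A
      perm : flatten pairs ++ singles ↭ S
      edges : All (λ p → adj (proj₁ p) (proj₂ p) ≡ true) pairs
      singles≡ : length singles ≡ δ
  open Pairing

  pairing : ∀ n {S m} → length S ≤ n → Unique S → IsMatching S m → Pairing S (defect m S)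
  pairing n {[]} _ u M = record { pairs = [] ; singles = [] ; perm = ↭-refl ; edges = [] ; singles≡ = refl }
  pairing (suc n) {x ∷ S} {m} (s≤s l) u@(_ ∷ u′) M with m x ≟ x
  ... | yes mx = let P = pairing n l u′ (drop-fixed u M mx) in record
    { pairs = pairs P ; singles = x ∷ singles P
    ; perm = ↭-trans (shift x (flatten (pairs P)) (singles P)) (prep x (perm P))
    ; edges = edges P ; singles≡ = cong suc (singles≡ P) }
  ... | no mx with closed M (here refl)
  ...   | here mx≡x = ⊥-elim (mx mx≡x)
  ...   | there y∈ with S′ , p ← ∈⇒↭∷ y∈ = record
    { pairs = (x , m x) ∷ pairs P ; singles = singles P
    ; perm = prep x (↭-trans (prep (m x) (perm P)) (↭-sym p))
    ; edges = matched M (here refl) mx ∷ edges P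
    ; singles≡ = trans (singles≡ P) (sym (trans (∑-↭ (unmatched m) p) (cong (_+ defect m S′) (unmatched-no m fixed)))) }
    where
    u″ : Unique (x ∷ m x ∷ S′)
    u″ = Unique-↭ (prep x p) u
    fixed : m (m x) ≢ m x
    fixed e = mx (sym (trans (sym (invol M (here refl))) e))
    P : Pairing S′ (defect m S′)
    P = pairing n (≤-trans (≤-trans (n≤1+n _) (≤-reflexive (sym (↭-length p)))) l) (AllPairs.tail (AllPairs.tail u″)) (drop-edge u″ (IsMatching-↭ (prep x p) M) refl)

  length-flatten : ∀ ps → length (flatten ps) ≡ 2 * length ps
  length-flatten [] = refl
  length-flatten (p ∷ ps) rewrite length-flatten ps = solve 1 (λ l → con 2 :+ con 2 :* l := con 2 :* (con 1 :+ l)) refl (length ps)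
    where open +-*-Solver

  matching-parity : ∀ {S m} → Unique S → IsMatching S m → ∃ λ k → length S ≡ 2 * k + defect m S
  matching-parity {S} {m} u M = length (pairs P) ,
    trans (sym (↭-length (perm P))) (trans (Lₚ.length-++ (flatten (pairs P))) (cong₂ _+_ (length-flatten (pairs P)) (singles≡ P)))
    where
    P : Pairing S (defect m S)
    P = pairing (length S) ≤-refl u M

  add : (A → A) → A → A → A → A
  add m x y w with w ≟ x | w ≟ y
  ... | yes _ | _ = y
  ... | no _ | yes _ = x
  ... | no _ | no _ = m w

  add-x : ∀ m x y → add m x y x ≡ y
  add-x m x y with x ≟ x
  ... | yes _ = refl
  ... | no ne = ⊥-elim (ne refl)

  add-y : ∀ m {x y} → x ≢ y → add m x y y ≡ x
  add-y m {x} {y} ne with y ≟ x | y ≟ y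
  ... | yes e | _ = ⊥-elim (ne (sym e))
  ... | no _ | yes _ = refl
  ... | no _ | no ne′ = ⊥-elim (ne′ refl)

  add-other : ∀ m {x y w} → w ≢ x → w ≢ y → add m x y w ≡ m w
  add-other m {x} {y} {w} nx ny with w ≟ x | w ≟ y
  ... | yes e | _ = ⊥-elim (nx e)
  ... | no _ | yes e = ⊥-elim (ny e)
  ... | no _ | no _ = refl

  remove : (A → A) → A → A → A
  remove m y w with w ≟ y | m w ≟ y
  ... | yes _ | _ = w
  ... | no _ | yes _ = w
  ... | no _ | no _ = m w

  remove-y : ∀ m y → remove m y y ≡ y
  remove-y m y with y ≟ y
  ... | yes _ = refl
  ... | no ne = ⊥-elim (ne refl)

  remove-z : ∀ m {y z} → m z ≡ y → remove m y z ≡ z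
  remove-z m {y} {z} e with z ≟ y | m z ≟ y
  ... | yes _ | _ = refl
  ... | no _ | yes _ = refl
  ... | no _ | no ne = ⊥-elim (ne e)

  remove-other : ∀ m {y w} → w ≢ y → m w ≢ y → remove m y w ≡ m w
  remove-other m {y} {w} n₁ n₂ with w ≟ y | m w ≟ y
  ... | yes e | _ = ⊥-elim (n₁ e)
  ... | no _ | yes e = ⊥-elim (n₂ e)
  ... | no _ | no _ = refl

  two : ∀ {S x y} → Unique S → x ∈ S → y ∈ S → x ≢ y → ∃ λ (S′ : List A) → S ↭ x ∷ y ∷ S′
  two u x∈ y∈ ne with S₁ , p ← ∈⇒↭∷ x∈ with ∈-resp-↭ p y∈
  ... | here e = ⊥-elim (ne (sym e))
  ... | there y∈₁ with S₂ , q ← ∈⇒↭∷ y∈₁ = S₂ , ↭-trans p (prep _ q)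

  agree-off : ∀ {m m′ x y S} → Unique (x ∷ y ∷ S) → (∀ {w} → w ∈ S → w ≢ x → w ≢ y → m′ w ≡ m w) → defect m′ S ≡ defect m S
  agree-off {m} {m′} ((x≢y ∷ x∉) ∷ y∉ ∷ u) f = ∑-cong (All.tabulate λ {w} w∈ →
    cong (λ v → indicator (v ≟ w)) (f w∈ (λ e → All.lookup x∉ w∈ (sym e)) (λ e → All.lookup y∉ w∈ (sym e))))

  module _ {S : List A} (u : Unique S) where

    add-matching : ∀ {m x y} → IsMatching S m → x ∈ S → y ∈ S → m x ≡ x → m y ≡ y → adj x y ≡ true →
                   IsMatching S (add m x y) × defect m S ≡ 2 + defect (add m x y) S
    add-matching {m} {x} {y} M x∈ y∈ mx my a = record { closed = cl ; invol = inv ; matched = ed } , def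
      where
      x≢y : x ≢ y
      x≢y = adj⇒≢ a
      m≢ : ∀ {w v} → w ∈ S → m v ≡ v → w ≢ v → m w ≢ v
      m≢ {w} {v} w∈ mv w≢v e = w≢v (trans (sym (invol M w∈)) (trans (cong m e) mv))
      cl : ∀ {w} → w ∈ S → add m x y w ∈ S
      cl {w} w∈ with w ≟ x | w ≟ y
      ... | yes _ | _ = y∈
      ... | no _ | yes _ = x∈
      ... | no _ | no _ = closed M w∈
      inv : ∀ {w} → w ∈ S → add m x y (add m x y w) ≡ w
      inv {w} w∈ with w ≟ x | w ≟ y
      ... | yes refl | _ = add-y m x≢y
      ... | no _ | yes refl = add-x m x y
      ... | no n₁ | no n₂ = trans (add-other m (m≢ w∈ mx n₁) (m≢ w∈ my n₂)) (invol M w∈)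
      ed : ∀ {w} → w ∈ S → add m x y w ≢ w → adj w (add m x y w) ≡ true
      ed {w} w∈ ne with w ≟ x | w ≟ y
      ... | yes refl | _ = a
      ... | no _ | yes refl = trans (adj-sym y x) a
      ... | no _ | no _ = matched M w∈ ne
      def : defect m S ≡ 2 + defect (add m x y) S
      def = begin
        defect m S                                     ≡⟨ ∑-↭ (unmatched m) p ⟩
        unmatched m x + (unmatched m y + defect m S′)  ≡⟨ cong₂ (λ a b → a + (b + defect m S′)) (unmatched-yes m mx) (unmatched-yes m my) ⟩
        2 + defect m S′                                ≡⟨ cong (2 +_) (sym (agree-off (Unique-↭ p u) (λ _ → add-other m))) ⟩
        2 + defect m′ S′                               ≡⟨ cong₂ (λ a b → 2 + (a + (b + defect m′ S′))) (sym (unmatched-no m′ ux)) (sym (unmatched-no m′ uy)) ⟩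
        2 + (unmatched m′ x + (unmatched m′ y + defect m′ S′)) ≡⟨ cong (2 +_) (sym (∑-↭ (unmatched m′) p)) ⟩
        2 + defect m′ S                                ∎
        where
        open ≡-Reasoning
        pick : ∃ λ S′ → S ↭ x ∷ y ∷ S′
        pick = two u x∈ y∈ x≢y
        S′ : List A
        S′ = proj₁ pick
        p : S ↭ x ∷ y ∷ S′
        p = proj₂ pick
        m′ : A → A
        m′ = add m x y
        ux : m′ x ≢ x
        ux e = x≢y (trans (sym e) (add-x m x y))
        uy : m′ y ≢ y
        uy e = x≢y (trans (sym (add-y m x≢y)) e)

    remove-matching : ∀ {m y} → IsMatching S m → y ∈ S → m y ≢ y →
                      IsMatching S (remove m y) × defect (remove m y) S ≡ 2 + defect m S
    remove-matching {m} {y} M y∈ my = record { closed = cl ; invol = inv ; matched = ed } , def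
      where
      z : A
      z = m y
      mz : m z ≡ y
      mz = invol M y∈
      cl : ∀ {w} → w ∈ S → remove m y w ∈ S
      cl {w} w∈ with w ≟ y | m w ≟ y
      ... | yes _ | _ = w∈
      ... | no _ | yes _ = w∈
      ... | no _ | no _ = closed M w∈
      inv : ∀ {w} → w ∈ S → remove m y (remove m y w) ≡ w
      inv {w} w∈ with w ≟ y | m w ≟ y
      ... | yes refl | _ = remove-y m y
      ... | no _ | yes e = remove-z m e
      ... | no n₁ | no n₂ = trans (remove-other m n₂ (λ e → n₁ (trans (sym (invol M w∈)) e))) (invol M w∈)
      ed : ∀ {w} → w ∈ S → remove m y w ≢ w → adj w (remove m y w) ≡ true
      ed {w} w∈ ne with w ≟ y | m w ≟ y
      ... | yes _ | _ = ⊥-elim (ne refl)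
      ... | no _ | yes _ = ⊥-elim (ne refl)
      ... | no _ | no _ = matched M w∈ ne
      def : defect (remove m y) S ≡ 2 + defect m S
      def = begin
        defect m′ S                                      ≡⟨ ∑-↭ (unmatched m′) p ⟩
        unmatched m′ y + (unmatched m′ z + defect m′ S′) ≡⟨ cong₂ (λ a b → a + (b + defect m′ S′)) (unmatched-yes m′ (remove-y m y)) (unmatched-yes m′ (remove-z m mz)) ⟩
        2 + defect m′ S′                                 ≡⟨ cong (2 +_) (agree-off (Unique-↭ p u) other) ⟩
        2 + defect m S′                                  ≡⟨ cong₂ (λ a b → 2 + (a + (b + defect m S′))) (sym (unmatched-no m my)) (sym (unmatched-no m λ e → my (trans (sym e) mz))) ⟩
        2 + (unmatched m y + (unmatched m z + defect m S′)) ≡⟨ cong (2 +_) (sym (∑-↭ (unmatched m) p)) ⟩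
        2 + defect m S                                   ∎
        where
        open ≡-Reasoning
        pick : ∃ λ S′ → S ↭ y ∷ z ∷ S′
        pick = two u y∈ (closed M y∈) (λ e → my (sym e))
        S′ : List A
        S′ = proj₁ pick
        p : S ↭ y ∷ z ∷ S′
        p = proj₂ pick
        m′ : A → A
        m′ = remove m y
        other : ∀ {w} → w ∈ S′ → w ≢ y → w ≢ z → m′ w ≡ m w
        other {w} w∈ n₁ n₂ = remove-other m n₁ λ e →
          n₂ (trans (sym (invol M (∈-resp-↭ (↭-sym p) (there (there w∈))))) (cong m e))

  Minimal : ℕ → List A → Set
  Minimal δ S = ∀ m → IsMatching S m → δ ≤ defect m S

  -- When δ is the least defect, the matching is maximum. The case x = y speaks of a single missed
  -- vertex.
  Missed : ℕ → List A → A → A → Set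
  Missed δ S x y = ∃ λ m → IsMatching S m × defect m S ≡ δ × m x ≡ x × m y ≡ y

  module Gallai {S : List A} (u : Unique S) {δ : ℕ} (min : Minimal δ S) where

    -- Otherwise the edge could be added to the matching, lowering the least defect by 2.
    missed-nonadjacent : ∀ {x y} → x ∈ S → y ∈ S → adj x y ≡ true → ¬ Missed δ S x y
    missed-nonadjacent x∈ y∈ a (m , M , def , mx , my) with M′ , def′ ← add-matching u M x∈ y∈ mx my a =
      <⇒≱ (≤-trans (n≤1+n _) (≤-reflexive (trans (sym def′) def))) (min _ M′)

    module _ {M} (isM : IsMatching S M) (defM : defect M S ≡ δ)
             {v w t} (v∈ : v ∈ S) (w∈ : w ∈ S) (t∈ : t ∈ S) (v≢w : v ≢ w) (Mv : M v ≡ v) (Mw : M w ≡ w)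
             (no-tv : ¬ Missed δ S t v) (no-tw : ¬ Missed δ S t w) where

      common : (A → A) → A → ℕ
      common N s with M s ≟ N s | M s ≟ s
      ... | yes _ | no _ = 1
      ... | _ | _ = 0

      common≤1 : ∀ N s → common N s ≤ 1
      common≤1 N s with M s ≟ N s | M s ≟ s
      ... | yes _ | no _ = s≤s z≤n
      ... | yes _ | yes _ = z≤n
      ... | no _ | yes _ = z≤n
      ... | no _ | no _ = z≤n

      common-mono : ∀ {N N′ s} → (M s ≡ N s → M s ≢ s → N′ s ≡ N s) → common N s ≤ common N′ s
      common-mono {N} {N′} {s} f with M s ≟ N s | M s ≟ s
      ... | no _ | _ = z≤n
      ... | yes _ | yes _ = z≤n
      ... | yes e | no ne with M s ≟ N′ s | M s ≟ s
      ...   | yes _ | no _ = s≤s z≤n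
      ...   | no e′ | _ = ⊥-elim (e′ (trans e (sym (f e ne))))
      ...   | yes _ | yes ne′ = ⊥-elim (ne ne′)

      common-yes : ∀ {N s} → M s ≡ N s → M s ≢ s → common N s ≡ 1
      common-yes {N} {s} e ne with M s ≟ N s | M s ≟ s
      ... | yes _ | no _ = refl
      ... | no e′ | _ = ⊥-elim (e′ e)
      ... | yes _ | yes e′ = ⊥-elim (ne e′)

      common-no : ∀ {N s} → M s ≢ N s → common N s ≡ 0
      common-no {N} {s} ne with M s ≟ N s | M s ≟ s
      ... | yes e | _ = ⊥-elim (ne e)
      ... | no _ | _ = refl

      -- An edge {x , M x} with x ≠ t missed by N can be exchanged into N, so N would share
      -- ever more edges with M; and such an x exists because M misses v and w while N does not.
      exchange : ∀ fuel N → IsMatching S N → defect N S ≡ δ → N t ≡ t → length S ≤ fuel + ∑ (common N) S → ⊥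
      exchange fuel N isN defN Nt short = contradiction
        where
        Nv : N v ≢ v
        Nv e = no-tv (N , isN , defN , Nt , e)
        Nw : N w ≢ w
        Nw e = no-tw (N , isN , defN , Nt , e)
        improve : ∀ {x} → x ∈ S → x ≢ t → M x ≢ x → N x ≡ x → ⊥
        improve {x} x∈ x≢t Mx Nx = step fuel short
          where
          y : A
          y = M x
          y∈ : y ∈ S
          y∈ = closed isM x∈
          My : M y ≡ x
          My = invol isM x∈
          xy : adj x y ≡ true
          xy = matched isM x∈ Mx
          Ny : N y ≢ y
          Ny e = missed-nonadjacent x∈ y∈ xy (N , isN , defN , Nx , e)
          z : A
          z = N y
          z≢x : z ≢ x
          z≢x e = Mx (trans (sym (invol isN y∈)) (trans (cong N e) Nx))
          R : A → A
          R = remove N y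
          isR : IsMatching S R × defect R S ≡ 2 + defect N S
          isR = remove-matching u isN y∈ Ny
          Rx : R x ≡ x
          Rx = trans (remove-other N (λ e → Mx (sym e)) (λ e → Mx (trans (sym e) Nx))) Nx
          N′ : A → A
          N′ = add R x y
          isN′ : IsMatching S N′ × defect R S ≡ 2 + defect N′ S
          isN′ = add-matching u (proj₁ isR) x∈ y∈ Rx (remove-y N y) xy
          defN′ : defect N′ S ≡ δ
          defN′ = trans (+-cancelˡ-≡ 2 _ _ (trans (sym (proj₂ isN′)) (proj₂ isR))) defN
          N′t : N′ t ≡ t
          N′t = trans (add-other R (λ e → x≢t (sym e)) t≢y) (trans (remove-other N t≢y (λ e → t≢y (trans (sym Nt) e))) Nt)
            where
            t≢y : t ≢ y
            t≢y e = Ny (subst (λ s → N s ≡ s) e Nt)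
          keep : ∀ {s} → s ∈ S → M s ≡ N s → M s ≢ s → N′ s ≡ N s
          keep {s} s∈ e ne = trans (add-other R s≢x s≢y) (remove-other N s≢y λ Ns≡y → s≢x (M-inj s∈ (trans e Ns≡y)))
            where
            M-inj : ∀ {s} → s ∈ S → M s ≡ y → s ≡ x
            M-inj s∈ e = trans (sym (invol isM s∈)) (trans (cong M e) My)
            s≢x : s ≢ x
            s≢x refl = ne (trans e Nx)
            s≢y : s ≢ y
            s≢y refl = z≢x (trans (sym e) My)
          more : suc (∑ (common N) S) ≤ ∑ (common N′) S
          more = begin
            suc (∑ (common N) S)          ≡⟨ cong suc (trans (∑-↭ (common N) p) (cong (_+ ∑ (common N) S′) (common-no {N} λ e → Mx (trans e Nx)))) ⟩
            1 + ∑ (common N) S′           ≤⟨ +-mono-≤ (≤-reflexive (sym (common-yes {N′} (sym (add-x R x y)) Mx)))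
                                               (∑-mono (All.tabulate λ s∈ → common-mono {N} {N′} (keep (∈-resp-↭ (↭-sym p) (there s∈))))) ⟩
            common N′ x + ∑ (common N′) S′ ≡⟨ sym (∑-↭ (common N′) p) ⟩
            ∑ (common N′) S               ∎
            where
            open ≤-Reasoning
            pick : ∃ λ S′ → S ↭ x ∷ S′
            pick = ∈⇒↭∷ x∈
            S′ : List A
            S′ = proj₁ pick
            p : S ↭ x ∷ S′
            p = proj₂ pick
          step : ∀ fuel → length S ≤ fuel + ∑ (common N) S → ⊥
          step zero short = <⇒≱ (≤-trans (s≤s short) more)
            (≤-trans (∑-mono (All.universal (common≤1 N′) S)) (≤-reflexive (trans (∑-const 1 S) (*-identityʳ _))))
          step (suc fuel) short = exchange fuel N′ (proj₁ isN′) defN′ N′t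
            (≤-trans short (≤-trans (≤-reflexive (sym (+-suc fuel _))) (+-monoʳ-≤ fuel more)))
        -- As no exchange is possible, every vertex other than `t` that N misses is missed by M as
        -- well.
        pointwise : ∀ {s} → s ∈ S → unmatched N s ≤ unmatched M s + indicator (s ≟ t)
        pointwise {s} s∈ with N s ≟ s | M s ≟ s | s ≟ t
        ... | no _ | _ | _ = z≤n
        ... | yes _ | yes _ | _ = s≤s z≤n
        ... | yes _ | no _ | yes _ = s≤s z≤n
        ... | yes Ns | no Ms | no s≢t = ⊥-elim (improve s∈ s≢t Ms Ns)
        once : ∀ {S} → Unique S → ∑ (λ s → indicator (s ≟ t)) S ≤ 1
        once [] = z≤n
        once {s ∷ S} (s∉ ∷ u) with s ≟ t
        ... | no _ = once u
        ... | yes refl = s≤s (≤-reflexive (∑-zero (All.map (λ {x} ne → no-ind (λ e → ne (sym e))) s∉)))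
          where
          no-ind : ∀ {x} → x ≢ t → indicator (x ≟ t) ≡ 0
          no-ind {x} ne with x ≟ t
          ... | yes e = ⊥-elim (ne e)
          ... | no _ = refl
        -- M misses `v` and `w`, which N covers, while N gains at most `t`; so the defect of N would
        -- be smaller than that of M.
        contradiction : ⊥
        contradiction = <⇒≱ (≤-refl {suc (1 + defect M S′)}) (begin
          2 + defect M S′                                     ≡⟨ cong₂ (λ a b → a + (b + defect M S′)) (sym (unmatched-yes M Mv)) (sym (unmatched-yes M Mw)) ⟩
          unmatched M v + (unmatched M w + defect M S′)       ≡⟨ sym (∑-↭ (unmatched M) p) ⟩
          defect M S                                          ≡⟨ trans defM (sym defN) ⟩
          defect N S                                          ≡⟨ ∑-↭ (unmatched N) p ⟩
          unmatched N v + (unmatched N w + defect N S′)       ≡⟨ cong₂ (λ a b → a + (b + defect N S′)) (unmatched-no N Nv) (unmatched-no N Nw) ⟩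
          defect N S′                                         ≤⟨ ∑-mono (All.tabulate λ s∈ → pointwise (∈-resp-↭ (↭-sym p) (there (there s∈)))) ⟩
          ∑ (λ s → unmatched M s + indicator (s ≟ t)) S′      ≡⟨ ∑-+ (unmatched M) (λ s → indicator (s ≟ t)) S′ ⟩
          defect M S′ + ∑ (λ s → indicator (s ≟ t)) S′        ≤⟨ +-monoʳ-≤ (defect M S′) (once (AllPairs.tail (AllPairs.tail (Unique-↭ p u)))) ⟩
          defect M S′ + 1                                     ≡⟨ +-comm _ 1 ⟩
          1 + defect M S′                                     ∎)
          where
          open ≤-Reasoning
          pick : ∃ λ S′ → S ↭ v ∷ w ∷ S′
          pick = two u v∈ w∈ v≢w
          S′ : List A
          S′ = proj₁ pick
          p : S ↭ v ∷ w ∷ S′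
          p = proj₂ pick

    -- Gallai: "no maximum matching misses both" is transitive through t.
    gallai : ∀ {v w t} → v ∈ S → w ∈ S → t ∈ S → v ≢ w → Missed δ S v w → Missed δ S t t →
             ¬ Missed δ S t v → ¬ Missed δ S t w → ⊥
    gallai v∈ w∈ t∈ v≢w (M , isM , defM , Mv , Mw) (N , isN , defN , Nt , _) no-tv no-tw =
      exchange isM defM v∈ w∈ t∈ v≢w Mv Mw no-tv no-tw (length S) N isN defN Nt (m≤m+n _ _)

-- A lower bound for ν when n - ν exceeds the independence number by d.
bound : ℕ → ℕ
bound 0 = 0
bound 1 = 2
bound 2 = 4
bound 3 = 6
bound 4 = 8
bound 5 = 10
bound 6 = 10
bound 7 = 12
bound 8 = 12
bound 9 = 14
bound 10 = 16
bound 11 = 18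
bound 12 = 20
bound (suc (suc (suc (suc (suc (suc (suc (suc (suc (suc (suc (suc (suc d))))))))))))) = 22 + d

-- Arithmetic of the bound

bound-linear : ∀ {d} → 13 ≤ d → bound d ≡ 9 + d
bound-linear {d} 13≤ = subst (λ x → bound x ≡ 9 + x) (m+[n∸m]≡n 13≤) (linear (d ∸ 13))
  where
  linear : ∀ e → bound (13 + e) ≡ 9 + (13 + e)
  linear e = refl

bound-suc-large : ∀ {d} → 13 ≤ d → bound (suc d) ≡ 1 + bound d
bound-suc-large {d} 13≤ = trans (bound-linear (m≤n⇒m≤1+n 13≤)) (cong suc (sym (bound-linear 13≤)))

-- A step of 2 is what deleting an independent triple affords: three vertices leave, and one of them
-- pays for a colour.
bound-suc : ∀ d → bound (suc d) ≤ 2 + bound d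
bound-suc d with d ≤? 12
... | yes d≤ = small d≤
  where
  small : d ≤ 12 → bound (suc d) ≤ 2 + bound d
  small d≤ = ≤ᵇ-true (all-true (λ d → bound (suc d) ≤ᵇ 2 + bound d) {xs = upTo 13} refl (∈-upTo⁺ (s≤s d≤)))
... | no d≰ = m≤n⇒m≤1+n (≤-reflexive (bound-suc-large (≰⇒> d≰)))

-- Upper bounds for the Ramsey numbers R(3, a + 1).
threshold : ℕ → ℕ
threshold 0 = 1
threshold 1 = 3
threshold 2 = 6
threshold 3 = 9
threshold 4 = 14
threshold 5 = 19
threshold 6 = 24
threshold 7 = 30
threshold 8 = 37
threshold _ = 43

superadditiveOK : ℕ → ℕ → Bool
superadditiveOK e c = bound e ≤ᵇ bound c + bound (e ∸ c)

-- Needed when a difference is shared between two separated parts. For the total 13 every splitting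
-- is tight: `bound c` and `bound (13 ∸ c)` always add up to 22.
bound-superadditive : ∀ {c d} → c + d ≤ 13 → bound (c + d) ≤ bound c + bound d
bound-superadditive {c} {d} c+d≤ =
  subst (λ x → bound (c + d) ≤ bound c + bound x) (m+n∸m≡n c d) (≤ᵇ-true (all-true (superadditiveOK (c + d))
    (all-true (λ e → all (superadditiveOK e) (upTo (suc e))) {xs = upTo 14} refl (∈-upTo⁺ (s≤s c+d≤))) (∈-upTo⁺ (s≤s (m≤m+n c d)))))

-- For k below `bound d`, a graph on 2 k + 1 vertices with independence number at most k + 1 - d has
-- to violate the Ramsey bound. Besides d = 13 and k = 21 this is tight for d = 5 and k = 9, where
-- R(3, 6) ≤ 19 is what is required.
thresholdOK : ℕ → ℕ → Bool
thresholdOK d k = not (d ≤ᵇ suc k) ∨ ((suc k ∸ d ≤ᵇ 9) ∧ (threshold (suc k ∸ d) ≤ᵇ 2 * k + 1))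

threshold≤ : ∀ {d k} → d ≤ 13 → k < bound d → d ≤ suc k → suc k ∸ d ≤ 9 × threshold (suc k ∸ d) ≤ 2 * k + 1
threshold≤ {d} {k} d≤ k< d≤k = unpack (≤⇒≤ᵇ d≤k)
  (all-true (thresholdOK d) (all-true (λ d → all (thresholdOK d) (upTo (bound d))) {xs = upTo 14} refl (∈-upTo⁺ (s≤s d≤))) (∈-upTo⁺ k<))
  where
  unpack : T (d ≤ᵇ suc k) → thresholdOK d k ≡ true → suc k ∸ d ≤ 9 × threshold (suc k ∸ d) ≤ 2 * k + 1
  unpack t ok with d ≤ᵇ suc k
  ... | true with p , q ← ∧-true {suc k ∸ d ≤ᵇ 9} ok = ≤ᵇ-true p , ≤ᵇ-true q

-- `P` need not be decidable, so a least element exists only up to double negation, which suffices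
-- for deriving absurdity.
¬¬-least : (P : ℕ → Set) → ∀ {n} → P n → ¬ ¬ (∃ λ k → P k × (∀ j → P j → k ≤ j))
¬¬-least P {n} pn none = below (suc n) n ≤-refl pn
  where
  below : ∀ m k → k < m → ¬ P k
  below (suc m) k k< pk = none (k , pk , λ j pj → ≮⇒≥ λ j<k → below m j (≤-trans j<k (≤-pred k<)) pj)

¬¬-partition : {A : Set} (R : A → Set) (S : List A) → ¬ ¬ (∃₂ λ P Q → P ++ Q ↭ S × All R P × All (λ x → ¬ R x) Q)
¬¬-partition R [] none = none ([] , [] , ↭-refl , [] , [])
¬¬-partition R (x ∷ S) none = ¬¬-partition R S λ (P , Q , p , rP , rQ) →
  (λ (¬r : ¬ R x) → none (P , x ∷ Q , ↭-trans (shift x P Q) (prep x p) , rP , ¬r ∷ rQ))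
  λ r → none (x ∷ P , Q , prep x p , r ∷ rP , rQ)

-- Meant for the values x₁, x₂ of n - ν on two parts with independence numbers a₁, a₂. If x₁ falls
-- short of a₁, the second part takes all of `d`; otherwise the first takes as much of `d` as fits
-- and the second the rest.
distribute : ∀ a₁ a₂ d {x₁ x₂} → a₁ + a₂ + d ≤ x₁ + x₂ →
             a₁ + d ≤ x₁ ⊎ a₂ + d ≤ x₂ ⊎ (∃₂ λ d₁ d₂ → d₁ + d₂ ≡ d × a₁ + d₁ ≤ x₁ × a₂ + d₂ ≤ x₂)
distribute a₁ a₂ d {x₁} {x₂} p with a₁ ≤? x₁
... | no a₁≰ = inj₂ (inj₁ (+-cancelˡ-≤ x₁ _ _ (≤-trans (+-monoˡ-≤ (a₂ + d) (<⇒≤ (≰⇒> a₁≰))) (≤-trans (≤-reflexive (sym (+-assoc a₁ a₂ d))) p))))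
... | yes a₁≤ with a₁ + d ≤? x₁
...   | yes q = inj₁ q
...   | no q = inj₂ (inj₂ (x₁ ∸ a₁ , d ∸ (x₁ ∸ a₁) , m+[n∸m]≡n d₁≤d , ≤-reflexive e₁ , +-cancelˡ-≤ x₁ _ _ e₂))
  where
  e₁ : a₁ + (x₁ ∸ a₁) ≡ x₁
  e₁ = m+[n∸m]≡n a₁≤
  d₁≤d : x₁ ∸ a₁ ≤ d
  d₁≤d = +-cancelˡ-≤ a₁ _ _ (≤-trans (≤-reflexive e₁) (<⇒≤ (≰⇒> q)))
  regroup : ∀ a b c e → a + b + (c + e) ≡ a + c + (b + e)
  regroup = solve 4 (λ a b c e → a :+ b :+ (c :+ e) := a :+ c :+ (b :+ e)) refl
    where open +-*-Solver
  e₂ : x₁ + (a₂ + (d ∸ (x₁ ∸ a₁))) ≤ x₁ + x₂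
  e₂ = begin
    x₁ + (a₂ + (d ∸ (x₁ ∸ a₁)))               ≡⟨ cong (_+ (a₂ + (d ∸ (x₁ ∸ a₁)))) (sym e₁) ⟩
    a₁ + (x₁ ∸ a₁) + (a₂ + (d ∸ (x₁ ∸ a₁)))   ≡⟨ regroup a₁ (x₁ ∸ a₁) a₂ _ ⟩
    a₁ + a₂ + ((x₁ ∸ a₁) + (d ∸ (x₁ ∸ a₁)))   ≡⟨ cong (a₁ + a₂ +_) (m+[n∸m]≡n d₁≤d) ⟩
    a₁ + a₂ + d                               ≤⟨ p ⟩
    x₁ + x₂                                   ∎
    where open ≤-Reasoning

-- A lower bound for the matching number

module MatchingNumber {A : Set} (_≟_ : DecidableEquality A) (adj : A → A → Bool)
  (adj-sym : ∀ x y → adj x y ≡ adj y x) (adj-irr : ∀ x → adj x x ≡ false)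
  (tf : ∀ {x y z} → adj x y ≡ true → adj x z ≡ true → adj y z ≡ true → ⊥) where

  open TriangleFree adj adj-sym adj-irr tf hiding (deg; edges)
  open Matchings _≟_ adj adj-sym adj-irr
  open IsMatching
  open DecMembership _≟_ using (_∈?_)

  Ramsey : Set
  Ramsey = ∀ {a S} → a ≤ 9 → Unique S → NoInd (suc a) S → length S < threshold a

  IsMaximum : List A → ℕ → Set
  IsMaximum S δ = (∃ λ m → IsMatching S m × defect m S ≡ δ) × Minimal δ S

  ¬¬-maximum : ∀ S → ¬ ¬ (∃ λ δ → IsMaximum S δ)
  ¬¬-maximum S none = ¬¬-least (λ δ → ∃ λ m → IsMatching S m × defect m S ≡ δ) (id , empty , refl)
    λ (δ , ex , min) → none (δ , ex , λ m M → min _ (m , M , refl))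
    where
    empty : IsMatching S id
    empty = record { closed = id ; invol = λ _ → refl ; matched = λ _ ne → ⊥-elim (ne refl) }

  join : List A → (A → A) → (A → A) → A → A
  join P m₁ m₂ x with x ∈? P
  ... | yes _ = m₁ x
  ... | no _ = m₂ x

  join-∈ : ∀ P {m₁ m₂ x} → x ∈ P → join P m₁ m₂ x ≡ m₁ x
  join-∈ P {x = x} x∈ with x ∈? P
  ... | yes _ = refl
  ... | no x∉ = ⊥-elim (x∉ x∈)

  join-∉ : ∀ P {m₁ m₂ x} → x ∉ P → join P m₁ m₂ x ≡ m₂ x
  join-∉ P {x = x} x∉ with x ∈? P
  ... | yes x∈ = ⊥-elim (x∉ x∈)
  ... | no _ = refl

  ++-disjoint : ∀ P {Q : List A} {x} → Unique (P ++ Q) → x ∈ Q → x ∉ P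
  ++-disjoint (y ∷ P) (y∉ ∷ u) x∈Q (here refl) = All.lookup y∉ (∈-++⁺ʳ P x∈Q) refl
  ++-disjoint (y ∷ P) (y∉ ∷ u) x∈Q (there x∈P) = ++-disjoint P u x∈Q x∈P

  join-matching : ∀ {P Q m₁ m₂} → Unique (P ++ Q) → IsMatching P m₁ → IsMatching Q m₂ →
                  IsMatching (P ++ Q) (join P m₁ m₂) × defect (join P m₁ m₂) (P ++ Q) ≡ defect m₁ P + defect m₂ Q
  join-matching {P} {Q} {m₁} {m₂} u M₁ M₂ = record
    { closed = λ x∈ → cl (∈-++⁻ P x∈) ; invol = λ x∈ → inv (∈-++⁻ P x∈) ; matched = λ x∈ → ed (∈-++⁻ P x∈) } ,
    trans (∑-++ (unmatched j) P Q) (cong₂ _+_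
      (∑-cong (All.tabulate λ {x} x∈ → cong (λ y → indicator (y ≟ x)) (join-∈ P x∈)))
      (∑-cong (All.tabulate λ {x} x∈ → cong (λ y → indicator (y ≟ x)) (join-∉ P (++-disjoint P u x∈)))))
    where
    j : A → A
    j = join P m₁ m₂
    cl : ∀ {x} → x ∈ P ⊎ x ∈ Q → j x ∈ P ++ Q
    cl (inj₁ x∈) = subst (_∈ P ++ Q) (sym (join-∈ P x∈)) (∈-++⁺ˡ (closed M₁ x∈))
    cl (inj₂ x∈) = subst (_∈ P ++ Q) (sym (join-∉ P (++-disjoint P u x∈))) (∈-++⁺ʳ P (closed M₂ x∈))
    inv : ∀ {x} → x ∈ P ⊎ x ∈ Q → j (j x) ≡ x
    inv (inj₁ x∈) = trans (cong j (join-∈ P x∈)) (trans (join-∈ P (closed M₁ x∈)) (invol M₁ x∈))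
    inv (inj₂ x∈) = trans (cong j (join-∉ P (++-disjoint P u x∈))) (trans (join-∉ P (++-disjoint P u (closed M₂ x∈))) (invol M₂ x∈))
    ed : ∀ {x} → x ∈ P ⊎ x ∈ Q → j x ≢ x → adj x (j x) ≡ true
    ed {x} (inj₁ x∈) = subst (λ y → y ≢ x → adj x y ≡ true) (sym (join-∈ P x∈)) (matched M₁ x∈)
    ed {x} (inj₂ x∈) = subst (λ y → y ≢ x → adj x y ≡ true) (sym (join-∉ P (++-disjoint P u x∈))) (matched M₂ x∈)

  -- Its first component is the independence number.
  ¬¬-independence : ∀ S → ¬ ¬ (∃ λ a → NoInd (suc a) S × ∃ λ (I : List A) → AllPairs Anti I × All (_∈ S) I × a ≤ length I)
  ¬¬-independence S none = ¬¬-least (λ a → NoInd (suc a) S) {length S} (λ I ap I⊆ → s≤s (independent≤ ap I⊆))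
    λ (a , ni , min) → attained a min λ (I , ap , I⊆ , a≤) → none (a , ni , I , ap , I⊆ , a≤)
    where
    independent≤ : ∀ {I} → AllPairs Anti I → All (_∈ S) I → length I ≤ length S
    independent≤ {I} ap I⊆ = unique-length (AllPairs.map proj₁ ap) I⊆
    attained : ∀ a → (∀ j → NoInd (suc j) S → a ≤ j) → ¬ ¬ (∃ λ (I : List A) → AllPairs Anti I × All (_∈ S) I × a ≤ length I)
    attained zero min none = none ([] , [] , [] , z≤n)
    attained (suc a) min none = <-irrefl refl (min a λ I ap I⊆ → ≰⇒> λ q → none (I , ap , I⊆ , q))

  two-unmatched : ∀ m {S} → Unique S → 2 ≤ defect m S → ∃₂ λ x y → x ∈ S × y ∈ S × x ≢ y × m x ≡ x × m y ≡ y
  two-unmatched m {x ∷ S} (x∉ ∷ u) p with m x ≟ x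
  ... | no _ = let y , z , y∈ , z∈ , rest = two-unmatched m u p in y , z , there y∈ , there z∈ , rest
  ... | yes mx = let y , y∈ , my = one S (≤-pred p) in x , y , here refl , there y∈ , All.lookup x∉ y∈ , mx , my
    where
    one : ∀ S → 1 ≤ defect m S → ∃ λ y → y ∈ S × m y ≡ y
    one (y ∷ S) p with m y ≟ y
    ... | yes my = y , here refl , my
    ... | no _ = let z , z∈ , mz = one S p in z , there z∈ , mz

  module Bound (ramsey : Ramsey) where

    -- There is no counterexample on fewer than n vertices. As δ is the least defect, k is the
    -- matching number and k + δ is |S| - ν. The parameters are quantified inside, since deleting a
    -- vertex or passing to a part changes them.
    NoLarge : ℕ → Set
    NoLarge n = ∀ {S δ} → length S < n → Unique S → IsMaximum S δ → ∀ {k a d} → length S ≡ 2 * k + δ → NoInd (suc a) S →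
                a + d ≤ k + δ → d ≤ 13 → ¬ (k < bound d)

    module Step {n} (IH : NoLarge n) {S δ} (S≤ : length S ≤ n) (u : Unique S) (max : IsMaximum S δ)
                {k a d} (len : length S ≡ 2 * k + δ) (ni : NoInd (suc a) S) (a+d≤ : a + d ≤ k + δ) (d≤ : d ≤ 13) (k< : k < bound d) where

      m : A → A
      m = proj₁ (proj₁ max)
      M : IsMatching S m
      M = proj₁ (proj₂ (proj₁ max))
      defm : defect m S ≡ δ
      defm = proj₂ (proj₂ (proj₁ max))
      min : Minimal δ S
      min = proj₂ max

      -- A vertex covered by every maximum matching can be deleted: ν drops by one and the defect
      -- rises by one, so k + δ is unchanged while k decreases. The rest would be a smaller
      -- counterexample.
      inessential : ∀ {v} → v ∈ S → ¬ ¬ Missed δ S v v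
      inessential {v} v∈ ess = IH
        (subst (_≤ n) lenS S≤) u′ ((remove m v , M′ , def′) , min′)
        len′ (λ I ap I⊆ → ni I ap (All.map (∈-resp-↭ (↭-sym p) ∘ there) I⊆))
        (≤-trans a+d≤ (≤-reflexive (trans (cong (_+ δ) k≡) (sym (+-suc k′ δ))))) d≤ (≤-trans (≤-reflexive (sym k≡)) (≤-trans (n≤1+n k) k<))
        where
        pick : ∃ λ (S′ : List A) → S ↭ v ∷ S′
        pick = ∈⇒↭∷ v∈
        S′ : List A
        S′ = proj₁ pick
        p : S ↭ v ∷ S′
        p = proj₂ pick
        uv : Unique (v ∷ S′)
        uv = Unique-↭ p u
        u′ : Unique S′
        u′ = AllPairs.tail uv
        lenS : length S ≡ suc (length S′)
        lenS = ↭-length p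
        mv : m v ≢ v
        mv e = ess (m , M , defm , e , e)
        R : IsMatching S (remove m v) × defect (remove m v) S ≡ 2 + defect m S
        R = remove-matching u M v∈ mv
        M′ : IsMatching S′ (remove m v)
        M′ = drop-fixed uv (IsMatching-↭ p (proj₁ R)) (remove-y m v)
        def′ : defect (remove m v) S′ ≡ suc δ
        def′ = suc-injective (trans (cong (_+ defect (remove m v) S′) (sym (unmatched-yes (remove m v) (remove-y m v))))
          (trans (sym (∑-↭ (unmatched (remove m v)) p)) (trans (proj₂ R) (cong (2 +_) defm))))
        parity′ : ∃ λ k′ → length S′ ≡ 2 * k′ + suc δ
        parity′ = let k′ , e = matching-parity u′ M′ in k′ , trans e (cong (2 * k′ +_) def′)
        k′ : ℕ
        k′ = proj₁ parity′
        len′ : length S′ ≡ 2 * k′ + suc δ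
        len′ = proj₂ parity′
        k≡ : k ≡ suc k′
        k≡ = *-cancelˡ-≡ k (suc k′) 2 (+-cancelʳ-≡ δ _ _ (trans (sym len) (trans lenS (trans (cong suc len′) (eq k′ δ)))))
          where
          eq : ∀ k δ → suc (2 * k + suc δ) ≡ 2 * suc k + δ
          eq = solve 2 (λ k δ → con 1 :+ (con 2 :* k :+ (con 1 :+ δ)) := con 2 :* (con 1 :+ k) :+ δ) refl
            where open +-*-Solver
        min′ : Minimal (suc δ) S′
        min′ m₂ M₂ with k₂ , e₂ ← matching-parity u′ M₂ = ≮⇒≥ λ lt → squeeze (≤-pred lt)
          where
          fixed : IsMatching (v ∷ []) id
          fixed = record { closed = id ; invol = λ _ → refl ; matched = λ _ ne → ⊥-elim (ne refl) }
          jm : IsMatching (v ∷ S′) (join (v ∷ []) id m₂) × defect (join (v ∷ []) id m₂) (v ∷ S′) ≡ defect id (v ∷ []) + defect m₂ S′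
          jm = join-matching uv fixed M₂
          j : A → A
          j = join (v ∷ []) id m₂
          defj : defect j S ≡ suc (defect m₂ S′)
          defj = trans (∑-↭ (unmatched j) p) (trans (proj₂ jm) (cong (λ x → x + 0 + defect m₂ S′) (unmatched-yes id refl)))
          Mj : IsMatching S j
          Mj = IsMatching-↭ (↭-sym p) (proj₁ jm)
          jv : j v ≡ v
          jv = join-∈ (v ∷ []) {id} {m₂} (here refl)
          -- With `v` left unmatched, such a matching has defect δ or δ + 1 on S. The former
          -- contradicts that `v` is always covered, the latter the parity of the defect.
          squeeze : defect m₂ S′ ≤ δ → ⊥
          squeeze le with m≤n⇒m<n∨m≡n (min j Mj)
          ... | inj₂ e = ess (j , Mj , sym e , jv , jv)
          ... | inj₁ lt = even≢odd k₂ k′ (sym (+-cancelʳ-≡ δ _ _ (trans (sym (trans len′ (+-suc (2 * k′) δ)))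
            (trans e₂ (cong (2 * k₂ +_) (≤-antisym le (≤-pred (subst (δ <_) defj lt))))))))

      -- By `inessential`, any vertex is missed by some maximum matching, whose defect is then
      -- positive. In the empty graph k = d = 0, and `bound 0` is 0.
      at-zero : δ ≡ 0 → ⊥
      at-zero δ≡0 = vanish S refl
        where
        no-slack : ∀ d → a + d ≤ 0 → k < bound d → ⊥
        no-slack zero p ()
        no-slack (suc d) p _ = 1+n≰n (≤-trans (≤-trans (s≤s z≤n) (m≤n+m (suc d) a)) p)
        vanish : ∀ S′ → S′ ≡ S → ⊥
        vanish [] e = no-slack d (≤-trans a+d≤ (≤-reflexive (cong₂ _+_ k≡0 δ≡0))) k<
          where
          k≡0 : k ≡ 0
          k≡0 = m+n≡0⇒m≡0 k (m+n≡0⇒m≡0 (2 * k) (trans (sym len) (cong length (sym e))))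
        vanish (x ∷ S′) e = inessential (subst (x ∈_) e (here refl)) λ (m , M , def , mx , _) →
          1+n≢0 (trans (cong (_+ defect m S′) (sym (unmatched-yes m mx))) (trans (cong (defect m) e) (trans def δ≡0)))

      -- Here |S| = 2 k + 1, and the independence number is at most k + 1 - d, so the Ramsey bound
      -- applies directly.
      at-one : δ ≡ 1 → ⊥
      at-one δ≡1 =
        <⇒≱ (ramsey (proj₁ thr) u (λ I ap I⊆ → <-≤-trans (ni I ap I⊆) (s≤s (m+n≤o⇒m≤o∸n a a+d≤′))))
            (≤-trans (proj₂ thr) (≤-reflexive (sym (trans len (cong (2 * k +_) δ≡1)))))
        where
        a+d≤′ : a + d ≤ suc k
        a+d≤′ = ≤-trans a+d≤ (≤-reflexive (trans (cong (k +_) δ≡1) (+-comm k 1)))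
        thr : suc k ∸ d ≤ 9 × threshold (suc k ∸ d) ≤ 2 * k + 1
        thr = threshold≤ {d} {k} d≤ k< (≤-trans (m≤n+m d a) a+d≤′)

      -- Matchings of the two parts combine to a matching of S, and independent sets to an
      -- independent set. So `distribute` shares `d` between parts that are no counterexamples, and
      -- their bounds add up by `bound-superadditive`.
      separated : ∀ {u₀ w} P Q → P ++ Q ↭ S → Unique (P ++ Q) → u₀ ∈ P → w ∈ Q → (∀ {x y} → x ∈ P → y ∈ Q → adj x y ≡ true → ⊥) → ⊥
      separated P Q p pu u∈P w∈Q apart =
        ¬¬-maximum P λ (δ₁ , max₁) → ¬¬-maximum Q λ (δ₂ , max₂) →
        ¬¬-independence P λ (a₁ , ni₁ , I₁ , ap₁ , I₁⊆ , a₁≤) → ¬¬-independence Q λ (a₂ , ni₂ , I₂ , ap₂ , I₂⊆ , a₂≤) →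
        combine δ₁ δ₂ max₁ max₂ a₁ a₂ ni₁ ni₂ (≤-trans (+-mono-≤ a₁≤ a₂≤) (≤-trans (≤-reflexive (sym (Lₚ.length-++ I₁)))
          (≤-pred (ni (I₁ ++ I₂) (APₚ.++⁺ ap₁ ap₂ (All.map (λ x∈ → All.map (anti x∈) I₂⊆) I₁⊆))
            (All.map (∈-resp-↭ p) (Allₚ.++⁺ (All.map ∈-++⁺ˡ I₁⊆) (All.map (∈-++⁺ʳ P) I₂⊆)))))))
        where
        uP : Unique P
        uP = AllPairs-++ˡ P pu
        uQ : Unique Q
        uQ = AllPairs-++ʳ P pu
        lenS : length P + length Q ≡ length S
        lenS = trans (sym (Lₚ.length-++ P)) (↭-length p)
        nonempty : ∀ {x} {X : List A} → x ∈ X → 1 ≤ length X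
        nonempty {X = _ ∷ _} _ = s≤s z≤n
        P≤ : length P < n
        P≤ = ≤-trans (≤-trans (≤-reflexive (+-comm 1 (length P))) (+-monoʳ-≤ (length P) (nonempty w∈Q))) (≤-trans (≤-reflexive lenS) S≤)
        Q≤ : length Q < n
        Q≤ = ≤-trans (+-monoˡ-≤ (length Q) (nonempty u∈P)) (≤-trans (≤-reflexive lenS) S≤)
        anti : ∀ {x y} → x ∈ P → y ∈ Q → Anti x y
        anti {x} {y} x∈ y∈ = (λ { refl → ++-disjoint P pu y∈ x∈ }) , nonadjacent
          where
          nonadjacent : adj x y ≡ false
          nonadjacent with adj x y in e
          ... | true = ⊥-elim (apart x∈ y∈ e)
          ... | false = refl
        combine : ∀ δ₁ δ₂ → IsMaximum P δ₁ → IsMaximum Q δ₂ → ∀ a₁ a₂ → NoInd (suc a₁) P → NoInd (suc a₂) Q → a₁ + a₂ ≤ a → ⊥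
        combine δ₁ δ₂ max₁@((m₁ , M₁ , d₁) , _) max₂@((m₂ , M₂ , d₂) , _) a₁ a₂ ni₁ ni₂ a₁+a₂≤ =
          finish (distribute a₁ a₂ d (begin
            a₁ + a₂ + d              ≤⟨ +-monoˡ-≤ d a₁+a₂≤ ⟩
            a + d                    ≤⟨ a+d≤ ⟩
            k + δ                    ≤⟨ k+δ≤ ⟩
            (k₁ + δ₁) + (k₂ + δ₂)    ∎))
          where
          open ≤-Reasoning
          par₁ : ∃ λ k → length P ≡ 2 * k + δ₁
          par₁ = let k , e = matching-parity uP M₁ in k , trans e (cong (2 * k +_) d₁)
          par₂ : ∃ λ k → length Q ≡ 2 * k + δ₂
          par₂ = let k , e = matching-parity uQ M₂ in k , trans e (cong (2 * k +_) d₂)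
          k₁ k₂ : ℕ
          k₁ = proj₁ par₁
          k₂ = proj₁ par₂
          joined : IsMatching (P ++ Q) (join P m₁ m₂) × defect (join P m₁ m₂) (P ++ Q) ≡ defect m₁ P + defect m₂ Q
          joined = join-matching pu M₁ M₂
          δ≤ : δ ≤ δ₁ + δ₂
          δ≤ = ≤-trans (min _ (IsMatching-↭ p (proj₁ joined)))
            (≤-reflexive (trans (sym (∑-↭ (unmatched (join P m₁ m₂)) p)) (trans (proj₂ joined) (cong₂ _+_ d₁ d₂))))
          total : 2 * (k₁ + k₂) + (δ₁ + δ₂) ≡ 2 * k + δ
          total = trans (eq k₁ k₂ δ₁ δ₂) (trans (cong₂ _+_ (sym (proj₂ par₁)) (sym (proj₂ par₂))) (trans lenS len))
            where
            open +-*-Solver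
            eq : ∀ k₁ k₂ δ₁ δ₂ → 2 * (k₁ + k₂) + (δ₁ + δ₂) ≡ (2 * k₁ + δ₁) + (2 * k₂ + δ₂)
            eq = solve 4 (λ k₁ k₂ δ₁ δ₂ → con 2 :* (k₁ :+ k₂) :+ (δ₁ :+ δ₂) := (con 2 :* k₁ :+ δ₁) :+ (con 2 :* k₂ :+ δ₂)) refl
          k₁+k₂≤ : k₁ + k₂ ≤ k
          k₁+k₂≤ = *-cancelˡ-≤ 2 (+-cancelʳ-≤ δ _ _ (≤-trans (+-monoʳ-≤ (2 * (k₁ + k₂)) δ≤) (≤-reflexive total)))
          k+δ≤ : k + δ ≤ (k₁ + δ₁) + (k₂ + δ₂)
          k+δ≤ = +-cancelˡ-≤ k _ _ (begin
            k + (k + δ)                            ≡⟨ eq₁ k δ ⟩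
            2 * k + δ                              ≡⟨ sym total ⟩
            2 * (k₁ + k₂) + (δ₁ + δ₂)              ≡⟨ eq₂ k₁ k₂ δ₁ δ₂ ⟩
            (k₁ + k₂) + ((k₁ + δ₁) + (k₂ + δ₂))    ≤⟨ +-monoˡ-≤ _ k₁+k₂≤ ⟩
            k + ((k₁ + δ₁) + (k₂ + δ₂))            ∎)
            where
            open +-*-Solver
            eq₁ : ∀ k δ → k + (k + δ) ≡ 2 * k + δ
            eq₁ = solve 2 (λ k δ → k :+ (k :+ δ) := con 2 :* k :+ δ) refl
            eq₂ : ∀ k₁ k₂ δ₁ δ₂ → 2 * (k₁ + k₂) + (δ₁ + δ₂) ≡ (k₁ + k₂) + ((k₁ + δ₁) + (k₂ + δ₂))
            eq₂ = solve 4 (λ k₁ k₂ δ₁ δ₂ → con 2 :* (k₁ :+ k₂) :+ (δ₁ :+ δ₂) := (k₁ :+ k₂) :+ ((k₁ :+ δ₁) :+ (k₂ :+ δ₂))) refl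
          lower₁ : ∀ {e} → a₁ + e ≤ k₁ + δ₁ → e ≤ 13 → ¬ (k₁ < bound e)
          lower₁ = IH P≤ uP max₁ (proj₂ par₁) ni₁
          lower₂ : ∀ {e} → a₂ + e ≤ k₂ + δ₂ → e ≤ 13 → ¬ (k₂ < bound e)
          lower₂ = IH Q≤ uQ max₂ (proj₂ par₂) ni₂
          finish : a₁ + d ≤ k₁ + δ₁ ⊎ a₂ + d ≤ k₂ + δ₂ ⊎ (∃₂ λ d₁ d₂ → d₁ + d₂ ≡ d × a₁ + d₁ ≤ k₁ + δ₁ × a₂ + d₂ ≤ k₂ + δ₂) → ⊥
          finish (inj₁ q) = lower₁ q d≤ (≤-<-trans (≤-trans (m≤m+n k₁ k₂) k₁+k₂≤) k<)
          finish (inj₂ (inj₁ q)) = lower₂ q d≤ (≤-<-trans (≤-trans (m≤n+m k₂ k₁) k₁+k₂≤) k<)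
          finish (inj₂ (inj₂ (e₁ , e₂ , refl , q₁ , q₂))) =
            <⇒≱ k< (≤-trans (bound-superadditive {e₁} {e₂} d≤) (≤-trans
              (+-mono-≤ (≮⇒≥ (lower₁ q₁ (≤-trans (m≤m+n e₁ e₂) d≤))) (≮⇒≥ (lower₂ q₂ (≤-trans (m≤n+m e₂ e₁) d≤)))) k₁+k₂≤))

      -- "No maximum matching misses both x and u" cuts S into two parts without edges between them.
      at-two : 2 ≤ δ → ⊥
      at-two 2≤δ with u₀ , w , u∈ , w∈ , u≢w , mu , mw ← two-unmatched m u (≤-trans 2≤δ (≤-reflexive (sym defm))) =
        ¬¬-partition (λ x → x ≡ u₀ ⊎ ¬ Missed δ S x u₀) S λ (P , Q , p , rP , rQ) →
        let pu = Unique-↭ (↭-sym p) u in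
        separated P Q p pu (in-P P Q p rQ u∈) (in-Q P Q p rP w∈)
          (no-edges P Q p rP rQ)
        where
        in-P : ∀ P Q (p : P ++ Q ↭ S) → All (λ x → ¬ (x ≡ u₀ ⊎ ¬ Missed δ S x u₀)) Q → u₀ ∈ S → u₀ ∈ P
        in-P P Q p rQ u∈ with ∈-++⁻ P (∈-resp-↭ (↭-sym p) u∈)
        ... | inj₁ q = q
        ... | inj₂ q = ⊥-elim (All.lookup rQ q (inj₁ refl))
        in-Q : ∀ P Q (p : P ++ Q ↭ S) → All (λ x → x ≡ u₀ ⊎ ¬ Missed δ S x u₀) P → w ∈ S → w ∈ Q
        in-Q P Q p rP w∈ with ∈-++⁻ P (∈-resp-↭ (↭-sym p) w∈)
        ... | inj₂ q = q
        ... | inj₁ q with All.lookup rP q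
        ...   | inj₁ e = ⊥-elim (u≢w (sym e))
        ...   | inj₂ nm = ⊥-elim (nm (m , M , defm , mw , mu))
        no-edges : ∀ P Q (p : P ++ Q ↭ S) → All (λ x → x ≡ u₀ ⊎ ¬ Missed δ S x u₀) P →
                   All (λ x → ¬ (x ≡ u₀ ⊎ ¬ Missed δ S x u₀)) Q → ∀ {x y} → x ∈ P → y ∈ Q → adj x y ≡ true → ⊥
        no-edges P Q p rP rQ {x} {y} x∈ y∈ xy with All.lookup rP x∈
        -- A neighbour `y` of `u₀` is never missed together with it, so it would belong to P.
        ... | inj₁ refl = All.lookup rQ y∈ (inj₂ λ (m , M , def , my , mu) →
                missed-nonadjacent x∈S y∈S xy (m , M , def , mu , my))
          where
          open Gallai u min
          x∈S = ∈-resp-↭ p (∈-++⁺ˡ x∈)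
          y∈S = ∈-resp-↭ p (∈-++⁺ʳ P y∈)
        -- A maximum matching missing `y` and `u₀` contradicts Gallai's lemma with t = x: `x` is
        -- adjacent to `y` and never missed together with `u₀`.
        ... | inj₂ nm = All.lookup rQ y∈ (inj₂ λ yu → inessential x∈S λ xx →
                gallai y∈S u∈ x∈S (λ e → All.lookup rQ y∈ (inj₁ e)) yu xx (missed-nonadjacent x∈S y∈S xy) nm)
          where
          open Gallai u min
          x∈S = ∈-resp-↭ p (∈-++⁺ˡ x∈)
          y∈S = ∈-resp-↭ p (∈-++⁺ʳ P y∈)
      impossible : ⊥
      impossible with δ ≟ℕ 0 | δ ≟ℕ 1
      ... | yes e | _ = at-zero e
      ... | no _ | yes e = at-one e
      ... | no n₀ | no n₁ = at-two (≤∧≢⇒< (n≢0⇒n>0 n₀) (n₁ ∘ sym))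

    no-large : ∀ n → NoLarge n
    no-large (suc n) (s≤s S≤) u max len ni a+d≤ d≤ k< = Step.impossible (no-large n) S≤ u max len ni a+d≤ d≤ k<

    bound≤matching : ∀ {S δ k a d} → Unique S → IsMaximum S δ → length S ≡ 2 * k + δ → NoInd (suc a) S → a + d ≤ k + δ → d ≤ 13 → bound d ≤ k
    bound≤matching u max len ni a+d≤ d≤ = ≮⇒≥ (no-large _ ≤-refl u max len ni a+d≤ d≤)

-- Edge bounds, classified graphs and weights

-- Entry n of the table for k is a lower bound for E(k, n), not always the best one; the length of
-- the table bounds R(3, k) from above.
T2 : Table
T2 = 0 ∷ 0 ∷ 1 ∷ []

T3 : Table
T3 = 0 ∷ 0 ∷ 0 ∷ 1 ∷ 2 ∷ 5 ∷ []

T4 : Table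
T4 = 0 ∷ 0 ∷ 0 ∷ 0 ∷ 1 ∷ 2 ∷ 3 ∷ 6 ∷ 10 ∷ []

T5 : Table
T5 = 0 ∷ 0 ∷ 0 ∷ 0 ∷ 0 ∷ 1 ∷ 2 ∷ 3 ∷ 4 ∷ 7 ∷ 10 ∷ 15 ∷ 20 ∷ 26 ∷ []

T6 : Table
T6 = 0 ∷ 0 ∷ 0 ∷ 0 ∷ 0 ∷ 0 ∷ 1 ∷ 2 ∷ 3 ∷ 4 ∷ 5 ∷ 8 ∷ 11 ∷ 15 ∷ 19 ∷ 25 ∷ 31 ∷ 38 ∷ 45 ∷ []

T7 : Table
T7 = 0 ∷ 0 ∷ 0 ∷ 0 ∷ 0 ∷ 0 ∷ 0 ∷ 1 ∷ 2 ∷ 3 ∷ 4 ∷ 5 ∷ 6 ∷ 9 ∷ 12 ∷ 15 ∷ 20 ∷ 24 ∷ 30 ∷ 36 ∷ 42 ∷ 50 ∷ 59 ∷ 68 ∷ []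

T8 : Table
T8 = 0 ∷ 0 ∷ 0 ∷ 0 ∷ 0 ∷ 0 ∷ 0 ∷ 0 ∷ 1 ∷ 2 ∷ 3 ∷ 4 ∷ 5 ∷ 6 ∷ 7 ∷ 10 ∷ 13 ∷ 16 ∷ 20 ∷ 24 ∷ 29 ∷ 34 ∷ 40 ∷ 46 ∷ 54 ∷ 62 ∷ 71 ∷ 80 ∷ 88 ∷ 99 ∷ []

T9 : Table
T9 = 0 ∷ 0 ∷ 0 ∷ 0 ∷ 0 ∷ 0 ∷ 0 ∷ 0 ∷ 0 ∷ 1 ∷ 2 ∷ 3 ∷ 4 ∷ 5 ∷ 6 ∷ 7 ∷ 8 ∷ 11 ∷ 14 ∷ 17 ∷ 20 ∷ 25 ∷ 29 ∷ 33 ∷ 39 ∷ 45 ∷ 50 ∷ 57 ∷ 64 ∷ 71 ∷ 80 ∷ 90 ∷ 99 ∷ 110 ∷ 122 ∷ 134 ∷ 144 ∷ []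

-- The numbers in these names are k, n and e. Up to isomorphism the list contains every
-- triangle-free graph with n vertices, e edges and no independent k-set; the corresponding class
-- lemma proves this.
graphs-1-0-0 : List Tri
graphs-1-0-0 = map decode
  ( ([])
  ∷ [])

graphs-2-2-1 : List Tri
graphs-2-2-1 = map decode
  ( (1 ∷ 0 ∷ [])
  ∷ [])

graphs-3-4-2 : List Tri
graphs-3-4-2 = map decode
  ( (1 ∷ 0 ∷ 1 ∷ 0 ∷ [])
  ∷ [])

graphs-4-7-6 : List Tri
graphs-4-7-6 = map decode
  ( (9 ∷ 1 ∷ 1 ∷ 1 ∷ 0 ∷ 1 ∷ 0 ∷ [])
  ∷ [])

graphs-5-10-10 : List Tri
graphs-5-10-10 = map decode
  ( (3 ∷ 2 ∷ 2 ∷ 1 ∷ 0 ∷ 3 ∷ 2 ∷ 2 ∷ 1 ∷ 0 ∷ [])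
  ∷ [])

graphs-5-10-11 : List Tri
graphs-5-10-11 = map decode
  ( (19 ∷ 144 ∷ 1 ∷ 1 ∷ 1 ∷ 0 ∷ 1 ∷ 1 ∷ 1 ∷ 0 ∷ [])
  ∷ (13 ∷ 17 ∷ 5 ∷ 8 ∷ 1 ∷ 0 ∷ 1 ∷ 0 ∷ 1 ∷ 0 ∷ [])
  ∷ [])

graphs-5-11-15 : List Tri
graphs-5-11-15 = map decode
  ( (43 ∷ 34 ∷ 33 ∷ 2 ∷ 17 ∷ 1 ∷ 8 ∷ 1 ∷ 0 ∷ 1 ∷ 0 ∷ [])
  ∷ [])

graphs-6-14-20 : List Tri
graphs-6-14-20 = map decode
  ( (39 ∷ 168 ∷ 130 ∷ 129 ∷ 1 ∷ 1 ∷ 2 ∷ 17 ∷ 1 ∷ 8 ∷ 1 ∷ 0 ∷ 1 ∷ 0 ∷ [])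
  ∷ [])

graphs-6-15-25 : List Tri
graphs-6-15-25 = map decode
  ( (147 ∷ 530 ∷ 530 ∷ 1057 ∷ 288 ∷ 9 ∷ 1 ∷ 1 ∷ 2 ∷ 2 ∷ 2 ∷ 2 ∷ 2 ∷ 1 ∷ 0 ∷ [])
  ∷ [])

graphs-6-15-26 : List Tri
graphs-6-15-26 = map decode
  ( (589 ∷ 2121 ∷ 67 ∷ 1026 ∷ 2 ∷ 1 ∷ 0 ∷ 19 ∷ 36 ∷ 1 ∷ 1 ∷ 1 ∷ 1 ∷ 1 ∷ 0 ∷ [])
  ∷ (2323 ∷ 292 ∷ 2305 ∷ 517 ∷ 9 ∷ 257 ∷ 1 ∷ 1 ∷ 1 ∷ 1 ∷ 1 ∷ 1 ∷ 1 ∷ 1 ∷ 0 ∷ [])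
  ∷ (1169 ∷ 19 ∷ 1090 ∷ 1033 ∷ 1 ∷ 1 ∷ 8 ∷ 49 ∷ 3 ∷ 20 ∷ 1 ∷ 1 ∷ 0 ∷ 1 ∷ 0 ∷ [])
  ∷ (579 ∷ 1092 ∷ 73 ∷ 641 ∷ 513 ∷ 67 ∷ 144 ∷ 1 ∷ 1 ∷ 1 ∷ 1 ∷ 0 ∷ 1 ∷ 1 ∷ 0 ∷ [])
  ∷ (1157 ∷ 289 ∷ 2114 ∷ 515 ∷ 130 ∷ 35 ∷ 136 ∷ 1 ∷ 1 ∷ 1 ∷ 0 ∷ 1 ∷ 1 ∷ 1 ∷ 0 ∷ [])
  ∷ (1107 ∷ 2054 ∷ 2051 ∷ 20 ∷ 129 ∷ 5 ∷ 9 ∷ 18 ∷ 1 ∷ 1 ∷ 1 ∷ 1 ∷ 0 ∷ 1 ∷ 0 ∷ [])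
  ∷ (1093 ∷ 265 ∷ 67 ∷ 4 ∷ 521 ∷ 1 ∷ 0 ∷ 35 ∷ 10 ∷ 3 ∷ 8 ∷ 1 ∷ 1 ∷ 1 ∷ 0 ∷ [])
  ∷ [])

graphs-7-20-44 : List Tri
graphs-7-20-44 = map decode
  ( (51235 ∷ 33322 ∷ 34851 ∷ 33312 ∷ 23 ∷ 8324 ∷ 24 ∷ 20 ∷ 3 ∷ 32 ∷ 0 ∷ 5 ∷ 1 ∷ 8 ∷ 3 ∷ 4 ∷ 5 ∷ 1 ∷ 1 ∷ 0 ∷ [])
  ∷ (18477 ∷ 39169 ∷ 8229 ∷ 32776 ∷ 85 ∷ 8193 ∷ 11 ∷ 32 ∷ 261 ∷ 21 ∷ 33 ∷ 64 ∷ 33 ∷ 2 ∷ 9 ∷ 1 ∷ 1 ∷ 2 ∷ 0 ∷ 0 ∷ [])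
  ∷ (139349 ∷ 197 ∷ 9225 ∷ 65 ∷ 4097 ∷ 1153 ∷ 275 ∷ 530 ∷ 10 ∷ 3 ∷ 0 ∷ 69 ∷ 1 ∷ 2 ∷ 7 ∷ 8 ∷ 4 ∷ 1 ∷ 1 ∷ 0 ∷ [])
  ∷ (37133 ∷ 135201 ∷ 32805 ∷ 2116 ∷ 1217 ∷ 1041 ∷ 37 ∷ 41 ∷ 11 ∷ 18 ∷ 256 ∷ 32 ∷ 16 ∷ 17 ∷ 1 ∷ 1 ∷ 1 ∷ 0 ∷ 1 ∷ 0 ∷ [])
  ∷ (8531 ∷ 73734 ∷ 65571 ∷ 516 ∷ 33 ∷ 129 ∷ 19 ∷ 276 ∷ 521 ∷ 67 ∷ 8 ∷ 161 ∷ 1 ∷ 0 ∷ 5 ∷ 9 ∷ 1 ∷ 1 ∷ 1 ∷ 0 ∷ [])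
  ∷ (33813 ∷ 1105 ∷ 16403 ∷ 18432 ∷ 553 ∷ 67 ∷ 276 ∷ 35 ∷ 512 ∷ 81 ∷ 7 ∷ 128 ∷ 64 ∷ 11 ∷ 16 ∷ 1 ∷ 1 ∷ 1 ∷ 0 ∷ 0 ∷ [])
  ∷ (37413 ∷ 135173 ∷ 32789 ∷ 2192 ∷ 401 ∷ 21 ∷ 273 ∷ 19 ∷ 1024 ∷ 67 ∷ 10 ∷ 32 ∷ 16 ∷ 17 ∷ 1 ∷ 1 ∷ 1 ∷ 0 ∷ 1 ∷ 0 ∷ [])
  ∷ (8421 ∷ 131209 ∷ 33283 ∷ 8384 ∷ 1095 ∷ 1156 ∷ 580 ∷ 532 ∷ 513 ∷ 1 ∷ 8 ∷ 129 ∷ 1 ∷ 2 ∷ 3 ∷ 2 ∷ 1 ∷ 0 ∷ 1 ∷ 0 ∷ [])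
  ∷ (427 ∷ 139530 ∷ 10513 ∷ 25344 ∷ 4129 ∷ 3 ∷ 48 ∷ 3 ∷ 576 ∷ 72 ∷ 3 ∷ 2 ∷ 2 ∷ 1 ∷ 16 ∷ 3 ∷ 2 ∷ 2 ∷ 1 ∷ 0 ∷ [])
  ∷ (37387 ∷ 34314 ∷ 34864 ∷ 34852 ∷ 8707 ∷ 8706 ∷ 3 ∷ 2 ∷ 6 ∷ 3 ∷ 2 ∷ 2 ∷ 3 ∷ 2 ∷ 2 ∷ 2 ∷ 5 ∷ 1 ∷ 1 ∷ 0 ∷ [])
  ∷ (12453 ∷ 17697 ∷ 33029 ∷ 32801 ∷ 1037 ∷ 2065 ∷ 261 ∷ 520 ∷ 513 ∷ 4 ∷ 257 ∷ 2 ∷ 3 ∷ 4 ∷ 5 ∷ 1 ∷ 1 ∷ 0 ∷ 1 ∷ 0 ∷ [])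
  ∷ (131349 ∷ 131141 ∷ 9352 ∷ 10376 ∷ 165 ∷ 289 ∷ 35 ∷ 66 ∷ 259 ∷ 66 ∷ 128 ∷ 128 ∷ 5 ∷ 9 ∷ 1 ∷ 1 ∷ 1 ∷ 0 ∷ 1 ∷ 0 ∷ [])
  ∷ (35339 ∷ 135186 ∷ 1313 ∷ 2050 ∷ 16901 ∷ 9 ∷ 17 ∷ 517 ∷ 521 ∷ 131 ∷ 132 ∷ 8 ∷ 5 ∷ 1 ∷ 2 ∷ 0 ∷ 3 ∷ 2 ∷ 1 ∷ 0 ∷ [])
  ∷ (34837 ∷ 33345 ∷ 1043 ∷ 1092 ∷ 16403 ∷ 274 ∷ 19 ∷ 1024 ∷ 81 ∷ 261 ∷ 17 ∷ 3 ∷ 6 ∷ 4 ∷ 4 ∷ 8 ∷ 1 ∷ 0 ∷ 1 ∷ 0 ∷ [])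
  ∷ (12301 ∷ 73737 ∷ 547 ∷ 32778 ∷ 18 ∷ 9 ∷ 9 ∷ 1033 ∷ 19 ∷ 2 ∷ 321 ∷ 17 ∷ 3 ∷ 4 ∷ 5 ∷ 9 ∷ 1 ∷ 1 ∷ 1 ∷ 0 ∷ [])
  ∷ [])

-- The first three numbers name the class to be derived, the last two are the order and the edge
-- count of the known graphs on the non-neighbours.
root-2-2-1-0-0 : Root
root-2-2-1-0-0 = root 0 0 (zip graphs-1-0-0
  ( (1 , 0)
  ∷ []))

glue-2-2-1-0-0 : GluesInto 2 2 1 graphs-2-2-1 root-2-2-1-0-0
glue-2-2-1-0-0 = refl ∷ []

root-3-4-2-2-1 : Root
root-3-4-2-2-1 = root 2 1 (zip graphs-2-2-1
  ( (11 , 1)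
  ∷ []))

glue-3-4-2-2-1 : GluesInto 3 4 2 graphs-3-4-2 root-3-4-2-2-1
glue-3-4-2-2-1 = refl ∷ []

root-4-7-6-4-2 : Root
root-4-7-6-4-2 = root 4 2 (zip graphs-3-4-2
  ( (1111 , 1)
  ∷ []))

glue-4-7-6-4-2 : GluesInto 4 7 6 graphs-4-7-6 root-4-7-6-4-2
glue-4-7-6-4-2 = refl ∷ []

root-5-10-10-7-6 : Root
root-5-10-10-7-6 = root 7 6 (zip graphs-4-7-6
  ( (1111111111 , 2)
  ∷ []))

glue-5-10-10-7-6 : GluesInto 5 10 10 graphs-5-10-10 root-5-10-10-7-6
glue-5-10-10-7-6 = refl ∷ []

root-5-10-11-7-6 : Root
root-5-10-11-7-6 = root 7 6 (zip graphs-4-7-6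
  ( (1111111111 , 2)
  ∷ []))

glue-5-10-11-7-6 : GluesInto 5 10 11 graphs-5-10-11 root-5-10-11-7-6
glue-5-10-11-7-6 = refl ∷ []

root-5-11-15-7-6 : Root
root-5-11-15-7-6 = root 7 6 (zip graphs-4-7-6
  ( (1111111111 , 1)
  ∷ []))

glue-5-11-15-7-6 : GluesInto 5 11 15 graphs-5-11-15 root-5-11-15-7-6
glue-5-11-15-7-6 = refl ∷ []

root-6-14-19-10-10 : Root
root-6-14-19-10-10 = root 10 10 (zip graphs-5-10-10
  ( (1111111111111111111111111 , 3)
  ∷ []))

glue-6-14-19-10-10 : GluesInto 6 14 19 [] root-6-14-19-10-10
glue-6-14-19-10-10 = refl ∷ []

root-6-14-20-10-10 : Root
root-6-14-20-10-10 = root 10 10 (zip graphs-5-10-10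
  ( (1111111111111111111111111 , 3)
  ∷ []))

root-6-14-20-10-11 : Root
root-6-14-20-10-11 = root 10 11 (zip graphs-5-10-11
  ( (111111111111111111111 , 3)
  ∷ (111111111111111111111111 , 3)
  ∷ []))

glue-6-14-20-10-10 : GluesInto 6 14 20 graphs-6-14-20 root-6-14-20-10-10
glue-6-14-20-10-10 = refl ∷ []

glue-6-14-20-10-11 : GluesInto 6 14 20 graphs-6-14-20 root-6-14-20-10-11
glue-6-14-20-10-11 = refl ∷ refl ∷ []

root-6-15-25-11-15 : Root
root-6-15-25-11-15 = root 11 15 (zip graphs-5-11-15
  ( (11111111111111111111111111111 , 3)
  ∷ []))

glue-6-15-25-11-15 : GluesInto 6 15 25 graphs-6-15-25 root-6-15-25-11-15
glue-6-15-25-11-15 = refl ∷ []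

root-6-15-26-11-15 : Root
root-6-15-26-11-15 = root 11 15 (zip graphs-5-11-15
  ( (11111111111111111111111111111 , 3)
  ∷ []))

root-6-15-26-10-10 : Root
root-6-15-26-10-10 = root 10 10 (zip graphs-5-10-10
  ( (1111111111111111111111111 , 2)
  ∷ []))

root-6-15-26-10-11 : Root
root-6-15-26-10-11 = root 10 11 (zip graphs-5-10-11
  ( (111111111111111111111 , 3)
  ∷ (111111111111111111111111 , 3)
  ∷ []))

glue-6-15-26-11-15 : GluesInto 6 15 26 graphs-6-15-26 root-6-15-26-11-15
glue-6-15-26-11-15 = refl ∷ []

glue-6-15-26-10-10 : GluesInto 6 15 26 graphs-6-15-26 root-6-15-26-10-10
glue-6-15-26-10-10 = refl ∷ []

glue-6-15-26-10-11 : GluesInto 6 15 26 graphs-6-15-26 root-6-15-26-10-11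
glue-6-15-26-10-11 = refl ∷ refl ∷ []

root-6-16-31-11-15 : Root
root-6-16-31-11-15 = root 11 15 (zip graphs-5-11-15
  ( (11111111111111111111111111111 , 2)
  ∷ []))

glue-6-16-31-11-15 : GluesInto 6 16 31 [] root-6-16-31-11-15
glue-6-16-31-11-15 = refl ∷ []

root-7-19-36-14-20 : Root
root-7-19-36-14-20 = root 14 20 (zip graphs-6-14-20
  ( (9955555555443344444344993455435544345555161171777112171161121611112222 , 26)
  ∷ []))

glue-7-19-36-14-20 : GluesInto 7 19 36 [] root-7-19-36-14-20
glue-7-19-36-14-20 = refl ∷ []

root-7-20-42-15-25 : Root
root-7-20-42-15-25 = root 15 25 (zip graphs-6-15-25
  ( (1111111111111111111111111111111111111111111111111111111111111111111111111111111111 , 7)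
  ∷ []))

glue-7-20-42-15-25 : GluesInto 7 20 42 [] root-7-20-42-15-25
glue-7-20-42-15-25 = refl ∷ []

root-7-20-43-15-25 : Root
root-7-20-43-15-25 = root 15 25 (zip graphs-6-15-25
  ( (3336693969393336233232233336639996933363233232239363963323323232322332232332322322 , 25)
  ∷ []))

root-7-20-43-14-20 : Root
root-7-20-43-14-20 = root 14 20 (zip graphs-6-14-20
  ( (6655222255223322223322663355335522222222532235222322333323223333222222 , 17)
  ∷ []))

glue-7-20-43-15-25 : GluesInto 7 20 43 [] root-7-20-43-15-25
glue-7-20-43-15-25 = refl ∷ []

glue-7-20-43-14-20 : GluesInto 7 20 43 [] root-7-20-43-14-20
glue-7-20-43-14-20 = refl ∷ []

root-7-20-44-15-25 : Root
root-7-20-44-15-25 = root 15 25 (zip graphs-6-15-25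
  ( (3336693969393336233232233336639996933363233232239363963323323232322332232332322322 , 25)
  ∷ []))

root-7-20-44-15-26 : Root
root-7-20-44-15-26 = root 15 26 (zip graphs-6-15-26
  ( (11011121110011000000111102111100011000000000000000000000000000000000111111100000 , 3)
  ∷ (54832345329221412334452382421547312021112362724212272701714402112111102110 , 17)
  ∷ (678181817281111511122422335612229811224411118429242121411124211243111221 , 18)
  ∷ (432222261611113121114124011224541020110130322110310011111001001211113100 , 9)
  ∷ (766700700415166013002239222392223121533540076151310600302001210312100200 , 16)
  ∷ (33221133442211111100311212232221121111111110121111111110113300112211111100001100 , 9)
  ∷ (46592373414334425131749522112321734311215211212312152122111554834844344321 , 20)
  ∷ []))

root-7-20-44-14-20 : Root
root-7-20-44-14-20 = root 14 20 (zip graphs-6-14-20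
  ( (2222000022111111111111221122112211110000110012111100111111001111000000 , 6)
  ∷ []))

glue-7-20-44-15-25 : GluesInto 7 20 44 graphs-7-20-44 root-7-20-44-15-25
glue-7-20-44-15-25 = refl ∷ []

glue-7-20-44-15-26 : GluesInto 7 20 44 graphs-7-20-44 root-7-20-44-15-26
glue-7-20-44-15-26 = refl ∷ refl ∷ refl ∷ refl ∷ refl ∷ refl ∷ refl ∷ []

glue-7-20-44-14-20 : GluesInto 7 20 44 graphs-7-20-44 root-7-20-44-14-20
glue-7-20-44-14-20 = refl ∷ []

root-8-26-71-20-44 : Root
root-8-26-71-20-44 = root 20 44 (zip graphs-7-20-44
  ( (776656556774565544436775494544454556465455444545344434334356665666554645346546554346544554434454354543465437443333434555364654855455444533433444453465243323337454345443434445435476746784443434445436473334343322434423233335334233333443255432224322232222 , 64)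
  ∷ (453234322233422222214421242222123633333221124232221223222124333433322235221234331224223522522132222125221233222222114232522222324222223222322232541111121211211222111213412131333231121123122211112312223112291111221211311112222222122122111111121222111211 , 29)
  ∷ (435443734345574543335344635322343435353555643333234443333254342653233254453553436473435334245444343433334344343333434232333324436345353343333333265453544436435345644644343333432325435333322324334354343636333434232392232333344333233243433244342323222332 , 53)
  ∷ (574744344647543445338544434475444344532254334344333334332245443534565464545433326587753254315464649364524736642335232334132428323464339775443331442332353357636433231343244293344463335334332345445533745333334332343433244354334323543332443333235333234322 , 58)
  ∷ (675555555545656455464445555556555566655556444586445868456479765856557657566865575657595786754554545555454544556556455458759555756445455546564486454465466446655555445555444444544685765555556656455455555546444544455455444445444564654444445544 , 74)
  ∷ (338233232252412113122322734232231135124222422134222112231111222143623221422222222232212224321232223232332222332322222122232122223131222222123222322222121221222212211222122224226311322222214131131322211151421313323129111212112111112111132212 , 28)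
  ∷ (564555345656554534336545333444235534434454334344432233333355444554447765464565565556345443544727352422443485345423133244132337995445334754344333252233634334532132123433333273445553335555643364443354443343354343334533444422234434433432343332325332313332 , 52)
  ∷ (343455545433335473454444333343343334333333443323112211132244543353685424233484352255464933333622332334224432421322351112111322755443447642322222431334242423543532331111222432334334333322544424345332343323122332222331111212242222323332234232122212111211 , 47)
  ∷ (111111111111111111111111111111111111111111111111111111111111111111111111111111111111111111111111111111111111111111111111111111111111111111111111111111111111111111111111111111111111111111111111111111111111111111111111111111111111111111111111111111111111 , 15)
  ∷ (655634463333223433232222543321332222233421232322132321333364543345433322335333223354321223233224332223232223232333343535644344633354344234343442222221132233222253552323225335333244332222322222212322222212134221222222224323113232222222222222 , 41)
  ∷ (564555455444545543545444444444345444554544444444444433343456554555454544454534444544554444444444444444444344444433435555645455444444443334444533443444454444344444436555654555444444443334444444543433443444454434434444544344433433444454443443343334434433 , 62)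
  ∷ (554533335435333343334333343333533543222223233333324422222333333222334536333335533333323334433334333433643335332222233333222223332332223344344334332345334333335533333344433332335433333334333234443334233233543333333335333244343333334333333233 , 41)
  ∷ (444454443495557454445445544443334444444444434443443333443379454444544444434434794465448444455464454554444445444333444445343334433343343344443333433343343333445334445446553343556454644444334443434465445454544454343434333343444444433333433334 , 58)
  ∷ (653345334334333233434332536534312243331343253143113313433234132225135431334363533333323413336334225313255433443343314345331133132225531223333343323333556643332233333322233332323432544411413333333333333333453353233222222113312232353133332332322232223132 , 40)
  ∷ (562523523332433343533232333222334222222213322331322115341222343323323543324332432333354422232332222253215112233232212232324322421433212222223333222242232222224232224213215231222233222222222222324333422223233433222222332221322212 , 37)
  ∷ []))

glue-8-26-71-20-44 : GluesInto 8 26 71 [] root-8-26-71-20-44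
glue-8-26-71-20-44 = refl ∷ refl ∷ refl ∷ refl ∷ refl ∷ refl ∷ refl ∷ refl ∷ refl ∷ refl ∷ refl ∷ refl ∷ refl ∷ refl ∷ refl ∷ []

-- Upper bounds for the Ramsey numbers R(3, k)

module SmallRamsey {A : Set} (adj : A → A → Bool)
  (adj-sym : ∀ x y → adj x y ≡ adj y x) (adj-irr : ∀ x → adj x x ≡ false)
  (tf : ∀ {x y z} → adj x y ≡ true → adj x z ≡ true → adj y z ≡ true → ⊥) where

  open TriangleFree adj adj-sym adj-irr tf
  open LinearProgram adj adj-sym adj-irr tf
  open Tables adj adj-sym adj-irr tf
  open Classification adj adj-sym adj-irr tf
  open Improvement adj adj-sym adj-irr tf

  class-1-0-0 : Class 1 0 0 graphs-1-0-0
  class-1-0-0 {[]} u ni refl refl = [] , ↭-refl , here refl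

  class-2-2-1 : Class 2 2 1 graphs-2-2-1
  class-2-2-1 = glue-class {(0 ∷ [])} (root-2-2-1-0-0 ∷ []) LB₁ refl
    ((≤ᵇ⇒≤ _ _ _ , class-1-0-0 , glue-2-2-1-0-0) ∷ [])

  LB-2 : LB T2 2
  LB-2 = next {(0 ∷ [])} LB₁ T2 refl

  class-3-4-2 : Class 3 4 2 graphs-3-4-2
  class-3-4-2 = glue-class {T2} (root-3-4-2-2-1 ∷ []) LB-2 refl
    ((≤ᵇ⇒≤ _ _ _ , class-2-2-1 , glue-3-4-2-2-1) ∷ [])

  LB-3 : LB T3 3
  LB-3 = next {T2} LB-2 T3 refl

  class-4-7-6 : Class 4 7 6 graphs-4-7-6
  class-4-7-6 = glue-class {T3} (root-4-7-6-4-2 ∷ []) LB-3 refl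
    ((≤ᵇ⇒≤ _ _ _ , class-3-4-2 , glue-4-7-6-4-2) ∷ [])

  LB-4 : LB T4 4
  LB-4 = next {T3} LB-3 T4 refl

  class-5-10-10 : Class 5 10 10 graphs-5-10-10
  class-5-10-10 = glue-class {T4} (root-5-10-10-7-6 ∷ []) LB-4 refl
    ((≤ᵇ⇒≤ _ _ _ , class-4-7-6 , glue-5-10-10-7-6) ∷ [])

  class-5-10-11 : Class 5 10 11 graphs-5-10-11
  class-5-10-11 = glue-class {T4} (root-5-10-11-7-6 ∷ []) LB-4 refl
    ((≤ᵇ⇒≤ _ _ _ , class-4-7-6 , glue-5-10-11-7-6) ∷ [])

  class-5-11-15 : Class 5 11 15 graphs-5-11-15
  class-5-11-15 = glue-class {T4} (root-5-11-15-7-6 ∷ []) LB-4 refl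
    ((≤ᵇ⇒≤ _ _ _ , class-4-7-6 , glue-5-11-15-7-6) ∷ [])

  LB-5 : LB T5 5
  LB-5 = next {T4} LB-4 T5 refl

  -- An empty class: the value 19 found by averaging is not attained, so the entry of the table
  -- rises to 20.
  class-6-14-19 : Class 6 14 19 []
  class-6-14-19 = glue-class {T5} (root-6-14-19-10-10 ∷ []) LB-5 refl
    ((≤ᵇ⇒≤ _ _ _ , class-5-10-10 , glue-6-14-19-10-10) ∷ [])

  LB-6 : LB T6 6
  LB-6 = next {T5} LB-5 T6 refl

  LB-6-14-20 : LB (bump 14 T6) 6
  LB-6-14-20 = not-attained {T6} 14 LB-6 refl class-6-14-19

  class-6-14-20 : Class 6 14 20 graphs-6-14-20
  class-6-14-20 = glue-class {T5} (root-6-14-20-10-10 ∷ root-6-14-20-10-11 ∷ []) LB-5 refl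
    ((≤ᵇ⇒≤ _ _ _ , class-5-10-10 , glue-6-14-20-10-10)
    ∷ (≤ᵇ⇒≤ _ _ _ , class-5-10-11 , glue-6-14-20-10-11) ∷ [])

  class-6-15-25 : Class 6 15 25 graphs-6-15-25
  class-6-15-25 = glue-class {T5} (root-6-15-25-11-15 ∷ []) LB-5 refl
    ((≤ᵇ⇒≤ _ _ _ , class-5-11-15 , glue-6-15-25-11-15) ∷ [])

  class-6-15-26 : Class 6 15 26 graphs-6-15-26
  class-6-15-26 = glue-class {T5} (root-6-15-26-11-15 ∷ root-6-15-26-10-10 ∷ root-6-15-26-10-11 ∷ []) LB-5 refl
    ((≤ᵇ⇒≤ _ _ _ , class-5-11-15 , glue-6-15-26-11-15)
    ∷ (≤ᵇ⇒≤ _ _ _ , class-5-10-10 , glue-6-15-26-10-10)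
    ∷ (≤ᵇ⇒≤ _ _ _ , class-5-10-11 , glue-6-15-26-10-11) ∷ [])

  class-6-16-31 : Class 6 16 31 []
  class-6-16-31 = glue-class {T5} (root-6-16-31-11-15 ∷ []) LB-5 refl
    ((≤ᵇ⇒≤ _ _ _ , class-5-11-15 , glue-6-16-31-11-15) ∷ [])

  LB-6-16-32 : LB (bump 16 (bump 14 T6)) 6
  LB-6-16-32 = not-attained {(bump 14 T6)} 16 LB-6-14-20 refl class-6-16-31

  class-7-19-36 : Class 7 19 36 []
  class-7-19-36 = glue-class {(bump 16 (bump 14 T6))} (root-7-19-36-14-20 ∷ []) LB-6-16-32 refl
    ((≤ᵇ⇒≤ _ _ _ , class-6-14-20 , glue-7-19-36-14-20) ∷ [])

  LB-7 : LB T7 7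
  LB-7 = next {(bump 16 (bump 14 T6))} LB-6-16-32 T7 refl

  LB-7-19-37 : LB (bump 19 T7) 7
  LB-7-19-37 = not-attained {T7} 19 LB-7 refl class-7-19-36

  class-7-20-42 : Class 7 20 42 []
  class-7-20-42 = glue-class {(bump 16 (bump 14 T6))} (root-7-20-42-15-25 ∷ []) LB-6-16-32 refl
    ((≤ᵇ⇒≤ _ _ _ , class-6-15-25 , glue-7-20-42-15-25) ∷ [])

  LB-7-20-43 : LB (bump 20 (bump 19 T7)) 7
  LB-7-20-43 = not-attained {(bump 19 T7)} 20 LB-7-19-37 refl class-7-20-42

  class-7-20-43 : Class 7 20 43 []
  class-7-20-43 = glue-class {(bump 16 (bump 14 T6))} (root-7-20-43-15-25 ∷ root-7-20-43-14-20 ∷ []) LB-6-16-32 refl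
    ((≤ᵇ⇒≤ _ _ _ , class-6-15-25 , glue-7-20-43-15-25)
    ∷ (≤ᵇ⇒≤ _ _ _ , class-6-14-20 , glue-7-20-43-14-20) ∷ [])

  LB-7-20-44 : LB (bump 20 (bump 20 (bump 19 T7))) 7
  LB-7-20-44 = not-attained {(bump 20 (bump 19 T7))} 20 LB-7-20-43 refl class-7-20-43

  class-7-20-44 : Class 7 20 44 graphs-7-20-44
  class-7-20-44 = glue-class {(bump 16 (bump 14 T6))} (root-7-20-44-15-25 ∷ root-7-20-44-15-26 ∷ root-7-20-44-14-20 ∷ []) LB-6-16-32 refl
    ((≤ᵇ⇒≤ _ _ _ , class-6-15-25 , glue-7-20-44-15-25)
    ∷ (≤ᵇ⇒≤ _ _ _ , class-6-15-26 , glue-7-20-44-15-26)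
    ∷ (≤ᵇ⇒≤ _ _ _ , class-6-14-20 , glue-7-20-44-14-20) ∷ [])

  -- Averaging forces a vertex of degree 5 whose non-neighbours span one of the fifteen graphs of
  -- `graphs-7-20-44`; none of them extends.
  class-8-26-71 : Class 8 26 71 []
  class-8-26-71 = glue-class {(bump 20 (bump 20 (bump 19 T7)))} (root-8-26-71-20-44 ∷ []) LB-7-20-44 refl
    ((≤ᵇ⇒≤ _ _ _ , class-7-20-44 , glue-8-26-71-20-44) ∷ [])

  LB-8 : LB T8 8
  LB-8 = next {(bump 20 (bump 20 (bump 19 T7)))} LB-7-20-44 T8 refl

  -- The improvement behind R(3, 10) ≤ 43: for degree 8, `deficientOK` requires exactly E(9, 34) ≥
  -- 122, and averaging reaches this value only with E(8, 26) ≥ 72, which bounds the non-neighbours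
  -- of the vertices of degree 7.
  LB-8-26-72 : LB (bump 26 T8) 8
  LB-8-26-72 = not-attained {T8} 26 LB-8 refl class-8-26-71

  LB-9 : LB T9 9
  LB-9 = next {(bump 26 T8)} LB-8-26-72 T9 refl

!-just⇒< : ∀ (T : Table) i {E} → T ! i ≡ just E → i < length T
!-just⇒< (x ∷ T) zero e = s≤s z≤n
!-just⇒< (x ∷ T) (suc i) e = s≤s (!-just⇒< T i e)

module SmallRamseyNumbers {A : Set} (_≟_ : DecidableEquality A) (adj : A → A → Bool)
  (adj-sym : ∀ x y → adj x y ≡ adj y x) (adj-irr : ∀ x → adj x x ≡ false)
  (tf : ∀ {x y z} → adj x y ≡ true → adj x z ≡ true → adj y z ≡ true → ⊥) where

  open TriangleFree adj adj-sym adj-irr tf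
  open LinearProgram adj adj-sym adj-irr tf
  open SmallRamsey adj adj-sym adj-irr tf
  open Ramsey43 adj adj-sym adj-irr tf

  shorter : ∀ T {k} → LB T k → ∀ {S} → Unique S → NoInd k S → length S < length T
  shorter T lb {S} u ni with _ , e , _ ← lb u ni = !-just⇒< T (length S) e

  ramsey : MatchingNumber.Ramsey _≟_ adj adj-sym adj-irr tf
  ramsey {0} a≤ = shorter (0 ∷ []) LB₁
    where open Tables adj adj-sym adj-irr tf
  ramsey {1} a≤ = shorter T2 LB-2
  ramsey {2} a≤ = shorter T3 LB-3
  ramsey {3} a≤ = shorter T4 LB-4
  ramsey {4} a≤ = shorter T5 LB-5
  ramsey {5} a≤ = shorter T6 LB-6
  ramsey {6} a≤ = shorter T7 LB-7
  ramsey {7} a≤ = shorter T8 LB-8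
  ramsey {8} a≤ = shorter T9 LB-9
  ramsey {9} {S} a≤ u ni = ≰⇒> λ 43≤ → no-43 {T9} LB-9 refl (APₚ.take⁺ 43 u)
    (NoInd-⊆ (All.tabulate (∈-take 43 S)) ni) (trans (Lₚ.length-take 43 S) (m≤n⇒m⊓n≡m 43≤))
  ramsey {suc (suc (suc (suc (suc (suc (suc (suc (suc (suc a)))))))))} a≤ = ⊥-elim (<⇒≱ (m≤m+n 10 a) a≤)

-- Colourings and deletion of colour classes

module Colouring {V : Set} (_≟_ : DecidableEquality V) (g : V → V → Bool)
  (g-sym : ∀ x y → g x y ≡ g y x) (g-irr : ∀ x → g x x ≡ false) where

  open DecMembership _≟_ using (_∈?_)

  Colourable : ℕ → List V → Set
  Colourable r S = ∃ λ (c : V → ℕ) → All (λ x → c x < r) S × (∀ {x y} → x ∈ S → y ∈ S → g x y ≡ true → c x ≢ c y)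

  NoClique : ℕ → List V → Set
  NoClique q S = ∀ K → AllPairs (λ x y → g x y ≡ true) K → All (_∈ S) K → length K < q

  NoClique-⊆ : ∀ {q S S′} → All (_∈ S) S′ → NoClique q S → NoClique q S′
  NoClique-⊆ sub nc K ap K⊆ = nc K ap (All.map (All.lookup sub) K⊆)

  Colourable-mono : ∀ {r r′ S} → r ≤ r′ → Colourable r S → Colourable r′ S
  Colourable-mono r≤ (c , c< , proper) = c , All.map (λ p → ≤-trans p r≤) c< , proper

  Colourable-↭ : ∀ {r S S′} → S ↭ S′ → Colourable r S → Colourable r S′
  Colourable-↭ p (c , c< , proper) = c , All-resp-↭ p c< , λ x∈ y∈ → proper (∈-resp-↭ (↭-sym p) x∈) (∈-resp-↭ (↭-sym p) y∈)

  add-class : ∀ {r} I {S} → (∀ {x y} → x ∈ I → y ∈ I → g x y ≡ false) → Colourable r S → Colourable (suc r) (I ++ S)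
  add-class {r} I {S} ind (c , c< , proper) = c′ , All.tabulate (λ x∈ → bounded (∈-++⁻ I x∈)) , λ x∈ y∈ → proper′ (∈-++⁻ I x∈) (∈-++⁻ I y∈)
    where
    c′ : V → ℕ
    c′ x with x ∈? I
    ... | yes _ = r
    ... | no _ = c x
    bounded : ∀ {x} → x ∈ I ⊎ x ∈ S → c′ x < suc r
    bounded {x} x∈ with x ∈? I
    ... | yes _ = ≤-refl
    bounded (inj₁ x∈) | no x∉ = ⊥-elim (x∉ x∈)
    bounded (inj₂ x∈) | no _ = m≤n⇒m≤1+n (All.lookup c< x∈)
    proper′ : ∀ {x y} → x ∈ I ⊎ x ∈ S → y ∈ I ⊎ y ∈ S → g x y ≡ true → c′ x ≢ c′ y
    proper′ {x} {y} x∈ y∈ xy e with x ∈? I | y ∈? I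
    proper′ x∈ y∈ xy e | yes x∈I | yes y∈I with () ← trans (sym xy) (ind x∈I y∈I)
    proper′ x∈ (inj₁ y∈) xy e | _ | no y∉ = y∉ y∈
    proper′ x∈ (inj₂ y∈) xy e | yes _ | no _ = <-irrefl (sym e) (All.lookup c< y∈)
    proper′ (inj₁ x∈) y∈ xy e | no x∉ | _ = x∉ x∈
    proper′ (inj₂ x∈) y∈ xy e | no _ | yes _ = <-irrefl e (All.lookup c< x∈)
    proper′ (inj₂ x∈) (inj₂ y∈) xy e | no _ | no _ = proper x∈ y∈ xy e

  Colourable-length : ∀ S → Colourable (length S) S
  Colourable-length [] = (λ _ → 0) , [] , λ ()
  Colourable-length (x ∷ S) = add-class (x ∷ []) (λ { (here refl) (here refl) → g-irr x }) (Colourable-length S)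

  ∈-clique : ∀ {q S x} → x ∈ S → NoClique (suc q) S → 1 ≤ q
  ∈-clique {x = x} x∈ nc = ≤-pred (nc (x ∷ []) ([] ∷ []) (x∈ ∷ []))

  -- The complement is restricted to S, so that the absence of independent triples in S makes it
  -- triangle-free on the whole type.
  module Complement (S : List V) where

    Co : V → V → Set
    Co x y = (x ∈ S × y ∈ S) × x ≢ y × g x y ≡ false

    co? : ∀ x y → Dec (Co x y)
    co? x y = ((x ∈? S) ×-dec (y ∈? S)) ×-dec (¬? (x ≟ y) ×-dec (g x y Boolₚ.≟ false))

    co : V → V → Bool
    co x y = does (co? x y)

    Co-sym : ∀ {x y} → Co x y → Co y x
    Co-sym {x} {y} ((x∈ , y∈) , ne , e) = (y∈ , x∈) , (λ q → ne (sym q)) , trans (g-sym y x) e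

    co-sym : ∀ x y → co x y ≡ co y x
    co-sym x y = does-⇔ (mk⇔ Co-sym Co-sym) (co? x y) (co? y x)

    co-irr : ∀ x → co x x ≡ false
    co-irr x = dec-false (co? x x) λ (_ , ne , _) → ne refl

    co⇒ : ∀ {x y} → co x y ≡ true → Co x y
    co⇒ {x} {y} = witness (co? x y)
      where
      witness : ∀ {P : Set} (P? : Dec P) → does P? ≡ true → P
      witness (yes p) _ = p

    co-none : ∀ {x y} → x ∈ S → y ∈ S → x ≢ y → co x y ≡ false → g x y ≡ true
    co-none {x} {y} x∈ y∈ ne e = Boolₚ.¬-not λ q → true≢false (trans (sym (dec-true (co? x y) ((x∈ , y∈) , ne , q))) e)

  Triple : List V → Set
  Triple S = ∃₂ λ x y → ∃ λ z → (x ∈ S × y ∈ S × z ∈ S) × (x ≢ y × x ≢ z × y ≢ z) × (g x y ≡ false × g x z ≡ false × g y z ≡ false)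

  module _ {S : List V} (u : Unique S) where

    remove-class : ∀ {r I R} → S ↭ I ++ R → (∀ {x y} → x ∈ I → y ∈ I → g x y ≡ false) → ¬ Colourable (suc r) S → ¬ Colourable r R
    remove-class {I = I} p ind nc col = nc (Colourable-↭ (↭-sym p) (add-class I ind col))

    -- Matched pairs of the complement and single unmatched vertices are colour classes, k + δ in
    -- number. As r colours do not suffice, r < k + δ, and adding `bound d ≤ k` gives the order 2 k
    -- + δ.
    without-triple : ∀ {r ω d} → ¬ Triple S → ¬ Colourable r S → NoClique (suc ω) S → ω + d ≤ suc r → d ≤ 13 → suc r + bound d ≤ length S
    without-triple {r} {ω} {d} nt ncol nclq ω+d≤ d≤ = decidable-stable (_ ≤? _) λ short → ¬¬-maximum S λ (δ , max) → short (at-maximum δ max)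
      where
      open Complement S
      tf : ∀ {x y z} → co x y ≡ true → co x z ≡ true → co y z ≡ true → ⊥
      tf {x} {y} {z} p q s with (x∈ , y∈) , ne₁ , e₁ ← co⇒ p | (_ , z∈) , ne₂ , e₂ ← co⇒ q | _ , ne₃ , e₃ ← co⇒ s =
        nt (x , y , z , (x∈ , y∈ , z∈) , (ne₁ , ne₂ , ne₃) , (e₁ , e₂ , e₃))
      open MatchingNumber _≟_ co co-sym co-irr tf
      open Bound (SmallRamseyNumbers.ramsey _≟_ co co-sym co-irr tf)
      open TriangleFree co co-sym co-irr tf using (NoInd; Anti)
      open Matchings _≟_ co co-sym co-irr
      ni : NoInd (suc ω) S
      ni I ap I⊆ = nclq I (cliques I⊆ ap) I⊆
        where
        cliques : ∀ {I} → All (_∈ S) I → AllPairs Anti I → AllPairs (λ x y → g x y ≡ true) I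
        cliques [] [] = []
        cliques (x∈ ∷ I⊆) (as ∷ ap) = All.zipWith (λ (y∈ , ne , e) → co-none x∈ y∈ ne e) (I⊆ , as) ∷ cliques I⊆ ap
      colour-pairs : ∀ ps {X r} → All (λ p → co (proj₁ p) (proj₂ p) ≡ true) ps → Colourable r X → Colourable (length ps + r) (flatten ps ++ X)
      colour-pairs [] [] col = col
      colour-pairs ((x , y) ∷ ps) (e ∷ es) col = add-class (x ∷ y ∷ []) ind (colour-pairs ps es col)
        where
        ind : ∀ {v w} → v ∈ x ∷ y ∷ [] → w ∈ x ∷ y ∷ [] → g v w ≡ false
        ind (here refl) (here refl) = g-irr x
        ind (here refl) (there (here refl)) = proj₂ (proj₂ (co⇒ e))
        ind (there (here refl)) (here refl) = proj₂ (proj₂ (co⇒ (trans (co-sym y x) e)))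
        ind (there (here refl)) (there (here refl)) = g-irr y
      at-maximum : ∀ δ → IsMaximum S δ → suc r + bound d ≤ length S
      at-maximum δ max@((m , M , def) , _) = begin
        suc r + bound d   ≤⟨ +-mono-≤ r< (bound≤matching u max len ni (≤-trans ω+d≤ r<) d≤) ⟩
        k + δ + k         ≡⟨ regroup k δ ⟩
        2 * k + δ         ≡⟨ sym len ⟩
        length S          ∎
        where
        open ≤-Reasoning
        open Pairing
        P : Pairing S (defect m S)
        P = pairing (length S) ≤-refl u M
        k : ℕ
        k = length (pairs P)
        singles-δ : length (singles P) ≡ δ
        singles-δ = trans (singles≡ P) def
        len : length S ≡ 2 * k + δ
        len = trans (sym (↭-length (perm P))) (trans (Lₚ.length-++ (flatten (pairs P))) (cong₂ _+_ (length-flatten (pairs P)) singles-δ))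
        r< : r < k + δ
        r< = ≰⇒> λ k+δ≤ → ncol (Colourable-mono k+δ≤ (subst (λ δ → Colourable (k + δ) S) singles-δ
          (Colourable-↭ (perm P) (colour-pairs (pairs P) (edges P) (Colourable-length (singles P))))))
        regroup : ∀ k δ → k + δ + k ≡ 2 * k + δ
        regroup = solve 2 (λ k δ → k :+ δ :+ k := con 2 :* k :+ δ) refl
          where open +-*-Solver

  d≤r : ∀ {S r ω d x} → x ∈ S → NoClique (suc ω) S → ω + d ≤ suc r → d ≤ r
  d≤r x∈ nclq le = ≤-pred (≤-trans (+-monoˡ-≤ _ (∈-clique x∈ nclq)) le)

  -- r + 1 stands for the chromatic number, ω for the clique number and d for their difference.
  -- One-sided bounds are used throughout, so that deleting a colour class preserves the hypotheses.
  Extremal : ℕ → Set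
  Extremal d = ∀ {S r ω} → Unique S → ¬ Colourable r S → NoClique (suc ω) S → ω + d ≤ suc r → suc r + bound d ≤ length S

  ω+d-pred : ∀ ω d {r} → ω + suc d ≤ suc (suc r) → ω + d ≤ suc r
  ω+d-pred ω d le = ≤-pred (≤-trans (≤-reflexive (sym (+-suc ω d))) le)

  three : ∀ {S} → Unique S → Triple S → ∃₂ λ x y → ∃₂ λ z R → S ↭ x ∷ y ∷ z ∷ R × (g x y ≡ false × g x z ≡ false × g y z ≡ false)
  three u (x , y , z , (x∈ , y∈ , z∈) , (ne₁ , ne₂ , ne₃) , es) with S₁ , p₁ ← ∈⇒↭∷ x∈ with ∈-resp-↭ p₁ y∈ | ∈-resp-↭ p₁ z∈
  ... | here e | _ = ⊥-elim (ne₁ (sym e))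
  ... | there _ | here e = ⊥-elim (ne₂ (sym e))
  ... | there y∈₁ | there z∈₁ with S₂ , p₂ ← ∈⇒↭∷ y∈₁ with ∈-resp-↭ p₂ z∈₁
  ...   | here e = ⊥-elim (ne₃ (sym e))
  ...   | there z∈₂ with S₃ , p₃ ← ∈⇒↭∷ z∈₂ = x , y , z , S₃ , ↭-trans p₁ (prep x (↭-trans p₂ (prep y p₃))) , es

  independent₃ : ∀ {x y z} → g x y ≡ false → g x z ≡ false → g y z ≡ false → ∀ {v w} → v ∈ x ∷ y ∷ z ∷ [] → w ∈ x ∷ y ∷ z ∷ [] → g v w ≡ false
  independent₃ {x} {y} {z} xy xz yz = ind
    where
    ind : ∀ {v w} → v ∈ x ∷ y ∷ z ∷ [] → w ∈ x ∷ y ∷ z ∷ [] → g v w ≡ false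
    ind (here refl) (here refl) = g-irr x
    ind (here refl) (there (here refl)) = xy
    ind (here refl) (there (there (here refl))) = xz
    ind (there (here refl)) (here refl) = trans (g-sym y x) xy
    ind (there (here refl)) (there (here refl)) = g-irr y
    ind (there (here refl)) (there (there (here refl))) = yz
    ind (there (there (here refl))) (here refl) = trans (g-sym z x) xz
    ind (there (there (here refl))) (there (here refl)) = trans (g-sym z y) yz
    ind (there (there (here refl))) (there (there (here refl))) = g-irr z

  -- The triple serves as one colour class: r and d drop by one, and three vertices pay for one
  -- colour and a step of at most 2 in `bound`. The case r = 0 is void, because a nonempty S has ω ≥
  -- 1.
  with-triple : ∀ {d} → Extremal d → ∀ {S r ω} → Unique S → ¬ Colourable r S → NoClique (suc ω) S → ω + suc d ≤ suc r → Triple S → suc r + bound (suc d) ≤ length S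
  with-triple {d} ext {S} {zero} u ncol nclq le t with () ← d≤r (proj₁ (proj₁ (proj₂ (proj₂ (proj₂ t))))) nclq le
  with-triple {d} ext {S} {suc r} {ω} u ncol nclq le t with x , y , z , R , p , xy , xz , yz ← three u t = begin
    suc (suc r) + bound (suc d)      ≤⟨ +-monoʳ-≤ (suc (suc r)) (bound-suc d) ⟩
    suc (suc r) + (2 + bound d)      ≡⟨ regroup r (bound d) ⟩
    3 + (suc r + bound d)            ≤⟨ +-monoʳ-≤ 3 (ext (drop₃ (Unique-↭ p u)) (remove-class u {I = x ∷ y ∷ z ∷ []} p (independent₃ xy xz yz) ncol)
                                          (NoClique-⊆ (All.tabulate λ q → ∈-resp-↭ (↭-sym p) (there (there (there q)))) nclq) (ω+d-pred ω d le)) ⟩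
    3 + length R                     ≡⟨ sym (↭-length p) ⟩
    length S                         ∎
    where
    open ≤-Reasoning
    drop₃ : ∀ {x y z R} → Unique (x ∷ y ∷ z ∷ R) → Unique R
    drop₃ (_ ∷ _ ∷ _ ∷ u) = u
    regroup : ∀ r b → suc (suc r) + (2 + b) ≡ 3 + (suc r + b)
    regroup = solve 2 (λ r b → con 2 :+ r :+ (con 2 :+ b) := con 3 :+ (con 1 :+ r :+ b)) refl
      where open +-*-Solver

  -- Otherwise S is a clique with at most ω ≤ r vertices, and r colours suffice.
  two-nonadjacent : ∀ {S r ω d} → Unique S → ¬ Colourable r S → NoClique (suc ω) S → ω + suc d ≤ suc r →
                    ¬ ¬ (∃₂ λ x y → ∃ λ R → S ↭ x ∷ y ∷ R × g x y ≡ false)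
  two-nonadjacent {S} {r} {ω} {d} u ncol nclq le none =
    ncol (Colourable-mono (≤-trans (≤-pred (nclq S (clique u λ x∈ y∈ ne → Boolₚ.¬-not λ e → none (pick x∈ y∈ ne e)) (All.tabulate id)))
      (≤-pred (≤-trans (≤-trans (≤-reflexive (+-comm 1 ω)) (+-monoʳ-≤ ω (s≤s z≤n))) le))) (Colourable-length S))
    where
    clique : ∀ {S} → Unique S → (∀ {x y} → x ∈ S → y ∈ S → x ≢ y → g x y ≡ true) → AllPairs (λ x y → g x y ≡ true) S
    clique [] h = []
    clique (x∉ ∷ u) h = All.tabulate (λ y∈ → h (here refl) (there y∈) (All.lookup x∉ y∈)) ∷ clique u λ x∈ y∈ → h (there x∈) (there y∈)
    pick : ∀ {x y} → x ∈ S → y ∈ S → x ≢ y → g x y ≡ false → ∃₂ λ x y → ∃ λ R → S ↭ x ∷ y ∷ R × g x y ≡ false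
    pick {x} {y} x∈ y∈ ne e with S₁ , p₁ ← ∈⇒↭∷ x∈ with ∈-resp-↭ p₁ y∈
    ... | here q = ⊥-elim (ne (sym q))
    ... | there y∈₁ with S₂ , p₂ ← ∈⇒↭∷ y∈₁ = x , y , S₂ , ↭-trans p₁ (prep x p₂) , e

  with-pair : ∀ {d} → Extremal d → bound (suc d) ≤ 1 + bound d → ∀ {S r ω} → Unique S → ¬ Colourable r S → NoClique (suc ω) S → ω + suc d ≤ suc r →
              (∃₂ λ x y → ∃ λ R → S ↭ x ∷ y ∷ R × g x y ≡ false) → suc r + bound (suc d) ≤ length S
  with-pair {d} ext b≤ {S} {zero} u ncol nclq le (x , _ , _ , p , _) with () ← d≤r (∈-resp-↭ (↭-sym p) (here refl)) nclq le
  with-pair {d} ext b≤ {S} {suc r} {ω} u ncol nclq le (x , y , R , p , xy) = begin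
    suc (suc r) + bound (suc d)      ≤⟨ +-monoʳ-≤ (suc (suc r)) b≤ ⟩
    suc (suc r) + (1 + bound d)      ≡⟨ regroup r (bound d) ⟩
    2 + (suc r + bound d)            ≤⟨ +-monoʳ-≤ 2 (ext (AllPairs.tail (AllPairs.tail (Unique-↭ p u))) (remove-class u {I = x ∷ y ∷ []} p ind ncol)
                                          (NoClique-⊆ (All.tabulate λ q → ∈-resp-↭ (↭-sym p) (there (there q))) nclq) (ω+d-pred ω d le)) ⟩
    2 + length R                     ≡⟨ sym (↭-length p) ⟩
    length S                         ∎
    where
    open ≤-Reasoning
    ind : ∀ {v w} → v ∈ x ∷ y ∷ [] → w ∈ x ∷ y ∷ [] → g v w ≡ false
    ind (here refl) (here refl) = g-irr x
    ind (here refl) (there (here refl)) = xy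
    ind (there (here refl)) (here refl) = trans (g-sym y x) xy
    ind (there (here refl)) (there (here refl)) = g-irr y
    regroup : ∀ r b → suc (suc r) + (1 + b) ≡ 2 + (suc r + b)
    regroup = solve 2 (λ r b → con 2 :+ r :+ (con 1 :+ b) := con 2 :+ (con 1 :+ r :+ b)) refl
      where open +-*-Solver

  -- The inequality is decidable, so its failure may be assumed; up to difference 13 this rules out
  -- triples without deciding whether one exists. Beyond 13, where `bound` grows by 1, a
  -- non-adjacent pair takes the place of the triple.
  extremal : ∀ d → Extremal d
  extremal zero {S} {r} u ncol nclq le = ≤-trans (≤-reflexive (+-identityʳ (suc r))) (≰⇒> λ S≤ → ncol (Colourable-mono S≤ (Colourable-length S)))
  extremal (suc d) {S} {r} u ncol nclq le with d ≤? 12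
  ... | yes d≤ = ≮⇒≥ λ short → <⇒≱ short (without-triple u (λ t → <⇒≱ short (with-triple (extremal d) u ncol nclq le t)) ncol nclq le (s≤s d≤))
  ... | no d≰ = ≮⇒≥ λ short → two-nonadjacent u ncol nclq le λ pair →
    <⇒≱ short (with-pair (extremal d) (≤-reflexive (bound-suc-large (≰⇒> d≰))) u ncol nclq le pair)

-- A circulant graph attaining the bound in (b)

distance : ℕ → ℕ → ℕ
distance a b = (a ∸ b) + (b ∸ a)

-- The circulant graph on ℤ/45 with connection set ±{6, 13, 20, 21, 22}.
circ : ℕ → ℕ → Bool
circ a b = connects (distance a b)
  where
  connects : ℕ → Bool
  -- Differences are not reduced modulo 45, so every d comes with 45 - d; the interval from 20 to 25
  -- contains six of the ten values.
  connects d = ((19 <ᵇ d) ∧ (d <ᵇ 26)) ∨ ((d ≡ᵇ 6) ∨ ((d ≡ᵇ 13) ∨ ((d ≡ᵇ 32) ∨ (d ≡ᵇ 39))))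

circ-sym : ∀ a b → circ a b ≡ circ b a
circ-sym a b rewrite +-comm (a ∸ b) (b ∸ a) = refl

noTriangle : ℕ → ℕ → ℕ → Bool
noTriangle a b c = not (circ a b ∧ (circ a c ∧ circ b c))

circ-triangleFree : ∀ {a b c} → a < 45 → b < 45 → c < 45 → circ a b ≡ true → circ a c ≡ true → circ b c ≡ true → ⊥
circ-triangleFree {a} {b} {c} a< b< c< p q r = true≢false (trans (sym checked) (cong₂ (λ x y → not (x ∧ y)) p (cong₂ _∧_ q r)))
  where
  checked : noTriangle a b c ≡ true
  checked = all-true (noTriangle a b) (all-true (λ b → all (noTriangle a b) (upTo 45))
    (all-true (λ a → all (λ b → all (noTriangle a b) (upTo 45)) (upTo 45)) {xs = upTo 45} refl (∈-upTo⁺ a<)) (∈-upTo⁺ b<)) (∈-upTo⁺ c<)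

-- Branches on whether the first vertex belongs to the set; a remainder that is too short ends the
-- branch, which keeps the evaluation small.
hasIndependent : ℕ → List ℕ → Bool
hasIndependent zero L = true
hasIndependent (suc m) [] = false
hasIndependent (suc m) (v ∷ L) =
  if length L <ᵇ m then false else (hasIndependent m (filterᵇ (not ∘ circ v) L) ∨ hasIndependent (suc m) L)

NonAdjacent : ℕ → ℕ → Set
NonAdjacent a b = a ≢ b × circ a b ≡ false

Detects : ℕ → List ℕ → Set
Detects m L = ∀ {I} → AllPairs NonAdjacent I → All (_∈ L) I → m ≤ length I → hasIndependent m L ≡ true

detects-∷ : ∀ {m v L} → Detects m (filterᵇ (not ∘ circ v) L) → Detects (suc m) L → Detects (suc m) (v ∷ L)
detects-∷ {m} {v} {L} with-v without-v {I} ap I⊆ m≤ with length L <ᵇ m in short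
... | true = ⊥-elim (<⇒≱ (s≤s (<ᵇ-true short)) (≤-trans m≤ (unique-length (AllPairs.map proj₁ ap) I⊆)))
... | false with v ∈?ℕ I
...   | no v∉ = trans (cong (hasIndependent m _ ∨_) (without-v ap (All.tabulate λ {x} x∈ → other x∈ (All.lookup I⊆ x∈)) m≤))
                  (Boolₚ.∨-zeroʳ _)
  where
  other : ∀ {x} → x ∈ I → x ∈ v ∷ L → x ∈ L
  other x∈ (here refl) = ⊥-elim (v∉ x∈)
  other x∈ (there q) = q
...   | yes v∈ with I′ , p ← ∈⇒↭∷ v∈ with AllPairs-↭ (λ {x} {y} (ne , e) → (λ q → ne (sym q)) , trans (circ-sym y x) e) p ap
...     | v-anti ∷ ap′ = cong (_∨ hasIndependent (suc m) L) (with-v ap′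
            (All.tabulate λ {x} x∈ → other x∈ (All.lookup v-anti x∈) (All.lookup I⊆ (∈-resp-↭ (↭-sym p) (there x∈))))
            (≤-pred (≤-trans m≤ (≤-reflexive (↭-length p)))))
  where
  other : ∀ {x} → x ∈ I′ → NonAdjacent v x → x ∈ v ∷ L → x ∈ filterᵇ (not ∘ circ v) L
  other x∈ (ne , e) (here q) = ⊥-elim (ne (sym q))
  other x∈ (ne , e) (there q) = ∈-filter⁺ (λ x → T? (not (circ v x))) q (subst (T ∘ not) (sym e) _)

hasIndependent-complete : ∀ m L → Detects m L
hasIndependent-complete zero L ap I⊆ m≤ = refl
hasIndependent-complete (suc m) [] {x ∷ I} ap (() ∷ _) m≤
hasIndependent-complete (suc m) (v ∷ L) = detects-∷ (hasIndependent-complete m _) (hasIndependent-complete (suc m) L)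

circ-independence : ∀ {I} → AllPairs NonAdjacent I → All (_< 45) I → length I ≤ 10
circ-independence {I} ap I< = ≮⇒≥ λ 10< → true≢false (sym (trans (sym none) (hasIndependent-complete 11 (upTo 45) ap (All.map ∈-upTo⁺ I<) 10<)))
  where
  none : hasIndependent 11 (upTo 45) ≡ false
  none = refl

-- The join of the complement of the circulant graph with a clique on the numbers from 45 on.
joined : ℕ → ℕ → Bool
joined a b = not (a ≡ᵇ b) ∧ not ((a <ᵇ 45) ∧ ((b <ᵇ 45) ∧ circ a b))

-- An independent set of the join is a single vertex of the clique or a clique of the triangle-free
-- circulant graph, so it weighs at most 2. With s clique vertices the total weight 45 + 2 s is more
-- than 22 + s colour classes can carry.
weight : ℕ → ℕ
weight a = if a <ᵇ 45 then 1 else 2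

joined-sym : ∀ a b → joined a b ≡ joined b a
joined-sym a b = cong₂ (λ x y → not x ∧ not y) (≡ᵇ-sym a b) (trans (∧-left (a <ᵇ 45) (b <ᵇ 45) (circ a b)) (cong (λ c → (b <ᵇ 45) ∧ ((a <ᵇ 45) ∧ c)) (circ-sym a b)))
  where
  ≡ᵇ-sym : ∀ a b → (a ≡ᵇ b) ≡ (b ≡ᵇ a)
  ≡ᵇ-sym zero zero = refl
  ≡ᵇ-sym zero (suc b) = refl
  ≡ᵇ-sym (suc a) zero = refl
  ≡ᵇ-sym (suc a) (suc b) = ≡ᵇ-sym a b
  ∧-left : ∀ x y z → x ∧ (y ∧ z) ≡ y ∧ (x ∧ z)
  ∧-left true y z = refl
  ∧-left false true z = refl
  ∧-left false false z = refl

joined-irrefl : ∀ a → joined a a ≡ false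
joined-irrefl a rewrite ≡ᵇ-refl a = refl

joined⇒nonAdjacent : ∀ {a b} → joined a b ≡ true → a < 45 → b < 45 → NonAdjacent a b
joined⇒nonAdjacent {a} {b} j a< b< =
  (λ { refl → true≢false (trans (sym j) (joined-irrefl a)) }) , unpack (a ≡ᵇ b) _ _ _ j (<⇒<ᵇ a<) (<⇒<ᵇ b<)
  where
  unpack : ∀ x y z c → not x ∧ not (y ∧ (z ∧ c)) ≡ true → T y → T z → c ≡ false
  unpack false true true false _ _ _ = refl

unjoined⇒adjacent : ∀ {a b} → a ≢ b → joined a b ≡ false → a < 45 × b < 45 × circ a b ≡ true
unjoined⇒adjacent {a} {b} ne j with a ≡ᵇ b in e | a <ᵇ 45 in p | b <ᵇ 45 in q | circ a b
... | true | _ | _ | _ = ⊥-elim (ne (≡ᵇ-true e))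
... | false | true | true | true = <ᵇ-true p , <ᵇ-true q , refl

circulantJoin : ∀ n → Graph n
circulantJoin n .adj x y = joined (toℕ x) (toℕ y)
circulantJoin n .adj-symmetric x y = joined-sym (toℕ x) (toℕ y)
circulantJoin n .adj-irreflexive x = joined-irrefl (toℕ x)

module _ {n : ℕ} where

  w : Fin n → ℕ
  w = weight ∘ toℕ

  class-weight : ∀ {P : List (Fin n)} → Unique P → (∀ {x y} → x ∈ P → y ∈ P → joined (toℕ x) (toℕ y) ≡ false) → ∑ w P ≤ 2
  class-weight {[]} u un = z≤n
  class-weight {x ∷ []} u un with toℕ x <ᵇ 45
  ... | true = s≤s z≤n
  ... | false = ≤-refl
  class-weight {x ∷ y ∷ P} ((x≢y ∷ x∉) ∷ y∉ ∷ u) un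
    with x< , y< , xy ← unjoined⇒adjacent (x≢y ∘ Finₚ.toℕ-injective) (un (here refl) (there (here refl))) = bounded P x∉ y∉ un
    where
    light : ∀ {a} → a < 45 → weight a ≡ 1
    light {a} a< with a <ᵇ 45 | <⇒<ᵇ a<
    ... | true | _ = refl
    bounded : ∀ P → All (x ≢_) P → All (y ≢_) P → (∀ {v w} → v ∈ x ∷ y ∷ P → w ∈ x ∷ y ∷ P → joined (toℕ v) (toℕ w) ≡ false) → ∑ w (x ∷ y ∷ P) ≤ 2
    bounded [] _ _ _ = ≤-reflexive (cong₂ (λ a b → a + (b + 0)) (light x<) (light y<))
    bounded (z ∷ P) (x≢z ∷ _) (y≢z ∷ _) un
      with _ , z< , xz ← unjoined⇒adjacent (x≢z ∘ Finₚ.toℕ-injective) (un (here refl) (there (there (here refl))))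
         | _ , _ , yz ← unjoined⇒adjacent (y≢z ∘ Finₚ.toℕ-injective) (un (there (here refl)) (there (there (here refl)))) =
      ⊥-elim (circ-triangleFree x< y< z< xy xz yz)

  colouring-weight : ∀ r (c : Fin n → ℕ) {S} → Unique S → All (λ x → c x < r) S →
                     (∀ {x y} → x ∈ S → y ∈ S → c x ≡ c y → joined (toℕ x) (toℕ y) ≡ false) → ∑ w S ≤ r * 2
  colouring-weight zero c {[]} u [] un = z≤n
  colouring-weight (suc r) c {S} u c< un = ≤-trans (≤-reflexive (∑-filter w top? S))
    (+-mono-≤ (class-weight (Uniqueₚ.filter⁺ top? u) λ x∈ y∈ → un (inˡ x∈) (inˡ y∈) (trans (atˡ x∈) (sym (atˡ y∈))))
              (colouring-weight r c (Uniqueₚ.filter⁺ (¬? ∘ top?) u) (All.tabulate below) λ x∈ y∈ → un (inʳ x∈) (inʳ y∈)))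
    where
    top? : ∀ x → Dec (c x ≡ r)
    top? x = c x ≟ℕ r
    inˡ : ∀ {x} → x ∈ filter top? S → x ∈ S
    inˡ = proj₁ ∘ ∈-filter⁻ top?
    atˡ : ∀ {x} → x ∈ filter top? S → c x ≡ r
    atˡ = proj₂ ∘ ∈-filter⁻ top? {xs = S}
    inʳ : ∀ {x} → x ∈ filter (¬? ∘ top?) S → x ∈ S
    inʳ = proj₁ ∘ ∈-filter⁻ (¬? ∘ top?)
    below : ∀ {x} → x ∈ filter (¬? ∘ top?) S → c x < r
    below x∈ = let x∈S , ne = ∈-filter⁻ (¬? ∘ top?) {xs = S} x∈ in ≤∧≢⇒< (≤-pred (All.lookup c< x∈S)) ne

totalWeight : ℕ → ℕ → ℕ
totalWeight k zero = 0
totalWeight k (suc n) = weight k + totalWeight (suc k) n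

∑-weight : ∀ n k {A : Set} (f : A → ℕ) (h : Fin n → A) → (∀ i → f (h i) ≡ weight (k + toℕ i)) → ∑ f (tabulate h) ≡ totalWeight k n
∑-weight zero k f h e = refl
∑-weight (suc n) k f h e = cong₂ _+_ (trans (e Fin.zero) (cong weight (+-identityʳ k)))
  (∑-weight n (suc k) f (h ∘ Fin.suc) λ i → trans (e (Fin.suc i)) (cong weight (+-suc k (toℕ i))))

totalWeight-heavy : ∀ s j → totalWeight (45 + j) s ≡ s * 2
totalWeight-heavy zero j = refl
totalWeight-heavy (suc s) j = cong (2 +_) (totalWeight-heavy s (suc j))

totalWeight-45 : ∀ s → totalWeight 0 (45 + s) ≡ 45 + s * 2
totalWeight-45 s = cong (45 +_) (totalWeight-heavy s 0)

circulantJoin-arrows : ∀ {n r} → r * 2 < totalWeight 0 n → VArrows (circulantJoin n) r (twos r)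
circulantJoin-arrows {n} {r} heavy c with Finₚ.any? (λ x → Finₚ.any? (λ y → (joined (toℕ x) (toℕ y) Boolₚ.≟ true) ×-dec (c x Finₚ.≟ c y)))
... | yes (x , y , j , e) = c x , ends , clique , λ { Fin.zero → refl ; (Fin.suc Fin.zero) → sym e }
  where
  ends : Fin 2 → Fin _
  ends Fin.zero = x
  ends (Fin.suc Fin.zero) = y
  clique : IsClique (circulantJoin _) 2 ends
  clique Fin.zero Fin.zero ne = ⊥-elim (ne refl)
  clique Fin.zero (Fin.suc Fin.zero) _ = j
  clique (Fin.suc Fin.zero) Fin.zero _ = trans (joined-sym (toℕ y) (toℕ x)) j
  clique (Fin.suc Fin.zero) (Fin.suc Fin.zero) ne = ⊥-elim (ne refl)
... | no none = ⊥-elim (<⇒≱ heavy (≤-trans (≤-reflexive (sym (∑-weight n 0 w id (λ _ → refl))))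
  (colouring-weight r (toℕ ∘ c) (Uniqueₚ.allFin⁺ n) (All.universal (Finₚ.toℕ<n ∘ c) _) (λ _ _ e → not-joined (Finₚ.toℕ-injective e)))))
  where
  not-joined : ∀ {x y} → c x ≡ c y → joined (toℕ x) (toℕ y) ≡ false
  not-joined {x} {y} e with joined (toℕ x) (toℕ y) in j
  ... | true = ⊥-elim (none (x , y , j , e))
  ... | false = refl

circulantJoin-cliqueLt : ∀ s {n q} → n ≡ 45 + s → q ≡ 11 + s → CliqueLt (circulantJoin n) q
circulantJoin-cliqueLt s {n} {q} n≡ q≡ (f , clique) = <⇒≱ (≤-reflexive (sym q≡)) (begin
  q                       ≡⟨ sym (Lₚ.length-tabulate (toℕ ∘ f)) ⟩
  length K                ≡⟨ trans (sym (∑-ones {xs = K} (All.universal (λ _ → refl) _))) (trans (∑-filter (λ _ → 1) (_<? 45) K) (cong₂ _+_ (∑-ones {xs = I} (All.universal (λ _ → refl) _)) (∑-ones {xs = C} (All.universal (λ _ → refl) _)))) ⟩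
  length I + length C     ≤⟨ +-mono-≤ (circ-independence indI (Allₚ.all-filter (_<? 45) K)) C≤ ⟩
  10 + s                  ∎)
  where
  open ≤-Reasoning
  K I C : List ℕ
  K = tabulate (toℕ ∘ f)
  I = filter (_<? 45) K
  C = filter (¬? ∘ (_<? 45)) K
  joinedK : AllPairs (λ a b → joined a b ≡ true) K
  joinedK = APₚ.tabulate⁺ λ i≢j → clique _ _ i≢j
  joined⇒≢ : ∀ {a b} → joined a b ≡ true → a ≢ b
  joined⇒≢ {a} j refl = true≢false (trans (sym j) (joined-irrefl a))
  indI : AllPairs NonAdjacent I
  indI = strengthen (Allₚ.all-filter (_<? 45) K) (APₚ.filter⁺ (_<? 45) joinedK)
    where
    strengthen : ∀ {X} → All (_< 45) X → AllPairs (λ a b → joined a b ≡ true) X → AllPairs NonAdjacent X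
    strengthen [] [] = []
    strengthen (p ∷ ps) (js ∷ jss) = All.zipWith (λ (j , q) → joined⇒nonAdjacent j p q) (js , ps) ∷ strengthen ps jss
  C≤ : length C ≤ s
  C≤ = ≤-trans (unique-length (AllPairs.map joined⇒≢ (APₚ.filter⁺ (¬? ∘ (_<? 45)) joinedK)) (All.zipWith place
      (Allₚ.all-filter (¬? ∘ (_<? 45)) K , Allₚ.filter⁺ (¬? ∘ (_<? 45)) (Allₚ.tabulate⁺ (λ i → <-≤-trans (Finₚ.toℕ<n (f i)) (≤-reflexive n≡))))))
    (≤-reflexive (trans (Lₚ.length-map (45 +_) (upTo s)) (Lₚ.length-upTo s)))
    where
    place : ∀ {a} → (¬ a < 45) × a < 45 + s → a ∈ map (45 +_) (upTo s)
    place {a} (a≮ , a<) = subst (_∈ map (45 +_) (upTo s)) (m+[n∸m]≡n (≮⇒≥ a≮))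
      (∈-map⁺ (45 +_) (∈-upTo⁺ (+-cancelˡ-< 45 _ _ (subst (_< 45 + s) (sym (m+[n∸m]≡n (≮⇒≥ a≮))) a<))))

-- Passage to the arrow relation

lookup-pairs : {A : Set} {R : A → A → Set} → (∀ {x y} → R x y → R y x) → ∀ {xs} → AllPairs R xs →
               ∀ i j → i ≢ j → R (lookup xs i) (lookup xs j)
lookup-pairs s (p ∷ ps) Fin.zero Fin.zero ne = ⊥-elim (ne refl)
lookup-pairs s (p ∷ ps) Fin.zero (Fin.suc j) ne = All.lookup p (∈-lookup j)
lookup-pairs s (p ∷ ps) (Fin.suc i) Fin.zero ne = s (All.lookup p (∈-lookup i))
lookup-pairs s (p ∷ ps) (Fin.suc i) (Fin.suc j) ne = lookup-pairs s ps i j (ne ∘ cong Fin.suc)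

module _ {n} (G : Graph n) where
  open Colouring Finₚ._≟_ (adj G) (adj-symmetric G) (adj-irreflexive G)

  arrows⇒¬Colourable : ∀ {r} → VArrows G r (twos r) → ¬ Colourable r (allFin n)
  arrows⇒¬Colourable {r} arrows (c , c< , proper) with arrows (λ x → fromℕ< (All.lookup c< (∈-allFin x)))
  ... | i , f , clique , same = proper (∈-allFin (f Fin.zero)) (∈-allFin (f (Fin.suc Fin.zero)))
    (clique Fin.zero (Fin.suc Fin.zero) λ ()) (Finₚ.fromℕ<-injective _ _ _ _ (trans (same Fin.zero) (sym (same (Fin.suc Fin.zero)))))

  cliqueLt⇒noClique : ∀ {q S} → CliqueLt G q → NoClique q S
  cliqueLt⇒noClique {q} none K ap _ = ≰⇒> λ q≤ → none ((λ i → lookup K (inject≤ i q≤)) , λ i j ne →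
    lookup-pairs (λ {x} {y} e → trans (adj-symmetric G y x) e) ap _ _ (ne ∘ Finₚ.inject≤-injective q≤ q≤ i j))

-- Take ω = r - k and the difference k + 1 in `extremal`. By 12 ≤ k this is in the linear range of
-- `bound`, and the order is at least (r + 1) + 9 + (k + 1).
lowerBound : ∀ {r k} → k ≤ r → 12 ≤ k → FvAtLeast r (twos r) (r ∸ k + 1) (r + k + 11)
lowerBound {r} {k} k≤ 12≤ n G (arrows , cliqueLt) = begin
  r + k + 11                    ≡⟨ regroup r k ⟩
  suc r + (9 + suc k)           ≡⟨ cong (suc r +_) (sym (bound-linear (s≤s 12≤))) ⟩
  suc r + bound (suc k)         ≤⟨ extremal (suc k) (Uniqueₚ.allFin⁺ n) (arrows⇒¬Colourable G arrows)
                                     (cliqueLt⇒noClique G (subst (CliqueLt G) (+-comm (r ∸ k) 1) cliqueLt))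
                                     (≤-reflexive (trans (+-suc (r ∸ k) k) (cong suc (m∸n+n≡m k≤)))) ⟩
  length (allFin n)             ≡⟨ Lₚ.length-tabulate {n = n} (λ i → i) ⟩
  n                             ∎
  where
  open ≤-Reasoning
  open Colouring Finₚ._≟_ (adj G) (adj-symmetric G) (adj-irreflexive G)
  regroup : ∀ r k → r + k + 11 ≡ suc r + (9 + suc k)
  regroup = solve 2 (λ r k → r :+ k :+ con 11 := con 1 :+ r :+ (con 9 :+ (con 1 :+ k))) refl
    where open +-*-Solver

-- With r = 22 + s the order is 45 + s, the total weight 45 + 2 s = 2 r + 1 just exceeds r classes
-- of weight 2, and cliques have at most 10 + s vertices, one less than r - 11.
attained : ∀ s → InHv (circulantJoin (22 + s + 23)) (22 + s) (twos (22 + s)) (22 + s ∸ 11)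
attained s = circulantJoin-arrows {22 + s + 23} {22 + s} (subst (λ n → (22 + s) * 2 < totalWeight 0 n) (sym order≡) (≤-reflexive (sym (totalWeight-45 s)))) ,
  circulantJoin-cliqueLt s order≡ refl
  where
  order≡ : 22 + s + 23 ≡ 45 + s
  order≡ = trans (cong (22 +_) (+-comm s 23)) refl

theorem1p4 : (r k : ℕ) → k + 2 ≤ r → 12 ≤ k →
    FvAtLeast r (twos r) (r ∸ k + 1) (r + k + 11)
    × (k ≡ 12 → 22 ≤ r → FvIs r (twos r) (r ∸ 11) (r + 23))
theorem1p4 r k k+2≤r 12≤k = lowerBound k≤r 12≤k , λ { refl 22≤r → (circulantJoin (r + 23) , attain 22≤r) , exact 22≤r }
  where
  k≤r : k ≤ r
  k≤r = ≤-trans (m≤m+n k 2) k+2≤r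
  attain : 22 ≤ r → InHv (circulantJoin (r + 23)) r (twos r) (r ∸ 11)
  attain 22≤r = subst (λ r → InHv (circulantJoin (r + 23)) r (twos r) (r ∸ 11)) (m+[n∸m]≡n 22≤r) (attained (r ∸ 22))
  exact : 22 ≤ r → FvAtLeast r (twos r) (r ∸ 11) (r + 23)
  exact 22≤r = subst₂ (FvAtLeast r (twos r)) clique-bound (+-assoc r 12 11) (lowerBound (≤-trans (m≤m+n 12 10) 22≤r) ≤-refl)
    where
    clique-bound : r ∸ 12 + 1 ≡ r ∸ 11
    clique-bound = trans (+-comm (r ∸ 12) 1) (sym (+-∸-assoc 1 (≤-trans (m≤m+n 12 10) 22≤r)))
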